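{- For every $0\le k\le n^2$, $$R^B_k\cong\bigoplus_{S_1,S_2} R^B_{\lambda_{S_1,S_2}}$$ as $B_n$-modules, where the sum is over all subsets $S_1\subseteq[n-1]$ and $S_2\subseteq[n]$ such that $\lambda_{S_1,S_2}$ is a partition (i.e. weakly decreasing) and $2\sum_{i\in S_1} i+|S_2|=k$.
   Context: $P_n=\mathbf{Q}[x_1,\dots,x_n]$. $B_n$ is the group of signed permutations of $[-n,n]\setminus\{0\}$ ($\sigma(-a)=-\sigma(a)$), acting on $P_n$ by $\sigma(x_i)=\mathrm{sign}(\sigma(i))\,x_{|\sigma(i)|}$. $I^B_n$ is the ideal generated by polynomials without constant term that are symmetric in $x_1^2,\dots,x_n^2$; $\psi^B:P_n\to P_n/I^B_n$ is the projection and $R^B_k$ the $k$-th homogeneous component of $P_n/I^B_n$. For a monomial $m=\prod x_i^{p_i}$, $\lambda(m)$ is $(p_1,\dots,p_n)$ sorted weakly decreasingly. For a partition $\lambda$ with at most $n$ parts, $P^{\trianglelefteq}_\lambda$ (resp. $P^{\triangleleft}_\lambda$) is the span of monomials $m$ with $\lambda(m)$ dominated (resp. strictly dominated) by $\lambda$, and $R^B_\lambda:=\psi^B(P^{\trianglelefteq}_\lambda)/\psi^B(P^{\triangleleft}_\lambda)$. For $S_1\subseteq[n-1]$, $S_2\subseteq[n]$, $\lambda_{S_1,S_2}\in\mathbf{N}^n$ has $i$-th entry $2|\{j\in S_1: j\ge i\}|+\mathbf{1}_{S_2}(i)$, where $\mathbf 1_{S_2}$ is the indicator of $S_2$. -}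

module Defs where

open import Data.Nat as ℕ using (ℕ; zero; suc; _∸_; _≤_)
open import Data.Nat.Properties using (≤-decTotalOrder)
open import Data.Rational as ℚ using (ℚ; 0ℚ; 1ℚ)
open import Data.Bool using (Bool; true; false; T; if_then_else_)
open import Data.Fin using (Fin; toℕ)
open import Data.Fin.Subset using (Subset; inside; outside; _∈_; ∣_∣)
open import Data.Fin.Permutation using (Permutation′; _⟨$⟩ʳ_; _⟨$⟩ˡ_)
open import Data.Vec as Vec using (Vec; lookup; tabulate; toList)
open import Data.Vec.Properties using (≡-dec)
open import Data.Nat.ListAction renaming (sum to sumℕ)
open import Data.List as List using (List; []; _∷_; map; concatMap; take; reverse; _++_)
open import Data.List.Sort.MergeSort ≤-decTotalOrder using (mergeSort)
open import Data.List.Sort.Base using (SortingAlgorithm)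
open import Data.Product using (Σ; ∃; _×_; _,_; proj₁; proj₂)
open import Relation.Nullary using (¬_; yes; no)
open import Relation.Binary.PropositionalEquality using (_≡_)

-- Polynomials in ℚ[x₁,…,xₙ]: finite formal sums of terms c·x^e, where
-- the exponent vector e : Vec ℕ n.  Two polynomials are equal iff all
-- their coefficients agree.

Monomial : ℕ → Set
Monomial n = Vec ℕ n

Poly : ℕ → Set
Poly n = List (ℚ × Monomial n)

module _ {n : ℕ} where

  coeff : Poly n → Monomial n → ℚ
  coeff [] m = 0ℚ
  coeff ((c , e) ∷ p) m with ≡-dec ℕ._≟_ e m
  ... | yes _ = c ℚ.+ coeff p m
  ... | no  _ = coeff p m

  _≈P_ : Poly n → Poly n → Set
  p ≈P q = ∀ m → coeff p m ≡ coeff q m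

  _+P_ : Poly n → Poly n → Poly n
  p +P q = p ++ q

  _·P_ : ℚ → Poly n → Poly n
  c ·P p = map (λ t → (c ℚ.* proj₁ t , proj₂ t)) p

  -P_ : Poly n → Poly n
  -P p = (ℚ.- 1ℚ) ·P p

  _-P_ : Poly n → Poly n → Poly n
  p -P q = p +P (-P q)

  _*P_ : Poly n → Poly n → Poly n
  p *P q = concatMap (λ s → map (λ t → (proj₁ s ℚ.* proj₁ t ,
                                        Vec.zipWith ℕ._+_ (proj₂ s) (proj₂ t))) q) p

  sumP : List (Poly n) → Poly n
  sumP = List.foldr _+P_ []

  zeroMono : Monomial n
  zeroMono = Vec.replicate n 0

  Occurs : Monomial n → Poly n → Set
  Occurs m p = ¬ (coeff p m ≡ 0ℚ)

-- The hyperoctahedral group Bₙ of signed permutations.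
-- σ = (π , ε) acts by σ(i) = ±π(i), with sign − iff ε i ≡ true.
-- On variables: σ(x_i) = sign(σ(i)) x_{|σ(i)|}, extended multiplicatively.

SignedPerm : ℕ → Set
SignedPerm n = Permutation′ n × (Fin n → Bool)

negPow : ℕ → ℚ → ℚ
negPow zero    c = c
negPow (suc s) c = ℚ.- negPow s c

module _ {n : ℕ} where

  -- σ(c·∏ x_i^{e_i}) = c·∏ (±x_{π i})^{e_i}
  actTerm : SignedPerm n → ℚ × Monomial n → ℚ × Monomial n
  actTerm (π , ε) (c , e) =
    ( negPow (sumℕ (toList (tabulate (λ i → if ε i then lookup e i else 0)))) c
    , tabulate (λ j → lookup e (π ⟨$⟩ˡ j)) )

  act : SignedPerm n → Poly n → Poly n
  act σ = map (actTerm σ)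

-- The ideal I^B_n: generated by the polynomials without constant term
-- that are symmetric in x₁²,…,xₙ² (i.e. invariant under Bₙ).

  SymInSquares : Poly n → Set
  SymInSquares g = ∀ (σ : SignedPerm n) → act σ g ≈P g

  NoConstTerm : Poly n → Set
  NoConstTerm g = coeff g zeroMono ≡ 0ℚ

  Generator : Poly n → Set
  Generator g = SymInSquares g × NoConstTerm g

  InIdeal : Poly n → Set
  InIdeal p = Σ (List (Poly n × Σ (Poly n) Generator)) λ gs →
                p ≈P sumP (map (λ t → proj₁ t *P proj₁ (proj₂ t)) gs)

sortDesc : List ℕ → List ℕ
sortDesc xs = reverse (SortingAlgorithm.sort mergeSort xs)

shape : {n : ℕ} → Monomial n → List ℕ
shape m = sortDesc (toList m)

_⊴_ : List ℕ → List ℕ → Set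
μ ⊴ ν = (sumℕ μ ≡ sumℕ ν) × (∀ j → sumℕ (take j μ) ≤ sumℕ (take j ν))

_◁_ : List ℕ → List ℕ → Set
μ ◁ ν = (μ ⊴ ν) × ¬ (μ ≡ ν)

IsPartition : List ℕ → Set
IsPartition [] = Data.Unit.⊤ where import Data.Unit
IsPartition (a ∷ []) = Data.Unit.⊤ where import Data.Unit
IsPartition (a ∷ b ∷ xs) = (b ≤ a) × IsPartition (b ∷ xs)

module _ {n : ℕ} where

  InDom : Vec ℕ n → Poly n → Set
  InDom lam p = ∀ m → Occurs m p → shape m ⊴ toList lam

  InSDom : Vec ℕ n → Poly n → Set
  InSDom lam p = ∀ m → Occurs m p → shape m ◁ toList lam

  InIdealPlus : (Poly n → Set) → Poly n → Set
  InIdealPlus A p = Σ (Poly n) λ a → Σ (Poly n) λ b → InIdeal a × A b × (p ≈P (a +P b))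

  Homogeneous : ℕ → Poly n → Set
  Homogeneous k p = ∀ m → Occurs m p → sumℕ (toList m) ≡ k

-- Bₙ-representations over ℚ presented by representatives:
-- a carrier, the predicate picking out valid representatives, an
-- equivalence on them, and the (representative-level) operations.

record Rep (n : ℕ) : Set₁ where
  field
    Carrier : Set
    Elem    : Carrier → Set
    _≈_     : Carrier → Carrier → Set
    _⊕_     : Carrier → Carrier → Carrier
    _⊙_     : ℚ → Carrier → Carrier
    actR    : SignedPerm n → Carrier → Carrier

record RepIso {n : ℕ} (A B : Rep n) : Set where
  private
    module A = Rep A
    module B = Rep B
  field
    f         : A.Carrier → B.Carrier
    f-elem    : ∀ x → A.Elem x → B.Elem (f x)
    f-cong    : ∀ x y → A.Elem x → A.Elem y → A._≈_ x y → B._≈_ (f x) (f y)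
    f-add     : ∀ x y → A.Elem x → A.Elem y → B._≈_ (f (A._⊕_ x y)) (B._⊕_ (f x) (f y))
    f-scale   : ∀ c x → A.Elem x → B._≈_ (f (A._⊙_ c x)) (B._⊙_ c (f x))
    f-equiv   : ∀ σ x → A.Elem x → B._≈_ (f (A.actR σ x)) (B.actR σ (f x))
    f-inj     : ∀ x y → A.Elem x → A.Elem y → B._≈_ (f x) (f y) → A._≈_ x y
    f-surj    : ∀ y → B.Elem y → Σ A.Carrier λ x → A.Elem x × B._≈_ (f x) y

_≅Rep_ : {n : ℕ} → Rep n → Rep n → Set
A ≅Rep B = RepIso A B

RBdeg : (n k : ℕ) → Rep n
RBdeg n k = record
  { Carrier = Poly n
  ; Elem    = Homogeneous k
  ; _≈_     = λ p q → InIdeal (p -P q)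
  ; _⊕_     = _+P_
  ; _⊙_     = _·P_
  ; actR    = act
  }

-- λ_{S₁,S₂}.  S₁ ⊆ [n-1] is a Subset (n ∸ 1), index j ↔ element j+1;
-- S₂ ⊆ [n] is a Subset n, index i ↔ element i+1.

countIn : {m : ℕ} → Subset m → (Fin m → Bool) → ℕ
countIn {m} S P = sumℕ (toList (tabulate (λ j → if P j then (if ⌊ j ∈? S ⌋ then 1 else 0) else 0)))
  where open import Data.Fin.Subset.Properties using (_∈?_)
        open import Relation.Nullary.Decidable using (⌊_⌋)

indicator : {m : ℕ} → Subset m → Fin m → ℕ
indicator S i = if ⌊ i ∈? S ⌋ then 1 else 0
  where open import Data.Fin.Subset.Properties using (_∈?_)
        open import Relation.Nullary.Decidable using (⌊_⌋)

lamS : (n : ℕ) → Subset (n ∸ 1) → Subset n → Vec ℕ n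
lamS n S₁ S₂ = tabulate (λ i →
  2 ℕ.* countIn S₁ (λ j → ⌊ toℕ i ℕ.≤? toℕ j ⌋) ℕ.+ indicator S₂ i)
  where open import Relation.Nullary.Decidable using (⌊_⌋)

-- Σ_{i ∈ S₁} i  (elements of [n-1] are toℕ j + 1)
sumElems : {m : ℕ} → Subset m → ℕ
sumElems {m} S = sumℕ (toList (tabulate (λ j → indicator S j ℕ.* suc (toℕ j))))

Valid : (n k : ℕ) → Subset (n ∸ 1) → Subset n → Set
Valid n k S₁ S₂ = IsPartition (toList (lamS n S₁ S₂)) × (2 ℕ.* sumElems S₁ ℕ.+ ∣ S₂ ∣ ≡ k)

-- R^B_λ = ψ(P^⊴_λ) / ψ(P^◁_λ), presented by representatives
-- p ∈ I + P^⊴_λ, with p ~ q iff p − q ∈ I + P^◁_λ.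

RBlam : (n : ℕ) → Vec ℕ n → Rep n
RBlam n lam = record
  { Carrier = Poly n
  ; Elem    = InIdealPlus (InDom lam)
  ; _≈_     = λ p q → InIdealPlus (InSDom lam) (p -P q)
  ; _⊕_     = _+P_
  ; _⊙_     = _·P_
  ; actR    = act
  }

-- ⊕_{(S₁,S₂) valid} R^B_{λ_{S₁,S₂}}: families indexed by all (S₁,S₂);
-- only the components at valid indices matter.
DirectSum : (n k : ℕ) → Rep n
DirectSum n k = record
  { Carrier = Subset (n ∸ 1) → Subset n → Poly n
  ; Elem    = λ F → ∀ S₁ S₂ → Valid n k S₁ S₂ → Rep.Elem (RBlam n (lamS n S₁ S₂)) (F S₁ S₂)
  ; _≈_     = λ F G → ∀ S₁ S₂ → Valid n k S₁ S₂ → Rep._≈_ (RBlam n (lamS n S₁ S₂)) (F S₁ S₂) (G S₁ S₂)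
  ; _⊕_     = λ F G S₁ S₂ → F S₁ S₂ +P G S₁ S₂
  ; _⊙_     = λ c F S₁ S₂ → c ·P F S₁ S₂
  ; actR    = λ σ F S₁ S₂ → act σ (F S₁ S₂)
  }

{-# OPTIONS --safe #-}
module Submission where

-- Write the exponent vector of a monomial uniquely as b + 2c, where b is the exponent of a descent monomial
-- and c is weakly decreasing in the order in which b sorts the indices.  By the rearrangement inequality,
-- b times the orbit sum of x^(2c) has leading term b + 2c, its other terms having dominated shapes.  These
-- products are therefore a basis of the polynomial ring, and those with c ≠ 0 span the ideal: every generator
-- is a combination of orbit sums.  This yields a linear normal form N with kernel the ideal, whose values are
-- supported on descent monomials and which does not increase shapes in dominance order; moreover descent
-- monomials have shapes λ_{S₁,S₂}.  Reading off the component of shape λ of N splits the projection onto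
-- R^B_λ, averaging over the group makes the splitting equivariant, and unitriangularity with respect to
-- dominance makes the sum of these splittings bijective.

open import Defs
open import Data.Bool using (Bool; true; false; if_then_else_; _xor_; _∧_)
import Data.Bool.Properties as Boolₚ
open import Data.Empty using (⊥; ⊥-elim)
open import Data.Fin as Fin using (Fin; zero; suc; toℕ; opposite; punchIn; inject₁; fromℕ; fromℕ<)
import Data.Fin.Properties as Finₚ
open import Data.Fin.Permutation as FP using (Permutation′; _⟨$⟩ʳ_; _⟨$⟩ˡ_; _∘ₚ_)
open import Data.Fin.Subset using (Subset; ∣_∣)
open import Data.Fin.Subset.Properties using (_∈?_)
open import Data.List as List using (List; []; _∷_; _++_; map; concatMap; filter; length; allFin; take; reverse; cartesianProduct; cartesianProductWith)
open import Data.List.Properties using (map-tabulate; map-∘; map-cong; unfold-reverse)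
  renaming (≡-dec to ≡-decList)
open import Data.List.Membership.Propositional using (_∈_)
open import Data.List.Membership.Propositional.Properties using (∈-map⁺; ∈-map⁻; ∈-allFin; ∈-filter⁺; ∈-filter⁻; ∈-cartesianProductWith⁺; ∈-cartesianProduct⁺; ∈-∃++)
open import Data.List.Membership.Propositional.Properties.WithK using (unique∧set⇒bag)
open import Data.List.Relation.Binary.BagAndSetEquality using (∼bag⇒↭)
open import Data.List.Relation.Binary.Permutation.Propositional as Perm using (_↭_; ↭-sym; ↭-trans)
import Data.List.Relation.Binary.Permutation.Propositional.Properties as Permₚ
open import Data.List.Relation.Unary.All as All using (All; []; _∷_)
import Data.List.Relation.Unary.All.Properties as Allₚ
open import Data.List.Relation.Unary.AllPairs using (AllPairs; []; _∷_)
import Data.List.Relation.Unary.AllPairs.Properties as AllPairsₚ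
open import Data.List.Relation.Unary.Any using (here; there)
open import Data.List.Relation.Unary.Sorted.TotalOrder.Properties using (Sorted⇒AllPairs)
open import Data.List.Relation.Unary.Unique.Propositional using (Unique)
import Data.List.Relation.Unary.Unique.Propositional.Properties as Uniqueₚ
open import Data.Nat as ℕ using (ℕ; zero; suc; _+_; _*_; _∸_; _≤_; _<_; z≤n; s≤s; _≤?_; _<?_; ⌊_/2⌋)
import Data.Nat.Properties as ℕₚ
open import Data.Nat.DivMod using ([m+kn]%n≡m%n; m<n⇒m%n≡m; _%_)
open import Data.Nat.Induction using (<-rec)
open import Data.Nat.ListAction using () renaming (sum to sumℕ)
open import Data.Nat.ListAction.Properties using (sum-↭)
open import Data.Nat.Solver using () renaming (module +-*-Solver to ℕ-Solver)
open import Data.List.Sort.Base using (SortingAlgorithm)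
open import Data.List.Sort.MergeSort ℕₚ.≤-decTotalOrder using (mergeSort)
open import Data.Product using (Σ; ∃; _×_; _,_; proj₁; proj₂)
import Data.Product.Properties as Productₚ
open import Data.Rational as ℚ using (ℚ; 0ℚ; 1ℚ; ½)
import Data.Rational.Properties as ℚₚ
open import Data.Rational.Solver using (module +-*-Solver)
open import Data.Sum as Sum using (_⊎_; inj₁; inj₂)
open import Data.Unit using (⊤; tt)
open import Data.Vec as Vec using (Vec; []; _∷_; lookup; tabulate; toList)
open import Data.Vec.Properties as Vecₚ using (≡-dec; lookup∘tabulate; tabulate∘lookup; tabulate-cong; lookup-zipWith; lookup-replicate; lookup-map; length-toList; ∷-injective)
open import Function using (_∘_; id; mk⇔)
open import Level using (0ℓ)
open import Relation.Binary.Definitions using (Tri)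
open import Relation.Binary.PropositionalEquality hiding ([_]; resp)
open import Relation.Nullary using (¬_; Dec; yes; no; does)
open import Relation.Nullary.Decidable using (⌊_⌋; isYes≗does; decidable-stable; _×-dec_; _→-dec_; _⊎-dec_; ¬?)
open import Relation.Unary using (Pred; Decidable)

-- The other terms of b times the orbit sum of x^(2c) may have the same shape as the leading one, as
-- x_2^2 has with x_1^2, so dominance alone cannot order the reduction. What strictly drops is
-- `energy`: n times it is the sum of the squares of the keys, less a constant. Dominance is tracked
-- alongside, to locate the normal forms.
--
-- N is linear but not multiplicative, so for a generator g it is not evident that N kills p g.
-- Expanding p in the basis and absorbing its orbit sums into g leaves products b g, where g is
-- itself a combination of orbit sums.
--
-- N depends on how ties between indices are broken: for n = 2 it sends x_1^2 to -x_2^2 but fixes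
-- x_2^2. Hence the component of shape λ is not equivariant by itself. An average of splittings is
-- again a splitting, which is what makes averaging legitimate.
--
-- The averaged splittings send null representatives to zero as polynomials, and not only modulo the
-- ideal. The isomorphism is therefore built from the direct sum to the graded component.
-- Injectivity is proved from the most dominant shapes downward, surjectivity from the least
-- dominant upward.

private variable
  A B : Set

-- Finite sums of rationals.

∑ : List A → (A → ℚ) → ℚ
∑ []       F = 0ℚ
∑ (x ∷ xs) F = F x ℚ.+ ∑ xs F

∑-cong : {F G : A → ℚ} (xs : List A) → (∀ x → F x ≡ G x) → ∑ xs F ≡ ∑ xs G
∑-cong []       e = refl
∑-cong (x ∷ xs) e = cong₂ ℚ._+_ (e x) (∑-cong xs e)

∑-0 : (xs : List A) → ∑ xs (λ _ → 0ℚ) ≡ 0ℚ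
∑-0 []       = refl
∑-0 (x ∷ xs) = trans (ℚₚ.+-identityˡ _) (∑-0 xs)

∑-++ : (F : A → ℚ) (xs ys : List A) → ∑ (xs ++ ys) F ≡ ∑ xs F ℚ.+ ∑ ys F
∑-++ F []       ys = sym (ℚₚ.+-identityˡ _)
∑-++ F (x ∷ xs) ys = trans (cong (F x ℚ.+_) (∑-++ F xs ys)) (sym (ℚₚ.+-assoc (F x) _ _))

∑-map : (F : B → ℚ) (h : A → B) (xs : List A) → ∑ (map h xs) F ≡ ∑ xs (F ∘ h)
∑-map F h []       = refl
∑-map F h (x ∷ xs) = cong (F (h x) ℚ.+_) (∑-map F h xs)

∑-concatMap : (F : B → ℚ) (h : A → List B) (xs : List A) →
              ∑ (concatMap h xs) F ≡ ∑ xs (λ x → ∑ (h x) F)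
∑-concatMap F h []       = refl
∑-concatMap F h (x ∷ xs) = trans (∑-++ F (h x) _) (cong (∑ (h x) F ℚ.+_) (∑-concatMap F h xs))

+-interchange : ∀ a b c d → (a ℚ.+ b) ℚ.+ (c ℚ.+ d) ≡ (a ℚ.+ c) ℚ.+ (b ℚ.+ d)
+-interchange = solve 4 (λ a b c d → (a :+ b) :+ (c :+ d) := (a :+ c) :+ (b :+ d)) refl
  where open +-*-Solver

+-leftComm : ∀ a b c → a ℚ.+ (b ℚ.+ c) ≡ b ℚ.+ (a ℚ.+ c)
+-leftComm = solve 3 (λ a b c → a :+ (b :+ c) := b :+ (a :+ c)) refl
  where open +-*-Solver

∑-+ : (F G : A → ℚ) (xs : List A) → ∑ xs (λ x → F x ℚ.+ G x) ≡ ∑ xs F ℚ.+ ∑ xs G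
∑-+ F G []       = refl
∑-+ F G (x ∷ xs) = trans (cong (F x ℚ.+ G x ℚ.+_) (∑-+ F G xs)) (+-interchange (F x) (G x) _ _)

∑-* : (c : ℚ) (F : A → ℚ) (xs : List A) → ∑ xs (λ x → c ℚ.* F x) ≡ c ℚ.* ∑ xs F
∑-* c F []       = sym (ℚₚ.*-zeroʳ c)
∑-* c F (x ∷ xs) = trans (cong (c ℚ.* F x ℚ.+_) (∑-* c F xs)) (sym (ℚₚ.*-distribˡ-+ c (F x) _))

∑-swap : (F : A → B → ℚ) (xs : List A) (ys : List B) →
         ∑ xs (λ x → ∑ ys (F x)) ≡ ∑ ys (λ y → ∑ xs (λ x → F x y))
∑-swap F []       ys = sym (∑-0 ys)
∑-swap F (x ∷ xs) ys = trans (cong (∑ ys (F x) ℚ.+_) (∑-swap F xs ys))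
                             (sym (∑-+ (F x) (λ y → ∑ xs (λ x → F x y)) ys))

∑-↭ : (F : A → ℚ) {xs ys : List A} → xs ↭ ys → ∑ xs F ≡ ∑ ys F
∑-↭ F Perm.refl = refl
∑-↭ F (Perm.prep x p) = cong (F x ℚ.+_) (∑-↭ F p)
∑-↭ F (Perm.swap x y p) = trans (cong (λ t → F x ℚ.+ (F y ℚ.+ t)) (∑-↭ F p)) (+-leftComm (F x) (F y) _)
∑-↭ F (Perm.trans p q) = trans (∑-↭ F p) (∑-↭ F q)

∑-zero : (F : A → ℚ) {xs : List A} → All (λ x → F x ≡ 0ℚ) xs → ∑ xs F ≡ 0ℚ
∑-zero F []       = refl
∑-zero F (e ∷ es) = trans (cong₂ ℚ._+_ e (∑-zero F es)) refl

∑-single : (F : A → ℚ) {xs : List A} {x : A} → Unique xs → x ∈ xs →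
           (∀ y → ¬ y ≡ x → F y ≡ 0ℚ) → ∑ xs F ≡ F x
∑-single F (x∉ ∷ u) (here refl) z =
  trans (cong (F _ ℚ.+_) (∑-zero F (All.map (λ x≢y → z _ (x≢y ∘ sym)) x∉))) (ℚₚ.+-identityʳ _)
∑-single F (x∉ ∷ u) (there i) z =
  trans (cong₂ ℚ._+_ (z _ (All.lookup x∉ i)) (∑-single F u i z)) (ℚₚ.+-identityˡ _)

p-q≡0⇒p≡q : ∀ a b → a ℚ.- b ≡ 0ℚ → a ≡ b
p-q≡0⇒p≡q a b e = trans (solve 2 (λ a b → a := (a :- b) :+ b) refl a b)
                        (trans (cong (ℚ._+ b) e) (ℚₚ.+-identityˡ b))
  where open +-*-Solver

-- Polynomials seen through their pairings with functions of the exponent.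

module _ {n : ℕ} where

  pair : (Monomial n → ℚ) → Poly n → ℚ
  pair ψ p = ∑ p (λ t → proj₁ t ℚ.* ψ (proj₂ t))

  -- Polynomial identities are proved by pairing with an arbitrary function of the exponent,
  -- which turns them into identities between finite sums of rationals.
  infix 4 _≋_
  record _≋_ (p q : Poly n) : Set where
    constructor by
    field at : ∀ ψ → pair ψ p ≡ pair ψ q

  open _≋_ public

  ≋-refl : ∀ {p} → p ≋ p
  ≋-refl = by λ ψ → refl

  ≋-sym : ∀ {p q} → p ≋ q → q ≋ p
  ≋-sym e = by λ ψ → sym (at e ψ)

  ≋-trans : ∀ {p q r} → p ≋ q → q ≋ r → p ≋ r
  ≋-trans e f = by λ ψ → trans (at e ψ) (at f ψ)

  mono : Monomial n → Poly n
  mono e = (1ℚ , e) ∷ []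

  δ : Monomial n → Monomial n → ℚ
  δ m e with ≡-dec ℕ._≟_ e m
  ... | yes _ = 1ℚ
  ... | no  _ = 0ℚ

  δ-refl : ∀ m → δ m m ≡ 1ℚ
  δ-refl m with ≡-dec ℕ._≟_ m m
  ... | yes _ = refl
  ... | no ¬e = ⊥-elim (¬e refl)

  δ-≢ : ∀ m e → ¬ e ≡ m → δ m e ≡ 0ℚ
  δ-≢ m e ne with ≡-dec ℕ._≟_ e m
  ... | yes p = ⊥-elim (ne p)
  ... | no _ = refl

  coeff-pair : ∀ p m → coeff p m ≡ pair (δ m) p
  coeff-pair [] m = refl
  coeff-pair ((c , e) ∷ p) m with ≡-dec ℕ._≟_ e m
  ... | yes _ = cong₂ ℚ._+_ (sym (ℚₚ.*-identityʳ c)) (coeff-pair p m)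
  ... | no  _ = trans (coeff-pair p m) (sym (trans (cong (ℚ._+ pair (δ m) p) (ℚₚ.*-zeroʳ c)) (ℚₚ.+-identityˡ _)))

  ≋⇒≈ : ∀ {p q} → p ≋ q → p ≈P q
  ≋⇒≈ {p} {q} e m = trans (coeff-pair p m) (trans (at e (δ m)) (sym (coeff-pair q m)))

  pair-cong : ∀ {ψ χ} → (∀ e → ψ e ≡ χ e) → ∀ p → pair ψ p ≡ pair χ p
  pair-cong eq p = ∑-cong p (λ t → cong (proj₁ t ℚ.*_) (eq (proj₂ t)))

  pair-++ : ∀ ψ p q → pair ψ (p ++ q) ≡ pair ψ p ℚ.+ pair ψ q
  pair-++ ψ p q = ∑-++ _ p q

  pair-· : ∀ ψ c p → pair ψ (c ·P p) ≡ c ℚ.* pair ψ p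
  pair-· ψ c p = trans (∑-map _ _ p)
    (trans (∑-cong p (λ t → ℚₚ.*-assoc c (proj₁ t) (ψ (proj₂ t)))) (∑-* c _ p))

  pair-sub : ∀ ψ p q → pair ψ (p -P q) ≡ pair ψ p ℚ.- pair ψ q
  pair-sub ψ p q = trans (pair-++ ψ p (-P q)) (cong (pair ψ p ℚ.+_)
    (trans (pair-· ψ (ℚ.- 1ℚ) q) (trans (sym (ℚₚ.neg-distribˡ-* 1ℚ (pair ψ q))) (cong ℚ.-_ (ℚₚ.*-identityˡ (pair ψ q))))))

  pair-mono : ∀ ψ e → pair ψ (mono e) ≡ ψ e
  pair-mono ψ e = trans (ℚₚ.+-identityʳ _) (ℚₚ.*-identityˡ _)

  pair-+fun : ∀ ψ χ p → pair (λ e → ψ e ℚ.+ χ e) p ≡ pair ψ p ℚ.+ pair χ p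
  pair-+fun ψ χ p = trans (∑-cong p (λ t → ℚₚ.*-distribˡ-+ (proj₁ t) _ _)) (∑-+ _ _ p)

  pair-*fun : ∀ c ψ p → pair (λ e → c ℚ.* ψ e) p ≡ c ℚ.* pair ψ p
  pair-*fun c ψ p = trans (∑-cong p (λ t →
    solve 3 (λ a b d → a :* (b :* d) := b :* (a :* d)) refl (proj₁ t) c (ψ (proj₂ t)))) (∑-* c _ p)
    where open +-*-Solver

  pair-0fun : ∀ p → pair (λ _ → 0ℚ) p ≡ 0ℚ
  pair-0fun p = trans (∑-cong p (λ t → ℚₚ.*-zeroʳ (proj₁ t))) (∑-0 p)

  pair-∑fun : {A : Set} (xs : List A) (F : A → Monomial n → ℚ) (p : Poly n) →
              pair (λ e → ∑ xs (λ x → F x e)) p ≡ ∑ xs (λ x → pair (F x) p)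
  pair-∑fun xs F p = trans (∑-cong p (λ t → sym (∑-* (proj₁ t) (λ x → F x (proj₂ t)) xs)))
                           (∑-swap (λ t x → proj₁ t ℚ.* F x (proj₂ t)) p xs)

  pair-* : ∀ ψ p q → pair ψ (p *P q) ≡ pair (λ e → pair (λ f → ψ (Vec.zipWith ℕ._+_ e f)) q) p
  pair-* ψ p q = trans (∑-concatMap _ _ p) (∑-cong p (λ s →
    trans (∑-map _ _ q) (trans (∑-cong q (λ t → ℚₚ.*-assoc (proj₁ s) (proj₁ t) _)) (∑-* (proj₁ s) _ q))))

  pair-sumP : {A : Set} (ψ : Monomial n → ℚ) (F : A → Poly n) (xs : List A) →
              pair ψ (sumP (map F xs)) ≡ ∑ xs (λ x → pair ψ (F x))
  pair-sumP ψ F []       = refl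
  pair-sumP ψ F (x ∷ xs) = trans (pair-++ ψ (F x) _) (cong (pair ψ (F x) ℚ.+_) (pair-sumP ψ F xs))

  opaque
    ext : (Monomial n → Poly n) → Poly n → Poly n
    ext φ = concatMap (λ t → proj₁ t ·P φ (proj₂ t))

    ext-[] : ∀ {φ} → ext φ [] ≡ []
    ext-[] = refl

    ext-∷ : ∀ φ t p → ext φ (t ∷ p) ≡ (proj₁ t ·P φ (proj₂ t)) +P ext φ p
    ext-∷ φ t p = refl

    pair-ext : ∀ ψ φ p → pair ψ (ext φ p) ≡ pair (λ e → pair ψ (φ e)) p
    pair-ext ψ φ p = trans (∑-concatMap _ _ p) (∑-cong p (λ t → pair-· ψ (proj₁ t) (φ (proj₂ t))))

  gate : {P : Pred (Monomial n) 0ℓ} → Decidable P → (Monomial n → ℚ) → Monomial n → ℚ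
  gate P? ψ e with P? e
  ... | yes _ = ψ e
  ... | no  _ = 0ℚ

  restrict : {P : Pred (Monomial n) 0ℓ} → Decidable P → Poly n → Poly n
  restrict P? = filter (P? ∘ proj₂)

  pair-restrict : {P : Pred (Monomial n) 0ℓ} (P? : Decidable P) → ∀ ψ p →
                  pair ψ (restrict P? p) ≡ pair (gate P? ψ) p
  pair-restrict P? ψ [] = refl
  pair-restrict P? ψ ((c , e) ∷ p) with P? e
  ... | yes _ = cong (c ℚ.* ψ e ℚ.+_) (pair-restrict P? ψ p)
  ... | no  _ = trans (pair-restrict P? ψ p)
                  (sym (trans (cong (ℚ._+ pair (gate P? ψ) p) (ℚₚ.*-zeroʳ c)) (ℚₚ.+-identityˡ _)))

  gate-δ-yes : {P : Pred (Monomial n) 0ℓ} (P? : Decidable P) → ∀ {m} → P m → ∀ e → gate P? (δ m) e ≡ δ m e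
  gate-δ-yes P? {m} pm e with P? e
  ... | yes _ = refl
  ... | no ¬p = sym (δ-≢ m e (λ { refl → ¬p pm }))

  gate-δ-no : {P : Pred (Monomial n) 0ℓ} (P? : Decidable P) → ∀ {m} → ¬ P m → ∀ e → gate P? (δ m) e ≡ 0ℚ
  gate-δ-no P? {m} ¬pm e with P? e
  ... | yes p = δ-≢ m e (λ { refl → ¬pm p })
  ... | no _ = refl

  coeff-restrict-yes : {P : Pred (Monomial n) 0ℓ} (P? : Decidable P) → ∀ {m} → P m → ∀ p →
                       coeff (restrict P? p) m ≡ coeff p m
  coeff-restrict-yes P? {m} pm p = trans (coeff-pair (restrict P? p) m)
    (trans (pair-restrict P? (δ m) p) (trans (pair-cong (gate-δ-yes P? pm) p) (sym (coeff-pair p m))))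

  coeff-restrict-no : {P : Pred (Monomial n) 0ℓ} (P? : Decidable P) → ∀ {m} → ¬ P m → ∀ p →
                       coeff (restrict P? p) m ≡ 0ℚ
  coeff-restrict-no P? {m} ¬pm p = trans (coeff-pair (restrict P? p) m)
    (trans (pair-restrict P? (δ m) p) (trans (pair-cong (gate-δ-no P? ¬pm) p) (pair-0fun p)))

  ≢? : (m : Monomial n) → Decidable (λ e → ¬ e ≡ m)
  ≢? m e with ≡-dec ℕ._≟_ e m
  ... | yes p = no (λ ne → ne p)
  ... | no ne = yes ne

  pair-split : ∀ ψ m p → pair ψ p ≡ coeff p m ℚ.* ψ m ℚ.+ pair ψ (restrict (≢? m) p)
  pair-split ψ m p = trans (trans (pair-cong pointwise p)
      (trans (pair-+fun _ _ p) (cong (ℚ._+ pair (gate (≢? m) ψ) p) (pair-*fun (ψ m) (δ m) p))))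
    (cong₂ ℚ._+_ (trans (ℚₚ.*-comm (ψ m) _) (cong (ℚ._* ψ m) (sym (coeff-pair p m))))
                 (sym (pair-restrict (≢? m) ψ p)))
    where
    pointwise : ∀ e → ψ e ≡ ψ m ℚ.* δ m e ℚ.+ gate (≢? m) ψ e
    pointwise e with ≡-dec ℕ._≟_ e m
    ... | yes refl = sym (trans (ℚₚ.+-identityʳ _) (ℚₚ.*-identityʳ _))
    ... | no  _    = sym (trans (cong (ℚ._+ ψ e) (ℚₚ.*-zeroʳ (ψ m))) (ℚₚ.+-identityˡ _))

  -- All terms sharing the exponent of the head are removed at once: together they contribute a
  -- multiple of a coefficient, which is zero. The remaining list is shorter but not structurally
  -- smaller, whence the bound `k`.
  coeffs-zero⇒pair-zero : ∀ k p → length p ≤ k → (∀ m → coeff p m ≡ 0ℚ) → ∀ ψ → pair ψ p ≡ 0ℚ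
  coeffs-zero⇒pair-zero k [] _ _ ψ = refl
  coeffs-zero⇒pair-zero (suc k) p@((c , e) ∷ q) (s≤s le) z ψ = trans (pair-split ψ e p)
    (trans (cong₂ ℚ._+_ (trans (cong (ℚ._* ψ e) (z e)) (ℚₚ.*-zeroˡ (ψ e)))
      (coeffs-zero⇒pair-zero k (restrict (≢? e) p) shorter z′ ψ)) refl)
    where
    open import Data.List.Properties using (length-filter)
    shorter : length (restrict (≢? e) p) ≤ k
    shorter with ≡-dec ℕ._≟_ e e
    ... | yes _ = ℕₚ.≤-trans (length-filter (≢? e ∘ proj₂) q) le
    ... | no ne = ⊥-elim (ne refl)
    z′ : ∀ m → coeff (restrict (≢? e) p) m ≡ 0ℚ
    z′ m with ≡-dec ℕ._≟_ m e
    ... | yes refl = coeff-restrict-no (≢? e) (λ ne → ne refl) p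
    ... | no ne = trans (coeff-restrict-yes (≢? e) ne p) (z m)

  ≈⇒≋ : ∀ p q → p ≈P q → p ≋ q
  ≈⇒≋ p q e = by λ ψ → p-q≡0⇒p≡q _ _ (trans (sym (pair-sub ψ p q))
    (coeffs-zero⇒pair-zero _ (p -P q) ℕₚ.≤-refl (λ m → trans (coeff-pair (p -P q) m)
      (trans (pair-sub (δ m) p q) (trans (cong₂ ℚ._-_ (sym (coeff-pair p m))
        (trans (sym (coeff-pair q m)) (sym (e m)))) (ℚₚ.+-inverseʳ (coeff p m))))) ψ))

-- Subspaces, linear maps and the ideal.

module _ {n : ℕ} where

  record InSpan (Q : Monomial n → Set) (p : Poly n) : Set where
    constructor span
    field occurs⇒ : ∀ m → Occurs m p → Q m

  open InSpan public

  record IsSubspace (C : Poly n → Set) : Set where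
    field
      zero-closed  : C []
      add-closed   : ∀ {p q} → C p → C q → C (p +P q)
      scale-closed : ∀ c {p} → C p → C (c ·P p)
      resp         : ∀ {p q} → p ≋ q → C p → C q

    sub-closed : ∀ {p q} → C p → C q → C (p -P q)
    sub-closed x y = add-closed x (scale-closed (ℚ.- 1ℚ) y)

    sumP-closed : {X : Set} {F : X → Poly n} (xs : List X) → (∀ x → C (F x)) → C (sumP (map F xs))
    sumP-closed [] h = zero-closed
    sumP-closed (x ∷ xs) h = add-closed (h x) (sumP-closed xs h)

    ext-closed-All : ∀ {φ} (p : Poly n) → All (λ t → C (φ (proj₂ t))) p → C (ext φ p)
    ext-closed-All [] [] = subst C (sym ext-[]) zero-closed
    ext-closed-All {φ} (t ∷ p) (h ∷ hs) = subst C (sym (ext-∷ φ t p)) (add-closed (scale-closed (proj₁ t) h) (ext-closed-All p hs))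

  open IsSubspace

  ++-cong : ∀ {p p′ q q′ : Poly n} → p ≋ p′ → q ≋ q′ → (p +P q) ≋ (p′ +P q′)
  ++-cong {p} {p′} {q} {q′} e f = by λ ψ →
    trans (pair-++ ψ p q) (trans (cong₂ ℚ._+_ (at e ψ) (at f ψ)) (sym (pair-++ ψ p′ q′)))

  ·-cong : ∀ c {p q : Poly n} → p ≋ q → (c ·P p) ≋ (c ·P q)
  ·-cong c {p} {q} e = by λ ψ → trans (pair-· ψ c p) (trans (cong (c ℚ.*_) (at e ψ)) (sym (pair-· ψ c q)))

  sub-cong : ∀ {p p′ q q′ : Poly n} → p ≋ p′ → q ≋ q′ → (p -P q) ≋ (p′ -P q′)
  sub-cong e f = ++-cong e (·-cong (ℚ.- 1ℚ) f)

  sumP-cong : {X : Set} {F F′ : X → Poly n} (xs : List X) → (∀ x → F x ≋ F′ x) →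
              sumP (map F xs) ≋ sumP (map F′ xs)
  sumP-cong [] h = ≋-refl
  sumP-cong (x ∷ xs) h = ++-cong (h x) (sumP-cong xs h)

  occurs? : (p : Poly n) → Decidable (λ m → Occurs m p)
  occurs? p m with coeff p m ℚₚ.≟ 0ℚ
  ... | yes z = no (λ ne → ne z)
  ... | no ne = yes ne

  -- A list may contain terms that cancel, and hypotheses on `Occurs` say nothing about their
  -- exponents. Dropping them first makes it possible to argue term by term.
  clean : (p : Poly n) → restrict (occurs? p) p ≋ p
  clean p = ≈⇒≋ (restrict (occurs? p) p) p go
    where
    go : restrict (occurs? p) p ≈P p
    go m with coeff p m ℚₚ.≟ 0ℚ
    ... | yes z = trans (coeff-restrict-no (occurs? p) (λ ne → ne z) p) (sym z)
    ... | no ne = coeff-restrict-yes (occurs? p) ne p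

  ext-cong : ∀ {φ} {p q : Poly n} → p ≋ q → ext φ p ≋ ext φ q
  ext-cong {φ} {p} {q} e = by λ ψ → trans (pair-ext ψ φ p) (trans (at e _) (sym (pair-ext ψ φ q)))

  ext-closed : ∀ {C Q φ} {p : Poly n} → IsSubspace C → InSpan Q p → (∀ e → Q e → C (φ e)) → C (ext φ p)
  ext-closed {p = p} S s h = resp S (ext-cong (clean p))
    (ext-closed-All S (restrict (occurs? p) p)
      (All.map (λ {t} o → h _ (occurs⇒ s _ o)) (Allₚ.all-filter (occurs? p ∘ proj₂) p)))

  coeff-≋ : ∀ {p q : Poly n} → p ≋ q → ∀ m → coeff p m ≡ coeff q m
  coeff-≋ {p} {q} e m = ≋⇒≈ {p = p} {q} e m

  coeff-++ : ∀ (p q : Poly n) m → coeff (p +P q) m ≡ coeff p m ℚ.+ coeff q m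
  coeff-++ p q m = trans (coeff-pair (p ++ q) m) (trans (pair-++ (δ m) p q)
    (sym (cong₂ ℚ._+_ (coeff-pair p m) (coeff-pair q m))))

  coeff-· : ∀ c (p : Poly n) m → coeff (c ·P p) m ≡ c ℚ.* coeff p m
  coeff-· c p m = trans (coeff-pair (c ·P p) m) (trans (pair-· (δ m) c p)
    (cong (c ℚ.*_) (sym (coeff-pair p m))))

  -- `Occurs` is a negation: a nonzero coefficient of a sum only refutes that both coefficients
  -- vanish, so `Q m` is obtained up to double negation.
  InSpan-isSubspace : ∀ {Q} → (∀ m → ¬ ¬ Q m → Q m) → IsSubspace (InSpan Q)
  InSpan-isSubspace {Q} stable = record
    { zero-closed = span λ m o → ⊥-elim (o refl)
    ; add-closed = λ {p} {q} x y → span λ m o → stable m (λ nq →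
        o (trans (coeff-++ p q m) (cong₂ ℚ._+_ (absent x nq) (absent y nq))))
    ; scale-closed = λ c {p} x → span λ m o → stable m (λ nq →
        o (trans (coeff-· c p m) (trans (cong (c ℚ.*_) (absent x nq)) (ℚₚ.*-zeroʳ c))))
    ; resp = λ {p} {q} e x → span λ m o → occurs⇒ x m (λ z → o (trans (sym (coeff-≋ e m)) z)) }
    where
    absent : ∀ {m p} → InSpan Q p → ¬ Q m → coeff p m ≡ 0ℚ
    absent {m} {p} x nq = decidable-stable (coeff p m ℚₚ.≟ 0ℚ) (λ o → nq (occurs⇒ x m o))

  InSpan-mono : ∀ {Q : Monomial n → Set} {e} → Q e → InSpan Q (mono e)
  InSpan-mono {Q} {e} q = span go
    where
    go : ∀ m → Occurs m (mono e) → Q m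
    go m o with ≡-dec ℕ._≟_ e m
    ... | yes refl = q
    ... | no ne = ⊥-elim (o refl)

  InSpan-weaken : ∀ {Q R : Monomial n → Set} {p} → (∀ e → Q e → R e) → InSpan Q p → InSpan R p
  InSpan-weaken h s = span λ m o → h m (occurs⇒ s m o)

  InSpan-restrict : ∀ {Q P : Monomial n → Set} (P? : Decidable P) {p} → InSpan Q p →
                    InSpan (λ m → P m × Q m) (restrict P? p)
  InSpan-restrict {Q} {P} P? {p} s = span go
    where
    go : ∀ m → Occurs m (restrict P? p) → P m × Q m
    go m o with P? m
    ... | yes pm = pm , occurs⇒ s m (λ z → o (trans (coeff-restrict-yes P? pm p) z))
    ... | no ¬pm = ⊥-elim (o (coeff-restrict-no P? ¬pm p))

  -- One equation, saying that the values on monomials determine `L`, replaces additivity,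
  -- homogeneity and compatibility with `_≋_`.
  record IsLinear (L : Poly n → Poly n) : Set where
    constructor mkLinear
    field linear : ∀ ψ p → pair ψ (L p) ≡ pair (λ e → pair ψ (L (mono e))) p

    L-cong : ∀ {p q} → p ≋ q → L p ≋ L q
    L-cong {p} {q} e = by λ ψ → trans (linear ψ p) (trans (at e _) (sym (linear ψ q)))

    L-+ : ∀ p q → L (p +P q) ≋ (L p +P L q)
    L-+ p q = by λ ψ → trans (linear ψ (p +P q)) (trans (pair-++ _ p q)
      (trans (cong₂ ℚ._+_ (sym (linear ψ p)) (sym (linear ψ q))) (sym (pair-++ ψ (L p) (L q)))))

    L-· : ∀ c p → L (c ·P p) ≋ (c ·P L p)
    L-· c p = by λ ψ → trans (linear ψ (c ·P p)) (trans (pair-· _ c p)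
      (trans (cong (c ℚ.*_) (sym (linear ψ p))) (sym (pair-· ψ c (L p)))))

    L-sub : ∀ p q → L (p -P q) ≋ (L p -P L q)
    L-sub p q = ≋-trans (L-+ p (-P q)) (++-cong {p = L p} ≋-refl (L-· (ℚ.- 1ℚ) q))

    L-[] : L [] ≋ []
    L-[] = by λ ψ → linear ψ []

    L-sumP : {X : Set} (F : X → Poly n) (xs : List X) → L (sumP (map F xs)) ≋ sumP (map (L ∘ F) xs)
    L-sumP F [] = L-[]
    L-sumP F (x ∷ xs) = ≋-trans (L-+ (F x) _) (++-cong {p = L (F x)} ≋-refl (L-sumP F xs))

    L-ext : ∀ p → L p ≋ ext (L ∘ mono) p
    L-ext p = by λ ψ → trans (linear ψ p) (sym (pair-ext ψ (L ∘ mono) p))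

    L-closed : ∀ {C Q p} → IsSubspace C → InSpan Q p → (∀ e → Q e → C (L (mono e))) → C (L p)
    L-closed {p = p} S s h = resp S (≋-sym (L-ext p)) (ext-closed S s h)

  open IsLinear

  -- `T` is the transpose of `L`, acting on functions of the exponent. Having a transpose is enough
  -- for linearity.
  via-pair : ∀ {L} (T : (Monomial n → ℚ) → Monomial n → ℚ) →
             (∀ ψ p → pair ψ (L p) ≡ pair (T ψ) p) → IsLinear L
  via-pair T h = mkLinear λ ψ p → trans (h ψ p)
    (pair-cong (λ e → sym (trans (h ψ (mono e)) (pair-mono (T ψ) e))) p)

  ext-linear : ∀ φ → IsLinear (ext φ)
  ext-linear φ = via-pair _ (λ ψ → pair-ext ψ φ)

  restrict-linear : {P : Pred (Monomial n) 0ℓ} (P? : Decidable P) → IsLinear (restrict P?)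
  restrict-linear P? = via-pair _ (pair-restrict P?)

  id-linear : IsLinear (λ p → p)
  id-linear = via-pair {L = λ p → p} (λ ψ → ψ) (λ ψ p → refl)

  scale-linear : ∀ c {L} → IsLinear L → IsLinear (λ p → c ·P L p)
  scale-linear c {L} l = via-pair _ λ ψ p → trans (pair-· ψ c (L p))
    (trans (cong (c ℚ.*_) (linear l ψ p)) (sym (pair-*fun c _ p)))

  +-linear : ∀ {L M} → IsLinear L → IsLinear M → IsLinear (λ p → L p +P M p)
  +-linear {L} {M} l m = via-pair _ λ ψ p → trans (pair-++ ψ (L p) (M p))
    (trans (cong₂ ℚ._+_ (linear l ψ p) (linear m ψ p)) (sym (pair-+fun _ _ p)))

  ∘-linear : ∀ {L M} → IsLinear L → IsLinear M → IsLinear (λ p → L (M p))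
  ∘-linear {L} {M} l m = via-pair _ λ ψ p → trans (linear l ψ (M p)) (linear m (λ e → pair ψ (L (mono e))) p)

  sumP-linear : {X : Set} {L : X → Poly n → Poly n} (xs : List X) → (∀ x → IsLinear (L x)) →
                IsLinear (λ p → sumP (map (λ x → L x p) xs))
  sumP-linear {L = L} xs l = via-pair _ λ ψ p → trans (pair-sumP ψ (λ x → L x p) xs)
    (trans (∑-cong xs (λ x → linear (l x) ψ p)) (sym (pair-∑fun xs _ p)))

  *ˡ-linear : ∀ g → IsLinear (λ p → p *P g)
  *ˡ-linear g = via-pair _ λ ψ p → pair-* ψ p g

  *ʳ-linear : ∀ p → IsLinear (λ g → p *P g)
  *ʳ-linear p = via-pair _ λ ψ g → trans (pair-* ψ p g) (∑-pair ψ g)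
    where
    ∑-pair : ∀ ψ g → pair (λ e → pair (λ f → ψ (Vec.zipWith ℕ._+_ e f)) g) p
                   ≡ pair (λ f → ∑ p (λ s → proj₁ s ℚ.* ψ (Vec.zipWith ℕ._+_ (proj₂ s) f))) g
    ∑-pair ψ g = trans (∑-cong p (λ s → sym (pair-*fun (proj₁ s) _ g)))
      (sym (pair-∑fun p _ g))

  mono-ext : ∀ (p : Poly n) → ext mono p ≋ p
  mono-ext p = by λ ψ → trans (pair-ext ψ mono p) (pair-cong (pair-mono ψ) p)

  span-closed : ∀ {C Q p} → IsSubspace C → InSpan Q p → (∀ e → Q e → C (mono e)) → C p
  span-closed {p = p} S s h = resp S (mono-ext p) (ext-closed {φ = mono} S s h)

  *-assoc : ∀ (p q r : Poly n) → ((p *P q) *P r) ≋ (p *P (q *P r))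
  *-assoc p q r = by λ ψ → trans (pair-* ψ (p *P q) r) (trans (pair-* _ p q) (sym (trans (pair-* ψ p (q *P r))
    (pair-cong (λ e → trans (pair-* _ q r) (pair-cong (λ f → pair-cong (λ g →
      cong ψ (sym (zipWith-assoc ℕₚ.+-assoc e f g))) r) q)) p))))
    where open import Data.Vec.Properties using (zipWith-assoc)

  idealSum : List (Poly n × Σ (Poly n) Generator) → Poly n
  idealSum gs = sumP (map (λ t → proj₁ t *P proj₁ (proj₂ t)) gs)

  record Ideal (p : Poly n) : Set where
    constructor ideal
    field
      gens : List (Poly n × Σ (Poly n) Generator)
      expansion : p ≋ idealSum gens

  Ideal-isSubspace : IsSubspace Ideal
  Ideal-isSubspace = record
    { zero-closed = ideal [] ≋-refl
    ; add-closed = λ (ideal gs e) (ideal hs f) → ideal (gs ++ hs) (≋-trans (++-cong e f) (≋-sym (sum-++ gs hs)))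
    ; scale-closed = λ c (ideal gs e) → ideal (map (λ t → c ·P proj₁ t , proj₂ t) gs)
                                              (≋-trans (·-cong c e) (sum-· c gs))
    ; resp = λ e (ideal gs f) → ideal gs (≋-trans (≋-sym e) f) }
    where
    F : Poly n × Σ (Poly n) Generator → Poly n
    F t = proj₁ t *P proj₁ (proj₂ t)
    sum-++ : ∀ gs hs → idealSum (gs ++ hs) ≋ (idealSum gs +P idealSum hs)
    sum-++ gs hs = by λ ψ → trans (pair-sumP ψ F (gs ++ hs)) (trans (∑-++ _ gs hs)
      (sym (trans (pair-++ ψ (sumP (map F gs)) _) (cong₂ ℚ._+_ (pair-sumP ψ F gs) (pair-sumP ψ F hs)))))
    sum-· : ∀ c gs → (c ·P idealSum gs) ≋ idealSum (map (λ t → c ·P proj₁ t , proj₂ t) gs)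
    sum-· c gs = by λ ψ → trans (pair-· ψ c (sumP (map F gs))) (trans (cong (c ℚ.*_) (pair-sumP ψ F gs))
      (sym (trans (pair-sumP ψ F (map (λ t → c ·P proj₁ t , proj₂ t) gs))
        (trans (∑-map (λ t → pair ψ (F t)) (λ t → c ·P proj₁ t , proj₂ t) gs) (trans (∑-cong gs (λ t →
        trans (at (L-· (*ˡ-linear (proj₁ (proj₂ t))) c (proj₁ t)) ψ) (pair-· ψ c (F t)))) (∑-* c _ gs))))))

  ++-identityʳ-≋ : ∀ (p : Poly n) → p ≋ (p +P [])
  ++-identityʳ-≋ p = by λ ψ → sym (trans (pair-++ ψ p []) (ℚₚ.+-identityʳ _))

  Ideal-generator : ∀ p {g} → Generator g → Ideal (p *P g)
  Ideal-generator p {g} G = ideal ((p , g , G) ∷ []) (++-identityʳ-≋ (p *P g))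

  Ideal-rec : ∀ {C} → IsSubspace C → (∀ p {g} → Generator g → C (p *P g)) → ∀ {p} → Ideal p → C p
  Ideal-rec {C} S h {p} (ideal gs e) = resp S (≋-sym e) (sumP-closed S gs λ t → h (proj₁ t) (proj₂ (proj₂ t)))

  ker-isSubspace : ∀ {L} → IsLinear L → IsSubspace (λ p → L p ≋ [])
  ker-isSubspace {L} l = record
    { zero-closed = L-[] l
    ; add-closed = λ {p} {q} x y → ≋-trans (L-+ l p q) (++-cong x y)
    ; scale-closed = λ c {p} x → ≋-trans (L-· l c p) (·-cong c x)
    ; resp = λ e x → ≋-trans (≋-sym (L-cong l e)) x }

  preimage-isSubspace : ∀ {L C} → IsLinear L → IsSubspace C → IsSubspace (λ p → C (L p))
  preimage-isSubspace {L} l S = record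
    { zero-closed = resp S (≋-sym (L-[] l)) (zero-closed S)
    ; add-closed = λ {p} {q} x y → resp S (≋-sym (L-+ l p q)) (add-closed S x y)
    ; scale-closed = λ c {p} x → resp S (≋-sym (L-· l c p)) (scale-closed S c x)
    ; resp = λ e x → resp S (L-cong l e) x }

  record Mod (C : Poly n → Set) (p : Poly n) : Set where
    constructor _⊹_by_
    field
      {idealPart restPart} : Poly n
      inIdeal : Ideal idealPart
      inRest : C restPart
      split : p ≋ (idealPart +P restPart)

  Mod-isSubspace : ∀ {C} → IsSubspace C → IsSubspace (Mod C)
  Mod-isSubspace S = record
    { zero-closed = zero-closed Ideal-isSubspace ⊹ zero-closed S by ≋-refl
    ; add-closed = λ { (_⊹_by_ {a} {b} i s e) (_⊹_by_ {a′} {b′} i′ s′ e′) →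
        add-closed Ideal-isSubspace i i′ ⊹ add-closed S s s′ by ≋-trans (++-cong e e′) (interchange a b a′ b′) }
    ; scale-closed = λ { c (_⊹_by_ {a} {b} i s e) →
        scale-closed Ideal-isSubspace c i ⊹ scale-closed S c s by ≋-trans (·-cong c e) (L-+ (scale-linear c id-linear) a b) }
    ; resp = λ { e (i ⊹ s by f) → i ⊹ s by ≋-trans (≋-sym e) f } }
    where
    interchange : ∀ a b a′ b′ → ((a +P b) +P (a′ +P b′)) ≋ ((a +P a′) +P (b +P b′))
    interchange a b a′ b′ = by λ ψ → trans (pair-++ ψ (a +P b) (a′ +P b′))
      (trans (cong₂ ℚ._+_ (pair-++ ψ a b) (pair-++ ψ a′ b′))
      (trans (+-interchange (pair ψ a) (pair ψ b) (pair ψ a′) (pair ψ b′))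
      (sym (trans (pair-++ ψ (a +P a′) (b +P b′)) (cong₂ ℚ._+_ (pair-++ ψ a a′) (pair-++ ψ b b′))))))

  Mod-ideal : ∀ {C p} → IsSubspace C → Ideal p → Mod C p
  Mod-ideal {p = p} S i = i ⊹ zero-closed S by ++-identityʳ-≋ p

  Mod-rest : ∀ {C : Poly n → Set} {p} → C p → Mod C p
  Mod-rest c = zero-closed Ideal-isSubspace ⊹ c by ≋-refl

  Mod-rec : ∀ {C D} → IsSubspace D → (∀ {p} → Ideal p → D p) → (∀ {p} → C p → D p) →
            ∀ {p} → Mod C p → D p
  Mod-rec S h k (i ⊹ c by e) = resp S (≋-sym e) (add-closed S (h i) (k c))

open IsSubspace
open IsLinear

-- The action of the hyperoctahedral group

map-unique : {f : A → B} {xs : List A} → (∀ {x y} → x ∈ xs → y ∈ xs → f x ≡ f y → x ≡ y) →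
             Unique xs → Unique (map f xs)
map-unique inj [] = []
map-unique inj (x∉ ∷ u) =
  Allₚ.map⁺ (All.tabulate λ y∈ fx≡fy → All.lookup x∉ y∈ (inj (here refl) (there y∈) fx≡fy))
  ∷ map-unique (λ x∈ y∈ → inj (there x∈) (there y∈)) u

-- Bijectivity is asked on the members of `xs` only: maps of encoded group elements are inverse to
-- each other on the canonical codes, not on all codes.
map-bijection-↭ : {xs : List A} {f g : A → A} → Unique xs →
  (∀ {x} → x ∈ xs → f x ∈ xs) → (∀ {x} → x ∈ xs → g x ∈ xs) →
  (∀ {x} → x ∈ xs → g (f x) ≡ x) → (∀ {x} → x ∈ xs → f (g x) ≡ x) → map f xs ↭ xs
map-bijection-↭ {xs = xs} {f} {g} u f∈ g∈ gf fg = ∼bag⇒↭ (unique∧set⇒bag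
  (map-unique (λ x∈ y∈ e → trans (sym (gf x∈)) (trans (cong g e) (gf y∈))) u) u
  (mk⇔ to λ x∈ → subst (_∈ map f xs) (fg x∈) (∈-map⁺ f (g∈ x∈))))
  where
  to : ∀ {y} → y ∈ map f xs → y ∈ xs
  to y∈ with ∈-map⁻ f y∈
  ... | x , x∈ , refl = f∈ x∈

toList-tabulate : {n : ℕ} (f : Fin n → A) → toList (tabulate f) ≡ map f (allFin n)
toList-tabulate f = trans (go f) (sym (map-tabulate id f))
  where
  go : {n : ℕ} (f : Fin n → A) → toList (tabulate f) ≡ List.tabulate f
  go {n = zero}  f = refl
  go {n = suc n} f = cong (f zero ∷_) (go (f ∘ suc))

toList-permute-↭ : {n : ℕ} (π : Permutation′ n) (f : Fin n → A) →
                   toList (tabulate (f ∘ (π ⟨$⟩ʳ_))) ↭ toList (tabulate f)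
toList-permute-↭ {n = n} π f = subst₂ _↭_
  (trans (sym (map-∘ (allFin n))) (sym (toList-tabulate (f ∘ (π ⟨$⟩ʳ_))))) (sym (toList-tabulate f))
  (Permₚ.map⁺ f (map-bijection-↭ {g = π ⟨$⟩ˡ_} (Uniqueₚ.allFin⁺ n)
    (λ _ → ∈-allFin _) (λ _ → ∈-allFin _) (λ _ → FP.inverseˡ π) (λ _ → FP.inverseʳ π)))

sumF : {n : ℕ} → (Fin n → ℕ) → ℕ
sumF f = sumℕ (toList (tabulate f))

sumF-cong : {n : ℕ} {f g : Fin n → ℕ} → (∀ i → f i ≡ g i) → sumF f ≡ sumF g
sumF-cong e = cong (sumℕ ∘ toList) (tabulate-cong e)

sumF-permute : {n : ℕ} (π : Permutation′ n) (f : Fin n → ℕ) → sumF (f ∘ (π ⟨$⟩ʳ_)) ≡ sumF f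
sumF-permute π f = sum-↭ (toList-permute-↭ π f)

sumF-+ : {n : ℕ} (f g : Fin n → ℕ) → sumF (λ i → f i ℕ.+ g i) ≡ sumF f ℕ.+ sumF g
sumF-+ {zero}  f g = refl
sumF-+ {suc n} f g = trans (cong (f zero ℕ.+ g zero ℕ.+_) (sumF-+ (f ∘ suc) (g ∘ suc)))
  (ℕ-interchange (f zero) (g zero) _ _)
  where
  open import Algebra.Properties.CommutativeSemigroup ℕₚ.+-commutativeSemigroup renaming (interchange to ℕ-interchange)

sumF-0 : {n : ℕ} → sumF {n} (λ _ → 0) ≡ 0
sumF-0 {zero}  = refl
sumF-0 {suc n} = sumF-0 {n}

negPow-+ : ∀ a b c → negPow (a ℕ.+ b) c ≡ negPow a (negPow b c)
negPow-+ zero    b c = refl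
negPow-+ (suc a) b c = cong ℚ.-_ (negPow-+ a b c)

neg-involutive : ∀ a → ℚ.- (ℚ.- a) ≡ a
neg-involutive = solve 1 (λ a → :- (:- a) := a) refl
  where open +-*-Solver

negPow-even : ∀ a c → negPow (a ℕ.+ a) c ≡ c
negPow-even zero    c = refl
negPow-even (suc a) c rewrite ℕₚ.+-suc a a = trans (neg-involutive _) (negPow-even a c)

negPow-*ˡ : ∀ s c x → negPow s c ℚ.* x ≡ c ℚ.* negPow s x
negPow-*ˡ zero    c x = refl
negPow-*ˡ (suc s) c x = trans (sym (ℚₚ.neg-distribˡ-* (negPow s c) x))
  (trans (cong ℚ.-_ (negPow-*ˡ s c x)) (ℚₚ.neg-distribʳ-* c (negPow s x)))

negPow-scale : ∀ s x → negPow s x ≡ negPow s 1ℚ ℚ.* x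
negPow-scale s x = sym (trans (negPow-*ˡ s 1ℚ x) (ℚₚ.*-identityˡ _))

private
  bit : Bool → ℕ → ℕ
  bit b e = if b then e else 0

  -- An exclusive or is the sum less twice the conjunction. Only the parity of a sign exponent
  -- matters to `negPow`, so the doubled part can be discarded.
  bit-xor : ∀ x y e → bit (x xor y) e ℕ.+ (bit (x ∧ y) e ℕ.+ bit (x ∧ y) e) ≡ bit x e ℕ.+ bit y e
  bit-xor true  true  e = refl
  bit-xor true  false e = refl
  bit-xor false true  e = ℕₚ.+-comm e 0
  bit-xor false false e = refl

module _ {n : ℕ} where

  signExp : SignedPerm n → Monomial n → ℕ
  signExp (π , ε) e = sumF (λ i → bit (ε i) (lookup e i))

  actE : SignedPerm n → Monomial n → Monomial n
  actE (π , ε) e = tabulate (λ j → lookup e (π ⟨$⟩ˡ j))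

  pair-act : ∀ ψ σ p → pair ψ (act σ p) ≡ pair (λ e → negPow (signExp σ e) (ψ (actE σ e))) p
  pair-act ψ σ p = trans (∑-map _ _ p) (∑-cong p λ t → negPow-*ˡ (signExp σ (proj₂ t)) (proj₁ t) _)

  act-linear : ∀ σ → IsLinear (act σ)
  act-linear σ = via-pair _ (λ ψ → pair-act ψ σ)

  pair-negPow : ∀ s ψ (p : Poly n) → pair (λ e → negPow s (ψ e)) p ≡ negPow s (pair ψ p)
  pair-negPow s ψ p = trans (pair-cong (λ e → negPow-scale s (ψ e)) p)
    (trans (pair-*fun (negPow s 1ℚ) ψ p) (sym (negPow-scale s (pair ψ p))))

  infix 4 _≐_
  -- Signed permutations contain functions, so the group laws can only be expected to hold
  -- pointwise.
  record _≐_ (σ τ : SignedPerm n) : Set where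
    constructor ≐-intro
    field
      ʳ-eq : ∀ i → proj₁ σ ⟨$⟩ʳ i ≡ proj₁ τ ⟨$⟩ʳ i
      ˡ-eq : ∀ i → proj₁ σ ⟨$⟩ˡ i ≡ proj₁ τ ⟨$⟩ˡ i
      ε-eq : ∀ i → proj₂ σ i ≡ proj₂ τ i

  open _≐_ public

  ≐-refl : ∀ {σ} → σ ≐ σ
  ≐-refl = ≐-intro (λ _ → refl) (λ _ → refl) (λ _ → refl)

  ≐-sym : ∀ {σ τ} → σ ≐ τ → τ ≐ σ
  ≐-sym (≐-intro a b c) = ≐-intro (sym ∘ a) (sym ∘ b) (sym ∘ c)

  ≐-trans : ∀ {σ τ υ} → σ ≐ τ → τ ≐ υ → σ ≐ υ
  ≐-trans (≐-intro a b c) (≐-intro a′ b′ c′) =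
    ≐-intro (λ i → trans (a i) (a′ i)) (λ i → trans (b i) (b′ i)) (λ i → trans (c i) (c′ i))

  act-≐ : ∀ {σ τ} → σ ≐ τ → ∀ p → act σ p ≋ act τ p
  act-≐ {σ} {τ} e p = by λ ψ → trans (pair-act ψ σ p) (trans (pair-cong (λ x → cong₂ negPow
      (sumF-cong (λ i → cong (λ b → bit b (lookup x i)) (ε-eq e i)))
      (cong ψ (tabulate-cong (λ j → cong (lookup x) (ˡ-eq e j))))) p) (sym (pair-act ψ τ p)))

  infixl 7 _⊛_
  opaque
    -- The right factor acts first, whereas `∘ₚ` composes in reading order. The sign of a product at
    -- i is that of the right factor at i times that of the left factor at the image of i.
    _⊛_ : SignedPerm n → SignedPerm n → SignedPerm n
    (π , ε) ⊛ (ρ , η) = ρ ∘ₚ π , λ i → η i xor ε (ρ ⟨$⟩ʳ i)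

    ι : SignedPerm n
    ι = FP.id , λ _ → false

    inv : SignedPerm n → SignedPerm n
    inv (π , ε) = FP.flip π , λ j → ε (π ⟨$⟩ˡ j)

    ⊛-cong : ∀ {σ σ′ τ τ′} → σ ≐ σ′ → τ ≐ τ′ → (σ ⊛ τ) ≐ (σ′ ⊛ τ′)
    ⊛-cong {σ} {σ′} {τ} {τ′} s t = ≐-intro
      (λ i → trans (cong (proj₁ σ ⟨$⟩ʳ_) (ʳ-eq t i)) (ʳ-eq s _))
      (λ i → trans (cong (proj₁ τ ⟨$⟩ˡ_) (ˡ-eq s i)) (ˡ-eq t _))
      (λ i → cong₂ _xor_ (ε-eq t i) (trans (cong (proj₂ σ) (ʳ-eq t i)) (ε-eq s _)))

    inv-cong : ∀ {σ τ} → σ ≐ τ → inv σ ≐ inv τ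
    inv-cong {σ} {τ} s = ≐-intro (ˡ-eq s) (ʳ-eq s) (λ i → trans (cong (proj₂ σ) (ˡ-eq s i)) (ε-eq s _))

    ⊛-assoc : ∀ σ τ υ → ((σ ⊛ τ) ⊛ υ) ≐ (σ ⊛ (τ ⊛ υ))
    ⊛-assoc (π , ε) (ρ , η) (κ , θ) = ≐-intro (λ _ → refl) (λ _ → refl)
      (λ i → sym (Boolₚ.xor-assoc (θ i) (η (κ ⟨$⟩ʳ i)) (ε (ρ ⟨$⟩ʳ (κ ⟨$⟩ʳ i)))))

    ⊛-identityˡ : ∀ σ → (ι ⊛ σ) ≐ σ
    ⊛-identityˡ (π , ε) = ≐-intro (λ _ → refl) (λ _ → refl) (λ i → Boolₚ.xor-identityʳ (ε i))

    ⊛-identityʳ : ∀ σ → (σ ⊛ ι) ≐ σ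
    ⊛-identityʳ (π , ε) = ≐-intro (λ _ → refl) (λ _ → refl) (λ i → refl)

    ⊛-inverseˡ : ∀ σ → (inv σ ⊛ σ) ≐ ι
    ⊛-inverseˡ (π , ε) = ≐-intro (λ _ → FP.inverseˡ π) (λ _ → FP.inverseˡ π)
      (λ i → trans (cong (λ j → ε i xor ε j) (FP.inverseˡ π)) (Boolₚ.xor-same (ε i)))

    ⊛-inverseʳ : ∀ σ → (σ ⊛ inv σ) ≐ ι
    ⊛-inverseʳ (π , ε) = ≐-intro (λ _ → FP.inverseʳ π) (λ _ → FP.inverseʳ π) (λ i → Boolₚ.xor-same (ε _))

    actE-⊛ : ∀ σ τ e → actE (σ ⊛ τ) e ≡ actE σ (actE τ e)
    actE-⊛ (π , _) (ρ , _) e = tabulate-cong (λ j → sym (lookup∘tabulate (λ k → lookup e (ρ ⟨$⟩ˡ k)) (π ⟨$⟩ˡ j)))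

    negPow-⊛ : ∀ σ τ e x → negPow (signExp (σ ⊛ τ) e) x ≡ negPow (signExp τ e) (negPow (signExp σ (actE τ e)) x)
    negPow-⊛ (π , ε) (ρ , η) e x = sym (trans (sym (negPow-+ (signExp (ρ , η) e) _ x))
      (trans (cong (λ s → negPow s x) parity) (trans (negPow-+ (sumF xors) (sumF ands ℕ.+ sumF ands) x)
        (cong (negPow (sumF xors)) (negPow-even (sumF ands) x)))))
      where
      xors ands : Fin n → ℕ
      xors i = bit (η i xor ε (ρ ⟨$⟩ʳ i)) (lookup e i)
      ands i = bit (η i ∧ ε (ρ ⟨$⟩ʳ i)) (lookup e i)
      parity : sumF (λ i → bit (η i) (lookup e i)) ℕ.+ sumF (λ j → bit (ε j) (lookup (actE (ρ , η) e) j))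
             ≡ sumF xors ℕ.+ (sumF ands ℕ.+ sumF ands)
      parity = trans (cong (sumF (λ i → bit (η i) (lookup e i)) ℕ.+_)
          (trans (sym (sumF-permute ρ (λ j → bit (ε j) (lookup (actE (ρ , η) e) j))))
            (sumF-cong (λ i → cong (bit (ε (ρ ⟨$⟩ʳ i))) (trans (lookup∘tabulate (λ j → lookup e (ρ ⟨$⟩ˡ j)) (ρ ⟨$⟩ʳ i))
              (cong (lookup e) (FP.inverseˡ ρ)))))))
        (trans (sym (sumF-+ (λ i → bit (η i) (lookup e i)) (λ i → bit (ε (ρ ⟨$⟩ʳ i)) (lookup e i)))) (trans (sumF-cong (λ i → sym (bit-xor (η i) (ε (ρ ⟨$⟩ʳ i)) (lookup e i))))
          (trans (sumF-+ xors (λ i → ands i ℕ.+ ands i)) (cong (sumF xors ℕ.+_) (sumF-+ ands ands)))))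

    act-ι : ∀ p → act ι p ≋ p
    act-ι p = by λ ψ → trans (pair-act ψ ι p) (pair-cong (λ e →
      cong₂ negPow (sumF-0 {n}) (cong ψ (tabulate∘lookup e))) p)

  act-⊛ : ∀ σ τ p → act (σ ⊛ τ) p ≋ act σ (act τ p)
  act-⊛ σ τ p = by λ ψ → trans (pair-act ψ (σ ⊛ τ) p) (trans (pair-cong (λ e →
      trans (cong (λ m → negPow (signExp (σ ⊛ τ) e) (ψ m)) (actE-⊛ σ τ e)) (negPow-⊛ σ τ e _)) p)
    (sym (trans (pair-act ψ σ (act τ p)) (pair-act _ τ p))))

  act-inverse : ∀ σ τ → (σ ⊛ τ) ≐ ι → ∀ p → act σ (act τ p) ≋ p
  act-inverse σ τ h p = ≋-trans (≋-sym (act-⊛ σ τ p)) (≋-trans (act-≐ h p) (act-ι p))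

  act-* : ∀ σ p q → act σ (p *P q) ≋ (act σ p *P act σ q)
  act-* σ p q = by λ ψ → trans (pair-act ψ σ (p *P q)) (trans (pair-* _ p q) (trans (pair-cong (λ e →
      trans (pair-cong (λ f → trans (cong₂ negPow (signExp-+ e f) (cong ψ (actE-+ e f)))
              (negPow-+ (signExp σ e) (signExp σ f) _)) q)
        (trans (pair-negPow (signExp σ e) _ q) (cong (negPow (signExp σ e)) (sym (pair-act _ σ q))))) p)
    (sym (trans (pair-* ψ (act σ p) (act σ q)) (pair-act _ σ p)))))
    where
    bit-+ : ∀ b x y → bit b (x ℕ.+ y) ≡ bit b x ℕ.+ bit b y
    bit-+ true  x y = refl
    bit-+ false x y = refl
    signExp-+ : ∀ e f → signExp σ (Vec.zipWith ℕ._+_ e f) ≡ signExp σ e ℕ.+ signExp σ f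
    signExp-+ e f = trans (sumF-cong (λ i → trans (cong (bit (proj₂ σ i)) (lookup-zipWith ℕ._+_ i e f)) (bit-+ (proj₂ σ i) (lookup e i) (lookup f i))))
      (sumF-+ (λ i → bit (proj₂ σ i) (lookup e i)) (λ i → bit (proj₂ σ i) (lookup f i)))
    actE-+ : ∀ e f → actE σ (Vec.zipWith ℕ._+_ e f) ≡ Vec.zipWith ℕ._+_ (actE σ e) (actE σ f)
    actE-+ e f = trans (tabulate-cong (λ j → lookup-zipWith ℕ._+_ (proj₁ σ ⟨$⟩ˡ j) e f))
      (sym (tabulate-zipWith (λ j → lookup e (proj₁ σ ⟨$⟩ˡ j)) (λ j → lookup f (proj₁ σ ⟨$⟩ˡ j))))
      where
      tabulate-zipWith : ∀ {m} (g h : Fin m → ℕ) → Vec.zipWith ℕ._+_ (tabulate g) (tabulate h) ≡ tabulate (λ i → g i ℕ.+ h i)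
      tabulate-zipWith {zero}  g h = refl
      tabulate-zipWith {suc m} g h = cong (g zero ℕ.+ h zero ∷_) (tabulate-zipWith (g ∘ suc) (h ∘ suc))

  Ideal-act : ∀ σ {p} → Ideal p → Ideal (act σ p)
  Ideal-act σ = Ideal-rec (preimage-isSubspace (act-linear σ) Ideal-isSubspace) λ p {g} G →
    resp Ideal-isSubspace (≋-sym (≋-trans (act-* σ p g) (L-cong (*ʳ-linear (act σ p)) (≈⇒≋ (act σ g) g (proj₁ G σ)))))
      (Ideal-generator (act σ p) G)

-- Enumeration of the group and reindexing of sums over it.

allVec : List A → (n : ℕ) → List (Vec A n)
allVec xs zero    = [] ∷ []
allVec xs (suc n) = cartesianProductWith _∷_ xs (allVec xs n)

allVec-unique : {xs : List A} → Unique xs → ∀ n → Unique (allVec xs n)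
allVec-unique u zero    = [] ∷ []
allVec-unique u (suc n) = Uniqueₚ.cartesianProductWith⁺ _∷_ ∷-injective u (allVec-unique u n)

∈-allVec : {xs : List A} → (∀ x → x ∈ xs) → ∀ {n} (v : Vec A n) → v ∈ allVec xs n
∈-allVec h []      = here refl
∈-allVec h (x ∷ v) = ∈-cartesianProductWith⁺ _∷_ (h x) (∈-allVec h v)

bools : List Bool
bools = true ∷ false ∷ []

bools-unique : Unique bools
bools-unique = ((λ ()) ∷ []) ∷ ([] ∷ [])

∈-bools : ∀ b → b ∈ bools
∈-bools true  = here refl
∈-bools false = there (here refl)

-- Signed permutations are functions, so they are enumerated through first-order codes with decidable equality.
module _ {n : ℕ} where

  private
    Code : Set
    Code = Vec (Fin n) n × Vec (Fin n) n × Vec Bool n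

    _≟C_ : (c d : Code) → Dec (c ≡ d)
    _≟C_ = Productₚ.≡-dec (≡-dec Finₚ._≟_) (Productₚ.≡-dec (≡-dec Finₚ._≟_) (≡-dec Boolₚ._≟_))

    encode : SignedPerm n → Code
    encode (π , ε) = tabulate (π ⟨$⟩ʳ_) , tabulate (π ⟨$⟩ˡ_) , tabulate ε

    inverse? : (f g : Vec (Fin n) n) → Dec ((∀ i → lookup f (lookup g i) ≡ i) × (∀ i → lookup g (lookup f i) ≡ i))
    inverse? f g = Finₚ.all? (λ i → lookup f (lookup g i) Finₚ.≟ i) ×-dec Finₚ.all? (λ i → lookup g (lookup f i) Finₚ.≟ i)

    decode : Code → SignedPerm n
    decode (f , g , s) with inverse? f g
    ... | yes (fg , gf) = FP.permutation (lookup f) (lookup g) fg gf , lookup s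
    -- A junk value: such a code is not canonical, since the code of `ι` does consist of mutually
    -- inverse vectors, and the filter discards it.
    ... | no _ = ι

    encode-cong : ∀ {σ τ} → σ ≐ τ → encode σ ≡ encode τ
    encode-cong (≐-intro a b c) = cong₂ _,_ (tabulate-cong a) (cong₂ _,_ (tabulate-cong b) (tabulate-cong c))

    decode-encode : ∀ σ → decode (encode σ) ≐ σ
    decode-encode (π , ε) with inverse? (tabulate (π ⟨$⟩ʳ_)) (tabulate (π ⟨$⟩ˡ_))
    ... | yes _ = ≐-intro (lookup∘tabulate _) (lookup∘tabulate _) (lookup∘tabulate _)
    ... | no ¬inv = ⊥-elim (¬inv ((λ i → trans (lookup∘tabulate (π ⟨$⟩ʳ_) _) (trans (cong (π ⟨$⟩ʳ_) (lookup∘tabulate (π ⟨$⟩ˡ_) i)) (FP.inverseʳ π)))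
                                 , (λ i → trans (lookup∘tabulate (π ⟨$⟩ˡ_) _) (trans (cong (π ⟨$⟩ˡ_) (lookup∘tabulate (π ⟨$⟩ʳ_) i)) (FP.inverseˡ π)))))

    canonical? : (c : Code) → Dec (encode (decode c) ≡ c)
    canonical? c = encode (decode c) ≟C c

    allCodes codes : List Code
    allCodes = cartesianProduct (allVec (allFin n) n) (cartesianProduct (allVec (allFin n) n) (allVec bools n))
    codes = filter canonical? allCodes

    codes-unique : Unique codes
    codes-unique = Uniqueₚ.filter⁺ canonical? (Uniqueₚ.cartesianProduct⁺ u (Uniqueₚ.cartesianProduct⁺ u (allVec-unique bools-unique n)))
      where u = allVec-unique (Uniqueₚ.allFin⁺ n) n

    encode∈ : ∀ σ → encode σ ∈ codes
    encode∈ σ = ∈-filter⁺ canonical? (∈-cartesianProduct⁺ (∈-allVec ∈-allFin _) (∈-cartesianProduct⁺ (∈-allVec ∈-allFin _) (∈-allVec ∈-bools _)))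
      (encode-cong (decode-encode σ))

    codes-canonical : ∀ {c} → c ∈ codes → encode (decode c) ≡ c
    codes-canonical c∈ = proj₂ (∈-filter⁻ canonical? {xs = allCodes} c∈)

  Respects≐ : (SignedPerm n → ℚ) → Set
  Respects≐ F = ∀ {σ τ} → σ ≐ τ → F σ ≡ F τ

  opaque
    G : List (SignedPerm n)
    G = map decode codes

    G-complete : ∀ σ → ∃ λ τ → τ ∈ G × τ ≐ σ
    G-complete σ = decode (encode σ) , ∈-map⁺ decode (encode∈ σ) , decode-encode σ

    -- On codes equality is propositional, so `encode ∘ f ∘ decode` permutes a list without
    -- repetitions. Summands are carried to and from the codes by `Respects≐`.
    ∑-G-reindex : ∀ {F} → Respects≐ F → (f g : SignedPerm n → SignedPerm n) →
      (∀ {σ τ} → σ ≐ τ → f σ ≐ f τ) → (∀ {σ τ} → σ ≐ τ → g σ ≐ g τ) →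
      (∀ σ → g (f σ) ≐ σ) → (∀ σ → f (g σ) ≐ σ) → ∑ G (F ∘ f) ≡ ∑ G F
    ∑-G-reindex {F} r f g f-cong g-cong gf fg =
      trans (∑-map (F ∘ f) decode codes) (trans (∑-cong codes (λ c → r (≐-sym (decode-encode (f (decode c))))))
      (trans (sym (∑-map (F ∘ decode) (encode ∘ f ∘ decode) codes))
      (trans (∑-↭ (F ∘ decode) (map-bijection-↭ {g = encode ∘ g ∘ decode} codes-unique
          (λ {c} _ → encode∈ (f (decode c))) (λ {c} _ → encode∈ (g (decode c)))
          (λ c∈ → trans (encode-cong (≐-trans (g-cong (decode-encode _)) (gf _))) (codes-canonical c∈))
          (λ c∈ → trans (encode-cong (≐-trans (f-cong (decode-encode _)) (fg _))) (codes-canonical c∈))))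
        (sym (∑-map F decode codes)))))

  ⊛-cancelˡ : ∀ (σ τ υ : SignedPerm n) → (σ ⊛ τ) ≐ ι → (σ ⊛ (τ ⊛ υ)) ≐ υ
  ⊛-cancelˡ σ τ υ h = ≐-trans (≐-sym (⊛-assoc σ τ υ)) (≐-trans (⊛-cong h ≐-refl) (⊛-identityˡ υ))

  ⊛-cancelʳ : ∀ (σ τ υ : SignedPerm n) → (τ ⊛ υ) ≐ ι → ((σ ⊛ τ) ⊛ υ) ≐ σ
  ⊛-cancelʳ σ τ υ h = ≐-trans (⊛-assoc σ τ υ) (≐-trans (⊛-cong ≐-refl h) (⊛-identityʳ σ))

  ∑-G-⊛ˡ : ∀ {F} → Respects≐ F → ∀ σ → ∑ G (λ g → F (σ ⊛ g)) ≡ ∑ G F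
  ∑-G-⊛ˡ {F} r σ = ∑-G-reindex {F} r (σ ⊛_) (inv σ ⊛_) (⊛-cong ≐-refl) (⊛-cong ≐-refl)
    (λ τ → ⊛-cancelˡ (inv σ) σ τ (⊛-inverseˡ σ)) (λ τ → ⊛-cancelˡ σ (inv σ) τ (⊛-inverseʳ σ))

  ∑-G-⊛ʳ : ∀ {F} → Respects≐ F → ∀ σ → ∑ G (λ g → F (g ⊛ σ)) ≡ ∑ G F
  ∑-G-⊛ʳ {F} r σ = ∑-G-reindex {F} r (_⊛ σ) (_⊛ inv σ) (λ e → ⊛-cong e ≐-refl) (λ e → ⊛-cong e ≐-refl)
    (λ τ → ⊛-cancelʳ τ σ (inv σ) (⊛-inverseʳ σ)) (λ τ → ⊛-cancelʳ τ (inv σ) σ (⊛-inverseˡ σ))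

-- Sorting, dominance and rearrangement

takeSum : ℕ → List ℕ → ℕ
takeSum j xs = sumℕ (take j xs)

Descending : List ℕ → Set
Descending = AllPairs (λ x y → y ≤ x)

takeSum-extract : ∀ as {y} bs j → Descending (as ++ y ∷ bs) →
                  y + takeSum j (as ++ bs) ≤ takeSum (suc j) (as ++ y ∷ bs)
takeSum-extract [] bs j d = ℕₚ.≤-refl
takeSum-extract (a ∷ as) {y} bs zero (h ∷ d) = ℕₚ.+-monoˡ-≤ 0 (All.head (Allₚ.++⁻ʳ as h))
takeSum-extract (a ∷ as) {y} bs (suc j) (h ∷ d) = begin
  y + (a + takeSum j (as ++ bs)) ≡⟨ x∙yz≈y∙xz y a _ ⟩
  a + (y + takeSum j (as ++ bs)) ≤⟨ ℕₚ.+-monoʳ-≤ a (takeSum-extract as bs j d) ⟩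
  a + takeSum (suc j) (as ++ y ∷ bs) ∎
  where
  open ℕₚ.≤-Reasoning
  open import Algebra.Properties.CommutativeSemigroup ℕₚ.+-commutativeSemigroup using (x∙yz≈y∙xz)

Descending-remove : ∀ as {y} bs → Descending (as ++ y ∷ bs) → Descending (as ++ bs)
Descending-remove [] bs (_ ∷ d) = d
Descending-remove (a ∷ as) bs (h ∷ d) =
  Allₚ.++⁺ (Allₚ.++⁻ˡ as h) (All.tail (Allₚ.++⁻ʳ as h)) ∷ Descending-remove as bs d

-- The head of `ys` is deleted from the place where it occurs in `xs`, which stays descending. By
-- `takeSum-extract`, putting it back there loses nothing against putting it in front.
takeSum-max : ∀ {xs} ys → Descending xs → ys ↭ xs → ∀ j → takeSum j ys ≤ takeSum j xs
takeSum-max ys d p zero = z≤n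
takeSum-max [] d p (suc j) = z≤n
takeSum-max (y ∷ ys) d p (suc j) with ∈-∃++ (Permₚ.∈-resp-↭ p (here refl))
... | as , bs , refl = ℕₚ.≤-trans
  (ℕₚ.+-monoʳ-≤ y (takeSum-max ys (Descending-remove as bs d) (Permₚ.drop-mid [] as p) j))
  (takeSum-extract as bs j d)

takeSum-injective : ∀ xs ys → length xs ≡ length ys →
                    (∀ j → j ≤ length xs → takeSum j xs ≡ takeSum j ys) → xs ≡ ys
takeSum-injective [] [] _ e = refl
takeSum-injective (x ∷ xs) (y ∷ ys) l e = cong₂ _∷_ x≡y (takeSum-injective xs ys (ℕₚ.suc-injective l)
  λ j le → ℕₚ.+-cancelˡ-≡ x _ _ (trans (e (suc j) (s≤s le)) (cong (_+ takeSum j ys) (sym x≡y))))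
  where
  x≡y : x ≡ y
  x≡y = ℕₚ.+-cancelʳ-≡ 0 x y (e 1 (s≤s z≤n))

descending-unique : ∀ {xs ys} → Descending xs → Descending ys → xs ↭ ys → xs ≡ ys
descending-unique {xs} {ys} dx dy p = takeSum-injective xs ys (Permₚ.↭-length p)
  λ j _ → ℕₚ.≤-antisym (takeSum-max xs dy p j) (takeSum-max ys dx (↭-sym p) j)

sortDesc-↭ : ∀ xs → sortDesc xs ↭ xs
sortDesc-↭ xs = ↭-trans (Permₚ.↭-reverse _) (SortingAlgorithm.sort-↭ mergeSort xs)

sortDesc-descending : ∀ xs → Descending (sortDesc xs)
sortDesc-descending xs = go (SortingAlgorithm.sort mergeSort xs)
  (Sorted⇒AllPairs ℕₚ.≤-totalOrder (SortingAlgorithm.sort-↗ mergeSort xs))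
  where
  go : ∀ ys → AllPairs _≤_ ys → Descending (reverse ys)
  go [] [] = []
  go (y ∷ ys) (h ∷ d) = subst Descending (sym (unfold-reverse y ys))
    (AllPairsₚ.++⁺ (go ys d) ([] ∷ []) (All.map (_∷ []) (Permₚ.All-resp-↭ (↭-sym (Permₚ.↭-reverse ys)) h)))

shape-↭ : ∀ {n} {m m′ : Monomial n} → toList m ↭ toList m′ → shape m ≡ shape m′
shape-↭ {m = m} {m′} p = descending-unique (sortDesc-descending (toList m)) (sortDesc-descending (toList m′))
  (↭-trans (sortDesc-↭ (toList m)) (↭-trans p (↭-sym (sortDesc-↭ (toList m′)))))

shape-act : ∀ {n} (σ : SignedPerm n) e → shape (actE σ e) ≡ shape e
shape-act (π , ε) e = shape-↭ {m = actE (π , ε) e} {e} (subst (toList (actE (π , ε) e) ↭_)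
  (cong toList (tabulate∘lookup e)) (toList-permute-↭ (FP.flip π) (lookup e)))

module _ {n : ℕ} where

  values : (Fin n → ℕ) → List ℕ
  values f = map f (allFin n)

  values-permute : (π : Permutation′ n) (f : Fin n → ℕ) → values (f ∘ (π ⟨$⟩ʳ_)) ↭ values f
  values-permute π f = subst₂ _↭_ (toList-tabulate _) (toList-tabulate _) (toList-permute-↭ π f)

  values-descending : (f : Fin n → ℕ) → (∀ {s t} → toℕ s < toℕ t → f t ≤ f s) → Descending (values f)
  values-descending f h = AllPairsₚ.map⁺ (AllPairsₚ.tabulate⁺-< h)

  shape-values : (m : Monomial n) (σ : Permutation′ n) →
                 (∀ {s t} → toℕ s < toℕ t → lookup m (σ ⟨$⟩ʳ t) ≤ lookup m (σ ⟨$⟩ʳ s)) →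
                 shape m ≡ values (lookup m ∘ (σ ⟨$⟩ʳ_))
  shape-values m σ h = descending-unique (sortDesc-descending (toList m)) (values-descending _ h)
    (↭-trans (sortDesc-↭ (toList m)) (subst (_↭ values (lookup m ∘ (σ ⟨$⟩ʳ_)))
      (trans (sym (toList-tabulate (lookup m))) (cong toList (tabulate∘lookup m))) (↭-sym (values-permute σ (lookup m)))))

argmax : ∀ {n} (K : Fin (suc n) → ℕ) → ∃ λ i → ∀ j → K j ≤ K i
argmax {zero} K = zero , λ { zero → ℕₚ.≤-refl }
argmax {suc n} K with argmax (K ∘ suc)
... | i , h with K (suc i) ≤? K zero
... | yes le = zero , λ { zero → ℕₚ.≤-refl ; (suc j) → ℕₚ.≤-trans (h j) le }
... | no gt = suc i , λ { zero → ℕₚ.<⇒≤ (ℕₚ.≰⇒> gt) ; (suc j) → h j }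

insert-at : ∀ {n} (i j : Fin (suc n)) (π : Permutation′ n) → FP.insert i j π ⟨$⟩ʳ i ≡ j
insert-at i j π with i Finₚ.≟ i
... | yes _ = refl
... | no ne = ⊥-elim (ne refl)

sortingPerm : ∀ {n} (K : Fin n → ℕ) →
              ∃ λ (σ : Permutation′ n) → ∀ {s t} → toℕ s < toℕ t → K (σ ⟨$⟩ʳ t) ≤ K (σ ⟨$⟩ʳ s)
sortingPerm {zero} K = FP.id , λ { {()} }
sortingPerm {suc n} K with argmax K
... | i , max with sortingPerm (K ∘ punchIn i)
... | σ , sorted = FP.insert zero i σ , λ {s} {t} → go s t
  where
  go : ∀ s t → toℕ s < toℕ t → K (FP.insert zero i σ ⟨$⟩ʳ t) ≤ K (FP.insert zero i σ ⟨$⟩ʳ s)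
  go s (suc t) lt with s
  ... | zero rewrite FP.insert-punchIn zero i σ t | insert-at zero i σ = max _
  ... | suc s′ rewrite FP.insert-punchIn zero i σ t | FP.insert-punchIn zero i σ s′ = sorted (ℕ.s<s⁻¹ lt)

-- Abel summation, with the surplus D of the prefix sums of x over those of y carried along.
abel : (is : List A) (k x y : A → ℕ) → AllPairs (λ i j → k j < k i) is →
       ∀ κ D → All (λ i → D ≡ 0 ⊎ k i < κ) is →
       (∀ j → takeSum j (map y is) ≤ D + takeSum j (map x is)) →
       sumℕ (map y is) ≡ D + sumℕ (map x is) →
       (D ≡ 0 × All (λ i → y i ≡ x i) is) ⊎
       sumℕ (map (λ i → k i * y i) is) < κ * D + sumℕ (map (λ i → k i * x i) is)
abel [] k x y [] κ D _ _ tot = inj₁ (trans (sym (ℕₚ.+-identityʳ D)) (sym tot) , [])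
abel (i ∷ is) k x y (h ∷ d) κ D (b ∷ _) dom tot =
  conclude b (abel is k x y d (k i) D′ (All.map inj₂ h)
    (λ j → ℕₚ.+-cancelˡ-≤ (y i) _ _ (ℕₚ.≤-trans (dom (suc j)) (ℕₚ.≤-reflexive (shift _))))
    (ℕₚ.+-cancelˡ-≡ (y i) _ _ (trans tot (shift _))))
  where
  open ℕₚ.≤-Reasoning
  X Y D′ : ℕ
  X = sumℕ (map (λ i → k i * x i) is)
  Y = sumℕ (map (λ i → k i * y i) is)
  D′ = D + x i ∸ y i
  yi≤ : y i ≤ D + x i
  yi≤ = subst₂ _≤_ (ℕₚ.+-identityʳ _) (cong (D +_) (ℕₚ.+-identityʳ _)) (dom 1)
  shift : ∀ t → D + (x i + t) ≡ y i + (D′ + t)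
  shift t = trans (sym (ℕₚ.+-assoc D (x i) t)) (trans (cong (_+ t) (sym (ℕₚ.m+[n∸m]≡n yi≤))) (ℕₚ.+-assoc (y i) D′ t))
  regroup : k i * (D + x i) + X ≡ k i * D + (k i * x i + X)
  regroup = trans (cong (_+ X) (ℕₚ.*-distribˡ-+ (k i) D (x i))) (ℕₚ.+-assoc (k i * D) _ _)
  sums : ∀ {js} → All (λ i → y i ≡ x i) js → sumℕ (map (λ i → k i * y i) js) ≡ sumℕ (map (λ i → k i * x i) js)
  sums [] = refl
  sums {j ∷ _} (e ∷ es) = cong₂ _+_ (cong (k j *_) e) (sums es)
  bound : D ≡ 0 ⊎ k i < κ → k i * D ≤ κ * D
  bound (inj₁ e) rewrite e = ℕₚ.≤-reflexive (trans (ℕₚ.*-zeroʳ (k i)) (sym (ℕₚ.*-zeroʳ κ)))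
  bound (inj₂ l) = ℕₚ.*-monoˡ-≤ D (ℕₚ.<⇒≤ l)
  conclude : D ≡ 0 ⊎ k i < κ → (D′ ≡ 0 × All (λ i → y i ≡ x i) is) ⊎ Y < k i * D′ + X →
             (D ≡ 0 × All (λ i → y i ≡ x i) (i ∷ is)) ⊎ k i * y i + Y < κ * D + (k i * x i + X)
  conclude b (inj₁ (D′≡0 , eqs)) = go b (D ℕₚ.≟ 0)
    where
    yi≡ : y i ≡ D + x i
    yi≡ = ℕₚ.≤-antisym yi≤ (ℕₚ.m∸n≡0⇒m≤n D′≡0)
    go : D ≡ 0 ⊎ k i < κ → Dec (D ≡ 0) →
         (D ≡ 0 × All (λ i → y i ≡ x i) (i ∷ is)) ⊎ k i * y i + Y < κ * D + (k i * x i + X)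
    go _ (yes e) = inj₁ (e , trans yi≡ (cong (_+ x i) e) ∷ eqs)
    go (inj₁ e) (no ne) = ⊥-elim (ne e)
    -- The source of strictness: a positive surplus D is spent at the key `k i`, strictly below the
    -- preceding key κ.
    go (inj₂ lt) (no ne) = inj₂ (begin-strict
      k i * y i + Y             ≡⟨ cong₂ _+_ (cong (k i *_) yi≡) (sums eqs) ⟩
      k i * (D + x i) + X       ≡⟨ regroup ⟩
      k i * D + (k i * x i + X) <⟨ ℕₚ.+-monoˡ-< _ (ℕₚ.*-monoˡ-< D {{ℕ.≢-nonZero ne}} lt) ⟩
      κ * D + (k i * x i + X)   ∎)
  conclude b (inj₂ lt) = inj₂ (begin-strict
    k i * y i + Y              <⟨ ℕₚ.+-monoʳ-< (k i * y i) lt ⟩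
    k i * y i + (k i * D′ + X) ≡⟨ sym (ℕₚ.+-assoc (k i * y i) _ _) ⟩
    k i * y i + k i * D′ + X   ≡⟨ cong (_+ X) (sym (ℕₚ.*-distribˡ-+ (k i) (y i) D′)) ⟩
    k i * (y i + D′) + X       ≡⟨ cong (λ z → k i * z + X) (ℕₚ.m+[n∸m]≡n yi≤) ⟩
    k i * (D + x i) + X        ≡⟨ regroup ⟩
    k i * D + (k i * x i + X)  ≤⟨ ℕₚ.+-monoˡ-≤ _ (bound b) ⟩
    κ * D + (k i * x i + X)    ∎)

sumF-* : ∀ {n} c (f : Fin n → ℕ) → sumF (λ i → c * f i) ≡ c * sumF f
sumF-* {zero}  c f = sym (ℕₚ.*-zeroʳ c)
sumF-* {suc n} c f = trans (cong (c * f zero +_) (sumF-* c (f ∘ suc))) (sym (ℕₚ.*-distribˡ-+ c (f zero) _))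

sumF-values : ∀ {n} (f : Fin n → ℕ) → sumF f ≡ sumℕ (values f)
sumF-values f = cong sumℕ (toList-tabulate f)

≤-sumF : ∀ {n} (f : Fin n → ℕ) i → f i ≤ sumF f
≤-sumF f zero    = ℕₚ.m≤m+n _ _
≤-sumF f (suc i) = ℕₚ.≤-trans (≤-sumF (f ∘ suc) i) (ℕₚ.m≤n+m _ (f zero))

takeSum-linear : ∀ (is : List A) (f g : A → ℕ) j →
  takeSum j (map (λ i → f i + 2 * g i) is) ≡ takeSum j (map f is) + 2 * takeSum j (map g is)
takeSum-linear is f g zero = refl
takeSum-linear [] f g (suc j) = refl
takeSum-linear (i ∷ is) f g (suc j) = trans (cong (f i + 2 * g i +_) (takeSum-linear is f g j))
  (solve 4 (λ a b c d → (a :+ con 2 :* b) :+ (c :+ con 2 :* d) := (a :+ c) :+ con 2 :* (b :+ d)) refl (f i) (g i)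
    (takeSum j (map f is)) (takeSum j (map g is)))
  where open ℕ-Solver

-- Decomposition of exponent vectors, with its effect on energy and shape.

Compat : ∀ {n} → (Fin n → ℕ) → (Fin n → ℕ) → Set
Compat K c = ∀ i j → K i < K j → c i ≤ c j

Injective : ∀ {n} → (Fin n → ℕ) → Set
Injective K = ∀ {i j} → K i ≡ K j → i ≡ j

module _ {n : ℕ} where

  module _ {K : Fin n → ℕ} (inj : Injective K) (σ : Permutation′ n)
           (sorted : ∀ {s t} → toℕ s < toℕ t → K (σ ⟨$⟩ʳ t) ≤ K (σ ⟨$⟩ʳ s)) where

    sorted-strict : ∀ {s t} → toℕ s < toℕ t → K (σ ⟨$⟩ʳ t) < K (σ ⟨$⟩ʳ s)
    sorted-strict {s} {t} lt = ℕₚ.≤∧≢⇒< (sorted lt) λ e → ℕₚ.<-irrefl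
      (cong toℕ (trans (sym (FP.inverseˡ σ)) (trans (cong (σ ⟨$⟩ˡ_) (sym (inj e))) (FP.inverseˡ σ)))) lt

    sorted-Compat : ∀ {c} → Compat K c → ∀ {s t} → toℕ s < toℕ t → c (σ ⟨$⟩ʳ t) ≤ c (σ ⟨$⟩ʳ s)
    sorted-Compat h lt = h _ _ (sorted-strict lt)

  -- In the order that sorts K, a compatible c is descending and so has the largest prefix sums
  -- among its rearrangements. Abel summation then applies with no initial surplus; injectivity of K
  -- makes the keys strictly decreasing, as strictness requires.
  rearrangement : ∀ {K c c′ : Fin n → ℕ} → Injective K → Compat K c → values c′ ↭ values c →
    (∀ i → c′ i ≡ c i) ⊎ sumF (λ i → K i * c′ i) < sumF (λ i → K i * c i)
  rearrangement {K} {c} {c′} inj h p with sortingPerm K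
  ... | σ , sorted with abel (allFin n) (K ∘ (σ ⟨$⟩ʳ_)) (c ∘ (σ ⟨$⟩ʳ_)) (c′ ∘ (σ ⟨$⟩ʳ_))
        (AllPairsₚ.tabulate⁺-< (sorted-strict inj σ sorted)) 0 0 (All.tabulate λ _ → inj₁ refl)
        (takeSum-max _ (values-descending _ (sorted-Compat inj σ sorted h)) p′) (sum-↭ p′)
    where
    p′ : values (c′ ∘ (σ ⟨$⟩ʳ_)) ↭ values (c ∘ (σ ⟨$⟩ʳ_))
    p′ = ↭-trans (values-permute σ c′) (↭-trans p (↭-sym (values-permute σ c)))
  ... | inj₁ (_ , eqs) = inj₁ λ i → subst (λ j → c′ j ≡ c j) (FP.inverseʳ σ) (All.lookup eqs (∈-allFin (σ ⟨$⟩ˡ i)))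
  ... | inj₂ lt = inj₂ (subst₂ _<_ (unsort c′) (unsort c) lt)
    where
    unsort : ∀ (d : Fin n → ℕ) → sumℕ (map (λ t → K (σ ⟨$⟩ʳ t) * d (σ ⟨$⟩ʳ t)) (allFin n)) ≡ sumF (λ i → K i * d i)
    unsort d = trans (sum-↭ (values-permute σ (λ i → K i * d i))) (sym (sumF-values (λ i → K i * d i)))

  record Split (m b c : Fin n → ℕ) : Set where
    constructor split
    field parts : ∀ i → m i ≡ b i + 2 * c i

  open Split public

  -- Ordering the indices by key f sorts f decreasingly, ties being broken in favour of smaller indices.
  key : (Fin n → ℕ) → Fin n → ℕ
  key f i = toℕ (opposite i) + f i * n

  key-mono : ∀ f {i j} → f i < f j → key f i < key f j
  key-mono f {i} {j} lt = begin-strict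
    toℕ (opposite i) + f i * n <⟨ ℕₚ.+-monoˡ-< (f i * n) (Finₚ.toℕ<n (opposite i)) ⟩
    n + f i * n                ≤⟨ ℕₚ.*-monoˡ-≤ n lt ⟩
    f j * n                    ≤⟨ ℕₚ.m≤n+m _ _ ⟩
    key f j                    ∎
    where open ℕₚ.≤-Reasoning

  key-reflects : ∀ f {i j} → key f i ≤ key f j → f i ≤ f j
  key-reflects f le = ℕₚ.≮⇒≥ (λ lt → ℕₚ.<⇒≱ (key-mono f lt) le)

  -- Lowering f by 2 at i and at all indices preceding it keeps the order of the indices.
  -- The irreducible exponent vectors are those of the descent monomials.
  Reducible : (Fin n → ℕ) → Fin n → Set
  Reducible f i = 2 ≤ f i × (∀ k → key f k < key f i → key f k + 2 * n < key f i)

  Irreducible : (Fin n → ℕ) → Set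
  Irreducible f = ∀ i → ¬ Reducible f i

  reducible? : ∀ f i → Dec (Reducible f i)
  reducible? f i = (2 ≤? f i) ×-dec Finₚ.all? (λ k → (key f k <? key f i) →-dec (key f k + 2 * n <? key f i))

  key-+ : ∀ {f b c : Fin n → ℕ} → Split f b c → ∀ i → key f i ≡ key b i + c i * (2 * n)
  key-+ {f} {b} {c} e i = trans (cong (λ x → toℕ (opposite i) + x * n) (parts e i))
    (solve 4 (λ w b c n → w :+ (b :+ con 2 :* c) :* n := (w :+ b :* n) :+ c :* (con 2 :* n)) refl (toℕ (opposite i)) (b i) (c i) n)
    where open ℕ-Solver

-- The tie-breaking term is less than n, so it is the residue of the key modulo n and determines the
-- index.
key-injective : ∀ {n} (f : Fin n → ℕ) → Injective (key f)
key-injective {suc n} f {i} {j} e = trans (sym (Finₚ.opposite-involutive i)) (trans (cong opposite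
    (Finₚ.toℕ-injective (trans (sym (residue i)) (trans (cong (_% suc n) e) (residue j))))) (Finₚ.opposite-involutive j))
  where
  residue : ∀ i → key f i % suc n ≡ toℕ (opposite i)
  residue i = trans ([m+kn]%n≡m%n (toℕ (opposite i)) (f i) (suc n)) (m<n⇒m%n≡m (Finₚ.toℕ<n (opposite i)))

module _ {n : ℕ} where

  record Decomposition (m : Fin n → ℕ) : Set where
    field
      base rest   : Fin n → ℕ
      sum-eq      : Split m base rest
      irreducible : Irreducible base
      compat      : Compat (key base) rest

  -- Keys move by 2n times the entries of c, which respect the order of b. Thus b and b + 2c sort
  -- the indices alike, and two decompositions of the same m share one order.
  Compat-order : ∀ {m b c : Fin n → ℕ} → Split m b c → Compat (key b) c →
                 ∀ i j → key b i < key b j → key m i < key m j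
  Compat-order {m} {b} {c} e h i j lt = subst₂ _<_ (sym (key-+ e i)) (sym (key-+ e j))
    (ℕₚ.+-mono-<-≤ lt (ℕₚ.*-monoˡ-≤ (2 * n) (h i j lt)))

  Compat-order⁻ : ∀ {m b c : Fin n → ℕ} → Split m b c → Compat (key b) c →
                  ∀ i j → key m i < key m j → key b i < key b j
  Compat-order⁻ {m} {b} {c} e h i j lt with ℕₚ.<-cmp (key b i) (key b j)
  ... | Tri.tri< l _ _ = l
  ... | Tri.tri≈ _ q _ = ⊥-elim (ℕₚ.<-irrefl (cong (key m) (key-injective b q)) lt)
  ... | Tri.tri> _ _ g = ⊥-elim (ℕₚ.<-asym lt (Compat-order e h j i g))

  -- Greedy: while some i is reducible, 2 is subtracted at i and at all indices preceding it. The
  -- indicators `c₀` of these initial segments add up to the rest. The fuel bounds the sum of the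
  -- entries, which drops each time.
  decompose : ∀ fuel (m : Fin n → ℕ) → sumF m < fuel → Decomposition m
  decompose (suc fuel) m (s≤s le) with Finₚ.any? (reducible? m)
  ... | no ¬red = record
    { base = m ; rest = λ _ → 0 ; sum-eq = split λ i → sym (ℕₚ.+-identityʳ (m i))
    ; irreducible = λ i r → ¬red (i , r) ; compat = λ _ _ _ → z≤n }
  ... | yes (i , 2≤ , gap) = record
    { base = D.base ; rest = λ j → c₀ j + D.rest j
    ; sum-eq = split λ j → trans (parts m≡ j) (trans (cong (_+ 2 * c₀ j) (parts D.sum-eq j))
        (solve 3 (λ b c r → (b :+ con 2 :* r) :+ con 2 :* c := b :+ con 2 :* (c :+ r)) refl (D.base j) (c₀ j) (D.rest j)))
    ; irreducible = D.irreducible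
    ; compat = λ j k lt → ℕₚ.+-mono-≤ (c₀-compat j k (Compat-order D.sum-eq D.compat j k lt)) (D.compat j k lt) }
    where
    open ℕ-Solver
    c₀ m′ : Fin n → ℕ
    c₀ j with key m i ≤? key m j
    ... | yes _ = 1
    ... | no _ = 0
    -- The subtraction never truncates: an index preceding i carries a value at least that of i,
    -- which is at least 2.
    m′ j = m j ∸ 2 * c₀ j
    c₀-cases : ∀ j → (key m i ≤ key m j × c₀ j ≡ 1) ⊎ (key m j < key m i × c₀ j ≡ 0)
    c₀-cases j with key m i ≤? key m j
    ... | yes l = inj₁ (l , refl)
    ... | no g = inj₂ (ℕₚ.≰⇒> g , refl)
    m≡ : Split m m′ c₀
    m≡ = split λ j → sym (ℕₚ.m∸n+n≡m (enough (c₀-cases j)))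
      where
      enough : ∀ {j} → (key m i ≤ key m j × c₀ j ≡ 1) ⊎ (key m j < key m i × c₀ j ≡ 0) → 2 * c₀ j ≤ m j
      enough (inj₁ (l , e)) rewrite e = ℕₚ.≤-trans 2≤ (key-reflects m l)
      enough (inj₂ (_ , e)) rewrite e = z≤n
    c₀i : 1 ≤ c₀ i
    c₀i with c₀-cases i
    ... | inj₁ (_ , e) = ℕₚ.≤-reflexive (sym e)
    ... | inj₂ (l , _) = ⊥-elim (ℕₚ.<-irrefl refl l)
    smaller : sumF m′ < fuel
    smaller = ℕₚ.≤-trans (begin-strict
      sumF m′                         <⟨ ℕₚ.m<m+n _ (ℕₚ.≤-trans (ℕₚ.≤-trans c₀i (ℕₚ.m≤m+n _ _)) (≤-sumF (λ j → 2 * c₀ j) i)) ⟩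
      sumF m′ + sumF (λ j → 2 * c₀ j) ≡⟨ sym (sumF-+ m′ (λ j → 2 * c₀ j)) ⟩
      sumF (λ j → m′ j + 2 * c₀ j)    ≡⟨ sym (sumF-cong (parts m≡)) ⟩
      sumF m                          ∎) le
      where open ℕₚ.≤-Reasoning
    module D = Decomposition (decompose fuel m′ smaller)
    c₀-compat : Compat (key m′) c₀
    c₀-compat j k lt with c₀-cases j | c₀-cases k
    ... | inj₂ (_ , e) | _ = ℕₚ.≤-trans (ℕₚ.≤-reflexive e) z≤n
    ... | inj₁ (_ , e) | inj₁ (_ , e′) = ℕₚ.≤-reflexive (trans e (sym e′))
    -- An index j in the segment and k outside it cannot be exchanged by the lowering: the gap at i
    -- exceeds the 2n by which the key of j drops.
    ... | inj₁ (l , e) | inj₂ (g , e′) = ⊥-elim (ℕₚ.<-asym lt (ℕₚ.+-cancelʳ-< (2 * n) _ _ (begin-strict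
      key m′ k + 2 * n          ≡⟨ cong (_+ 2 * n) (trans (sym (ℕₚ.+-identityʳ _)) (cong (λ x → key m′ k + x * (2 * n)) (sym e′))) ⟩
      key m′ k + c₀ k * (2 * n) + 2 * n ≡⟨ cong (_+ 2 * n) (sym (key-+ m≡ k)) ⟩
      key m k + 2 * n           <⟨ gap k g ⟩
      key m i                   ≤⟨ l ⟩
      key m j                   ≡⟨ key-+ m≡ j ⟩
      key m′ j + c₀ j * (2 * n) ≡⟨ cong (key m′ j +_) (trans (cong (_* (2 * n)) e) (ℕₚ.*-identityˡ (2 * n))) ⟩
      key m′ j + 2 * n          ∎)))
      where open ℕₚ.≤-Reasoning

  -- Induction on the key of j in b. Suppose c j < c′ j, while c′ is at most c at smaller keys. Then
  -- the key of b is at most that of b′ at those indices, but exceeds it by at least 2n at j. Since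
  -- b and b′ give the same order, j lies more than 2n above all smaller keys, and b would be
  -- reducible there.
  rest-≤ : ∀ {m b c b′ c′ : Fin n → ℕ} → Irreducible b →
           Split m b c → Compat (key b) c →
           Split m b′ c′ → Compat (key b′) c′ → ∀ j → c′ j ≤ c j
  rest-≤ {m} {b} {c} {b′} {c′} irr e h e′ h′ j = <-rec (λ x → ∀ j → key b j ≡ x → c′ j ≤ c j) step _ j refl
    where
    keys : ∀ k → key b k + c k * (2 * n) ≡ key b′ k + c′ k * (2 * n)
    keys k = trans (sym (key-+ e k)) (key-+ e′ k)
    step : ∀ x → (∀ {y} → y < x → ∀ j → key b j ≡ y → c′ j ≤ c j) → ∀ j → key b j ≡ x → c′ j ≤ c j
    step x ih j refl = ℕₚ.≮⇒≥ λ lt → irr j (big lt , gap lt)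
      where
      open ℕₚ.≤-Reasoning
      big : c j < c′ j → 2 ≤ b j
      big lt = ℕₚ.+-cancelʳ-≤ (2 * c j) 2 (b j) (begin
        2 + 2 * c j      ≡⟨ solve 1 (λ x → con 2 :+ con 2 :* x := con 2 :* (con 1 :+ x)) refl (c j) ⟩
        2 * suc (c j)    ≤⟨ ℕₚ.*-monoʳ-≤ 2 lt ⟩
        2 * c′ j         ≤⟨ ℕₚ.m≤n+m _ (b′ j) ⟩
        b′ j + 2 * c′ j  ≡⟨ sym (parts e′ j) ⟩
        m j              ≡⟨ parts e j ⟩
        b j + 2 * c j    ∎)
        where open ℕ-Solver
      gap : c j < c′ j → ∀ k → key b k < key b j → key b k + 2 * n < key b j
      gap lt k lk = begin-strict
        key b k + 2 * n  ≤⟨ ℕₚ.+-monoˡ-≤ (2 * n) (ℕₚ.+-cancelʳ-≤ (c k * (2 * n)) _ _ (begin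
          key b k + c k * (2 * n)   ≡⟨ keys k ⟩
          key b′ k + c′ k * (2 * n) ≤⟨ ℕₚ.+-monoʳ-≤ (key b′ k) (ℕₚ.*-monoˡ-≤ (2 * n) (ih lk k refl)) ⟩
          key b′ k + c k * (2 * n)  ∎)) ⟩
        key b′ k + 2 * n <⟨ ℕₚ.+-monoˡ-< (2 * n) (Compat-order⁻ e′ h′ k j (Compat-order e h k j lk)) ⟩
        key b′ j + 2 * n ≤⟨ ℕₚ.+-cancelʳ-≤ (c j * (2 * n)) _ _ (begin
          key b′ j + 2 * n + c j * (2 * n)  ≡⟨ ℕₚ.+-assoc (key b′ j) (2 * n) _ ⟩
          key b′ j + suc (c j) * (2 * n)    ≤⟨ ℕₚ.+-monoʳ-≤ (key b′ j) (ℕₚ.*-monoˡ-≤ (2 * n) lt) ⟩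
          key b′ j + c′ j * (2 * n)         ≡⟨ sym (keys j) ⟩
          key b j + c j * (2 * n)           ∎) ⟩
        key b j          ∎

  decomposition-unique : ∀ {m : Fin n → ℕ} (d d′ : Decomposition m) →
    let open Decomposition in (∀ i → base d i ≡ base d′ i) × (∀ i → rest d i ≡ rest d′ i)
  decomposition-unique d d′ = (λ i → ℕₚ.+-cancelʳ-≡ (2 * D.rest i) _ _
      (trans (sym (parts D.sum-eq i)) (trans (parts D′.sum-eq i) (cong (λ x → D′.base i + 2 * x) (sym (rest-eq i)))))) , rest-eq
    where
    module D = Decomposition d
    module D′ = Decomposition d′
    rest-eq : ∀ i → D.rest i ≡ D′.rest i
    rest-eq i = ℕₚ.≤-antisym (rest-≤ D′.irreducible D′.sum-eq D′.compat D.sum-eq D.compat i)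
                             (rest-≤ D.irreducible D.sum-eq D.compat D′.sum-eq D′.compat i)

  -- When c is permuted in b + 2c, the energy varies as the sum of the products of key b and c (energy-+),
  -- so that the strict rearrangement inequality applies.
  energy : (Fin n → ℕ) → ℕ
  energy f = sumF (λ i → f i * (f i * n + 2 * toℕ (opposite i)))

  energy-+ : ∀ {f b c : Fin n → ℕ} → Split f b c →
             energy f ≡ energy b + (4 * sumF (λ i → key b i * c i) + 4 * n * sumF (λ i → c i * c i))
  energy-+ {f} {b} {c} e = trans (sumF-cong λ i → trans (cong (λ x → x * (x * n + 2 * toℕ (opposite i))) (parts e i))
      (solve 4 (λ b c w n → (b :+ con 2 :* c) :* ((b :+ con 2 :* c) :* n :+ con 2 :* w)
          := b :* (b :* n :+ con 2 :* w) :+ (con 4 :* ((w :+ b :* n) :* c) :+ con 4 :* n :* (c :* c))) refl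
        (b i) (c i) (toℕ (opposite i)) n))
    (trans (sumF-+ _ (λ i → 4 * (key b i * c i) + 4 * n * (c i * c i))) (cong (energy b +_)
      (trans (sumF-+ (λ i → 4 * (key b i * c i)) (λ i → 4 * n * (c i * c i)))
        (cong₂ _+_ (sumF-* 4 (λ i → key b i * c i)) (sumF-* (4 * n) (λ i → c i * c i))))))
    where open ℕ-Solver

  energy-decreases : ∀ {m m′ b c c′ : Fin n → ℕ} → Split m b c → Split m′ b c′ →
    Compat (key b) c → values c′ ↭ values c → (∀ i → m′ i ≡ m i) ⊎ energy m′ < energy m
  energy-decreases {m} {m′} {b} {c} {c′} e e′ h p with rearrangement (key-injective b) h p
  ... | inj₁ eq = inj₁ λ i → trans (parts e′ i) (trans (cong (λ x → b i + 2 * x) (eq i)) (sym (parts e i)))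
  ... | inj₂ lt = inj₂ (begin-strict
    energy m′ ≡⟨ energy-+ e′ ⟩
    energy b + (4 * sumF (λ i → key b i * c′ i) + 4 * n * sumF (λ i → c′ i * c′ i)) ≡⟨ cong (λ x → energy b + (4 * sumF (λ i → key b i * c′ i) + 4 * n * x)) squares ⟩
    energy b + (4 * sumF (λ i → key b i * c′ i) + 4 * n * sumF (λ i → c i * c i))
      <⟨ ℕₚ.+-monoʳ-< (energy b) (ℕₚ.+-monoˡ-< (4 * n * sumF (λ i → c i * c i)) (ℕₚ.*-monoʳ-< 4 lt)) ⟩
    energy b + (4 * sumF (λ i → key b i * c i) + 4 * n * sumF (λ i → c i * c i)) ≡⟨ sym (energy-+ e) ⟩
    energy m  ∎)
    where
    open ℕₚ.≤-Reasoning
    square-values : ∀ d → sumF (λ i → d i * d i) ≡ sumℕ (map (λ x → x * x) (values d))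
    square-values d = trans (sumF-values (λ i → d i * d i)) (cong sumℕ (map-∘ (allFin n)))
    squares : sumF (λ i → c′ i * c′ i) ≡ sumF (λ i → c i * c i)
    squares = trans (square-values c′) (trans (sum-↭ (Permₚ.map⁺ (λ x → x * x) p)) (sym (square-values c)))

  shape-sum : (m : Monomial n) → sumℕ (shape m) ≡ sumF (lookup m)
  shape-sum m = trans (sum-↭ (sortDesc-↭ (toList m))) (cong (sumℕ ∘ toList) (sym (tabulate∘lookup m)))

  -- A prefix sum of the sorted b + 2c′ is at most the largest one of b plus twice the largest one
  -- of c. As c is compatible with b, a single ordering attains both bounds at once, and it sorts b
  -- + 2c.
  dominance : ∀ {b c c′ : Fin n → ℕ} (m m′ : Monomial n) →
    Split (lookup m) b c → Split (lookup m′) b c′ →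
    Compat (key b) c → values c′ ↭ values c → shape m′ ⊴ shape m
  dominance {b} {c} {c′} m m′ e e′ h p with sortingPerm (key b) | sortingPerm (lookup m′)
  ... | σ , sorted | σ′ , sorted′ = total , prefix
    where
    open ℕₚ.≤-Reasoning
    b-sorted : ∀ {s t} → toℕ s < toℕ t → b (σ ⟨$⟩ʳ t) ≤ b (σ ⟨$⟩ʳ s)
    b-sorted lt = key-reflects b (sorted lt)
    c-sorted : ∀ {s t} → toℕ s < toℕ t → c (σ ⟨$⟩ʳ t) ≤ c (σ ⟨$⟩ʳ s)
    c-sorted = sorted-Compat (key-injective b) σ sorted h
    m-shape : shape m ≡ map (λ t → b (σ ⟨$⟩ʳ t) + 2 * c (σ ⟨$⟩ʳ t)) (allFin n)
    m-shape = trans (shape-values m σ λ {s} {t} lt → subst₂ _≤_ (sym (parts e _)) (sym (parts e _))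
        (ℕₚ.+-mono-≤ (b-sorted lt) (ℕₚ.*-monoʳ-≤ 2 (c-sorted lt)))) (map-cong (λ t → parts e (σ ⟨$⟩ʳ t)) (allFin n))
    m′-shape : shape m′ ≡ map (λ t → b (σ′ ⟨$⟩ʳ t) + 2 * c′ (σ′ ⟨$⟩ʳ t)) (allFin n)
    m′-shape = trans (shape-values m′ σ′ sorted′) (map-cong (λ t → parts e′ (σ′ ⟨$⟩ʳ t)) (allFin n))
    total : sumℕ (shape m′) ≡ sumℕ (shape m)
    total = trans (sum-of m′ e′) (trans (cong (λ x → sumF b + 2 * x) c-sum) (sym (sum-of m e)))
      where
      c-sum : sumF c′ ≡ sumF c
      c-sum = trans (sumF-values c′) (trans (sum-↭ p) (sym (sumF-values c)))
      sum-of : ∀ {d} (m : Monomial n) → Split (lookup m) b d → sumℕ (shape m) ≡ sumF b + 2 * sumF d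
      sum-of {d} m e = trans (shape-sum m) (trans (sumF-cong (parts e)) (trans (sumF-+ b (λ i → 2 * d i)) (cong (sumF b +_) (sumF-* 2 d))))
    prefix : ∀ j → takeSum j (shape m′) ≤ takeSum j (shape m)
    prefix j = begin
      takeSum j (shape m′) ≡⟨ trans (cong (takeSum j) m′-shape) (takeSum-linear (allFin n) (b ∘ (σ′ ⟨$⟩ʳ_)) (c′ ∘ (σ′ ⟨$⟩ʳ_)) j) ⟩
      takeSum j (values (b ∘ (σ′ ⟨$⟩ʳ_))) + 2 * takeSum j (values (c′ ∘ (σ′ ⟨$⟩ʳ_)))
        ≤⟨ ℕₚ.+-mono-≤ (takeSum-max _ (values-descending _ b-sorted) (↭-trans (values-permute σ′ b) (↭-sym (values-permute σ b))) j)
            (ℕₚ.*-monoʳ-≤ 2 (takeSum-max _ (values-descending _ c-sorted)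
              (↭-trans (values-permute σ′ c′) (↭-trans p (↭-sym (values-permute σ c)))) j)) ⟩
      takeSum j (values (b ∘ (σ ⟨$⟩ʳ_))) + 2 * takeSum j (values (c ∘ (σ ⟨$⟩ʳ_)))
        ≡⟨ sym (trans (cong (takeSum j) m-shape) (takeSum-linear (allFin n) (b ∘ (σ ⟨$⟩ʳ_)) (c ∘ (σ ⟨$⟩ʳ_)) j)) ⟩
      takeSum j (shape m) ∎

  -- The entry of rank t in c is moved to the index of rank t for K.
  compatible-rearrangement : ∀ (K c : Fin n → ℕ) → ∃ λ (π : Permutation′ n) → Compat K (c ∘ (π ⟨$⟩ˡ_))
  compatible-rearrangement K c with sortingPerm K | sortingPerm c
  ... | σ , σ-sorted | τ , τ-sorted = FP.flip τ ∘ₚ σ , go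
    where
    go : Compat K (λ i → c (τ ⟨$⟩ʳ (σ ⟨$⟩ˡ i)))
    go i j lt with ℕₚ.<-cmp (toℕ (σ ⟨$⟩ˡ i)) (toℕ (σ ⟨$⟩ˡ j))
    ... | Tri.tri> _ _ gt = τ-sorted gt
    ... | Tri.tri≈ _ eq _ = ℕₚ.≤-reflexive (cong (c ∘ (τ ⟨$⟩ʳ_)) (Finₚ.toℕ-injective eq))
    ... | Tri.tri< l _ _ = ⊥-elim (ℕₚ.<⇒≱ lt (subst₂ (λ x y → K x ≤ K y) (FP.inverseʳ σ) (FP.inverseʳ σ) (σ-sorted l)))

-- The partitions λ_{S₁,S₂}

private
  bitℕ : Bool → ℕ
  bitℕ b = if b then 1 else 0

indicator-zero : ∀ {m} s (S : Subset m) → indicator (s ∷ S) zero ≡ bitℕ s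
indicator-zero true  S = refl
indicator-zero false S = refl

indicator-suc : ∀ {m} s (S : Subset m) i → indicator (s ∷ S) (suc i) ≡ indicator S i
indicator-suc s S i = cong bitℕ (trans (isYes≗does (suc i ∈? (s ∷ S))) (sym (isYes≗does (i ∈? S))))

sumF-indicator : ∀ {m} (S : Subset m) → sumF (indicator S) ≡ ∣ S ∣
sumF-indicator [] = refl
sumF-indicator (true  ∷ S) = cong suc (trans (sumF-cong (indicator-suc true S)) (sumF-indicator S))
sumF-indicator (false ∷ S) = trans (sumF-cong (indicator-suc false S)) (sumF-indicator S)

∣∷∣ : ∀ {m} s (S : Subset m) → ∣ s ∷ S ∣ ≡ bitℕ s + ∣ S ∣
∣∷∣ true  S = refl
∣∷∣ false S = refl

sumElems-∷ : ∀ {m} s (S : Subset m) → sumElems (s ∷ S) ≡ bitℕ s + (sumElems S + ∣ S ∣)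
sumElems-∷ s S = cong₂ _+_ (trans (ℕₚ.*-identityʳ _) (indicator-zero s S))
  (trans (sumF-cong λ j → trans (cong (_* suc (suc (toℕ j))) (indicator-suc s S j))
      (trans (ℕₚ.*-suc (indicator S j) (suc (toℕ j))) (ℕₚ.+-comm (indicator S j) _)))
    (trans (sumF-+ (λ j → indicator S j * suc (toℕ j)) (indicator S)) (cong (sumElems S +_) (sumF-indicator S))))

suc≤?suc : ∀ i j → ⌊ suc i ≤? suc j ⌋ ≡ ⌊ i ≤? j ⌋
suc≤?suc i j = trans (isYes≗does (suc i ≤? suc j)) (trans (go i) (sym (isYes≗does (i ≤? j))))
  where
  go : ∀ i → does (suc i ≤? suc j) ≡ does (i ≤? j)
  go zero    = refl
  go (suc i) = refl

-- `lamS` by recursion on the position: the first entry counts all of S₁, and the later ones forget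
-- its first element.
staircase : ∀ {m} → Subset m → Subset (suc m) → Vec ℕ (suc m)
staircase []       (s ∷ _) = bitℕ s ∷ []
staircase (b ∷ S₁) (s ∷ S₂) = (2 * ∣ b ∷ S₁ ∣ + bitℕ s) ∷ staircase S₁ S₂

lamS-staircase : ∀ {m} (S₁ : Subset m) (S₂ : Subset (suc m)) → lamS (suc m) S₁ S₂ ≡ staircase S₁ S₂
lamS-staircase [] (s ∷ []) = cong (_∷ []) (indicator-zero s [])
lamS-staircase (b ∷ S₁) (s ∷ S₂) = cong₂ _∷_
  (cong₂ (λ x y → 2 * x + y) (sumF-indicator (b ∷ S₁)) (indicator-zero s S₂))
  (trans (Vecₚ.tabulate-cong λ i → cong₂ (λ x y → 2 * x + y)
      (sumF-cong λ j → cong₂ (λ p x → if p then x else 0) (suc≤?suc (toℕ i) (toℕ j)) (indicator-suc b S₁ j))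
      (indicator-suc s S₂ i)) (lamS-staircase S₁ S₂))

staircase-sum : ∀ {m} (S₁ : Subset m) S₂ → sumℕ (toList (staircase S₁ S₂)) ≡ 2 * sumElems S₁ + ∣ S₂ ∣
staircase-sum [] (s ∷ []) = sym (∣∷∣ s [])
staircase-sum (b ∷ S₁) (s ∷ S₂) rewrite staircase-sum S₁ S₂ | sumElems-∷ b S₁ | ∣∷∣ b S₁ | ∣∷∣ s S₂ =
  solve 5 (λ b s c e t → (con 2 :* (b :+ c) :+ s) :+ (con 2 :* e :+ t) := con 2 :* (b :+ (e :+ c)) :+ (s :+ t)) refl
    (bitℕ b) (bitℕ s) (∣ S₁ ∣) (sumElems S₁) (∣ S₂ ∣)
  where open ℕ-Solver

2*-bit-injective : ∀ x y s t → 2 * x + bitℕ s ≡ 2 * y + bitℕ t → x ≡ y × s ≡ t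
2*-bit-injective zero zero true true e = refl , refl
2*-bit-injective zero zero false false e = refl , refl
2*-bit-injective zero (suc y) true t e rewrite ℕₚ.+-suc y (y + 0) with () ← e
2*-bit-injective zero (suc y) false t e rewrite ℕₚ.+-suc y (y + 0) with () ← e
2*-bit-injective (suc x) zero s true e rewrite ℕₚ.+-suc x (x + 0) with () ← e
2*-bit-injective (suc x) zero s false e rewrite ℕₚ.+-suc x (x + 0) with () ← e
2*-bit-injective (suc x) (suc y) s t e rewrite ℕₚ.+-suc x (x + 0) | ℕₚ.+-suc y (y + 0)
  with 2*-bit-injective x y s t (ℕₚ.suc-injective (ℕₚ.suc-injective e))
... | refl , q = refl , q

bitℕ-injective : ∀ b b′ → bitℕ b ≡ bitℕ b′ → b ≡ b′
bitℕ-injective true  true  e = refl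
bitℕ-injective false false e = refl

-- The parities of the entries give S₂. Their halves are the sizes of the tails of S₁, whose
-- successive differences give S₁.
staircase-injective : ∀ {m} (S₁ T₁ : Subset m) S₂ T₂ → staircase S₁ S₂ ≡ staircase T₁ T₂ → S₁ ≡ T₁ × S₂ ≡ T₂
staircase-injective [] [] (s ∷ []) (t ∷ []) e = refl , cong (_∷ []) (bitℕ-injective s t (Vecₚ.∷-injectiveˡ e))
staircase-injective (b ∷ S₁) (b′ ∷ T₁) (s ∷ S₂) (t ∷ T₂) e
  with staircase-injective S₁ T₁ S₂ T₂ (Vecₚ.∷-injectiveʳ e)
     | 2*-bit-injective ∣ b ∷ S₁ ∣ ∣ b′ ∷ T₁ ∣ s t (Vecₚ.∷-injectiveˡ e)
... | refl , refl | q , refl = cong (_∷ S₁) (bitℕ-injective b b′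
        (ℕₚ.+-cancelʳ-≡ ∣ S₁ ∣ _ _ (trans (sym (∣∷∣ b S₁)) (trans q (∣∷∣ b′ S₁))))) , refl

-- These are not all the partitions λ_{S₁,S₂}: (3,0) comes from S₁ = {1} and S₂ = {1}. A valid λ
-- that is the shape of no descent monomial has R^B_λ = 0, because `top` then vanishes, so it does
-- no harm in the direct sum.
SmallSteps : ∀ {m} → Vec ℕ (suc m) → Set
SmallSteps (x ∷ []) = x < 2
SmallSteps (x ∷ y ∷ v) = y ≤ x × x ≤ 2 + y × SmallSteps (y ∷ v)

-- Built from the last entry: a step of 0 or 2 keeps the membership in S₂, a step of 1 toggles it,
-- and S₁ gains an element for a step of 2 or for a step of 1 from an odd entry.
toStaircase : ∀ {m} (v : Vec ℕ (suc m)) → SmallSteps v → ∃ λ S₁ → ∃ λ S₂ → staircase S₁ S₂ ≡ v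
toStaircase (zero ∷ []) _ = [] , (false ∷ []) , refl
toStaircase (suc zero ∷ []) _ = [] , (true ∷ []) , refl
toStaircase (suc (suc _) ∷ []) (s≤s (s≤s ()))
toStaircase (x ∷ y ∷ v) (y≤x , x≤ , small) with toStaircase (y ∷ v) small
... | S₁ , s ∷ S₂ , e = go (x ∸ y) (sym (ℕₚ.m∸n+n≡m y≤x)) (ℕₚ.m≤n+o⇒m∸n≤o x y (ℕₚ.≤-trans x≤ (ℕₚ.≤-reflexive (ℕₚ.+-comm 2 y)))) s e
  where
  head : ∀ {m} (S₁ : Subset m) s S₂ {v} → staircase S₁ (s ∷ S₂) ≡ y ∷ v → y ≡ 2 * ∣ S₁ ∣ + bitℕ s
  head [] s S₂ refl = refl
  head (b ∷ S₁) s S₂ refl = refl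
  build : ∀ {s} → staircase S₁ (s ∷ S₂) ≡ y ∷ v → ∀ b t → 2 * ∣ b ∷ S₁ ∣ + bitℕ t ≡ x →
          ∃ λ S₁ → ∃ λ S₂ → staircase S₁ S₂ ≡ x ∷ y ∷ v
  build e b t q = (b ∷ S₁) , (t ∷ _) , cong₂ _∷_ q e
  double-suc : 2 * suc ∣ S₁ ∣ ≡ 2 + 2 * ∣ S₁ ∣
  double-suc = cong suc (ℕₚ.+-suc _ _)
  go : ∀ d → x ≡ d + y → d ≤ 2 → ∀ s → staircase S₁ (s ∷ S₂) ≡ y ∷ v → ∃ λ S₁ → ∃ λ S₂ → staircase S₁ S₂ ≡ x ∷ y ∷ v
  go 0 p _ s e = build e false s (sym (trans p (head S₁ s S₂ e)))
  go 1 p _ false e = build e false true (sym (trans p (trans (cong suc (head S₁ false S₂ e)) (sym (ℕₚ.+-suc _ 0)))))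
  go 1 p _ true e = build e true false (sym (trans p (trans (cong suc (head S₁ true S₂ e))
    (trans (sym (ℕₚ.+-suc _ 1)) (trans (ℕₚ.+-comm _ 2) (trans (sym double-suc) (sym (ℕₚ.+-identityʳ _))))))))
  go 2 p _ s e = build e true s (sym (trans p (trans (cong (2 +_) (head S₁ s S₂ e)) (cong (_+ bitℕ s) (sym double-suc)))))
  go (suc (suc (suc _))) p (s≤s (s≤s ())) s e

lamS-sum : ∀ n (S₁ : Subset (n ∸ 1)) (S₂ : Subset n) → sumℕ (toList (lamS n S₁ S₂)) ≡ 2 * sumElems S₁ + ∣ S₂ ∣
lamS-sum zero [] [] = refl
lamS-sum (suc n) S₁ S₂ = trans (cong (sumℕ ∘ toList) (lamS-staircase S₁ S₂)) (staircase-sum S₁ S₂)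

toList-injective : ∀ {n} (v w : Vec ℕ n) → toList v ≡ toList w → v ≡ w
toList-injective [] [] e = refl
toList-injective (x ∷ v) (y ∷ w) e = cong₂ _∷_ (∷-injectiveˡ e) (toList-injective v w (∷-injectiveʳ e))
  where open import Data.List.Properties using (∷-injectiveˡ; ∷-injectiveʳ)

lamS-injective : ∀ n (S₁ T₁ : Subset (n ∸ 1)) (S₂ T₂ : Subset n) →
                 toList (lamS n S₁ S₂) ≡ toList (lamS n T₁ T₂) → S₁ ≡ T₁ × S₂ ≡ T₂
lamS-injective zero [] [] [] [] e = refl , refl
lamS-injective (suc n) S₁ T₁ S₂ T₂ e = staircase-injective S₁ T₁ S₂ T₂
  (trans (sym (lamS-staircase S₁ S₂)) (trans (toList-injective _ _ e) (lamS-staircase T₁ T₂)))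

smallSteps-tabulate : ∀ {m} (f : Fin (suc m) → ℕ) → (∀ t → f (suc t) ≤ f (inject₁ t) × f (inject₁ t) ≤ 2 + f (suc t)) →
                      f (fromℕ m) < 2 → SmallSteps (tabulate f)
smallSteps-tabulate {zero} f _ last = last
smallSteps-tabulate {suc m} f steps last = proj₁ (steps zero) , proj₂ (steps zero) ,
  smallSteps-tabulate (f ∘ suc) (steps ∘ suc) last

-- After a drop of 3 or more, all indices before it could be lowered by 2 and still precede the
-- others: two units of the drop pay for the lowering and the third outweighs the tie-breaking
-- terms. A last value of 2 or more would allow lowering every index.
irreducible-smallSteps : ∀ {m} (f : Fin (suc m) → ℕ) → Irreducible f →
  ∀ (σ : Permutation′ (suc m)) → (∀ {s t} → toℕ s < toℕ t → key f (σ ⟨$⟩ʳ t) ≤ key f (σ ⟨$⟩ʳ s)) → SmallSteps (tabulate (f ∘ (σ ⟨$⟩ʳ_)))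
irreducible-smallSteps {m} f irr σ sorted = smallSteps-tabulate (f ∘ (σ ⟨$⟩ʳ_))
  (λ t → key-reflects f (sorted (ℕₚ.≤-reflexive (cong suc (Finₚ.toℕ-inject₁ t)))) , ℕₚ.≮⇒≥ (step t))
  (ℕₚ.≰⇒> λ 2≤ → irr _ (2≤ , λ k lt → ⊥-elim (ℕₚ.<⇒≱ (below k lt) (subst (toℕ (σ ⟨$⟩ˡ k) ≤_) (sym (Finₚ.toℕ-fromℕ m)) (ℕ.s≤s⁻¹ (Finₚ.toℕ<n _))))))
  where
  weakly : ∀ {s t} → toℕ s ≤ toℕ t → key f (σ ⟨$⟩ʳ t) ≤ key f (σ ⟨$⟩ʳ s)
  weakly {s} {t} le with ℕₚ.m≤n⇒m<n∨m≡n le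
  ... | inj₁ lt = sorted lt
  ... | inj₂ e = ℕₚ.≤-reflexive (cong (key f ∘ (σ ⟨$⟩ʳ_)) (sym (Finₚ.toℕ-injective e)))
  below : ∀ {s} k → key f k < key f (σ ⟨$⟩ʳ s) → toℕ s < toℕ (σ ⟨$⟩ˡ k)
  below {s} k lt = ℕₚ.≰⇒> λ le → ℕₚ.<⇒≱ lt (subst (λ x → key f (σ ⟨$⟩ʳ s) ≤ key f x) (FP.inverseʳ σ) (weakly le))
  step : ∀ t → ¬ (2 + f (σ ⟨$⟩ʳ suc t) < f (σ ⟨$⟩ʳ inject₁ t))
  step t lt = irr _ (ℕₚ.≤-trans (ℕₚ.≤-trans (ℕₚ.m≤m+n 2 _) (ℕₚ.n≤1+n _)) lt , λ k kl → begin-strict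
    key f k + 2 * suc m ≤⟨ ℕₚ.+-monoˡ-≤ (2 * suc m) (subst (λ x → key f x ≤ key f (σ ⟨$⟩ʳ suc t)) (FP.inverseʳ σ)
        (weakly (ℕₚ.≤-trans (ℕₚ.≤-reflexive (cong suc (sym (Finₚ.toℕ-inject₁ t)))) (below k kl)))) ⟩
    key f (σ ⟨$⟩ʳ suc t) + 2 * suc m                  <⟨ ℕₚ.+-monoˡ-< (2 * suc m) (ℕₚ.+-monoˡ-< (f′ * suc m) (Finₚ.toℕ<n (opposite (σ ⟨$⟩ʳ suc t)))) ⟩
    (suc m + f′ * suc m) + 2 * suc m                  ≡⟨ solve 2 (λ n x → (n :+ x :* n) :+ con 2 :* n := (con 3 :+ x) :* n) refl (suc m) f′ ⟩
    (3 + f′) * suc m                                  ≤⟨ ℕₚ.*-monoˡ-≤ (suc m) lt ⟩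
    f (σ ⟨$⟩ʳ inject₁ t) * suc m                      ≤⟨ ℕₚ.m≤n+m _ _ ⟩
    key f (σ ⟨$⟩ʳ inject₁ t)                          ∎)
    where
    open ℕₚ.≤-Reasoning
    open ℕ-Solver using (solve; _:+_; _:*_; _:=_; con)
    f′ = f (σ ⟨$⟩ʳ suc t)

irreducible-shape : ∀ {n} (d : Monomial n) → Irreducible (lookup d) →
                    ∃ λ S₁ → ∃ λ S₂ → toList (lamS n S₁ S₂) ≡ shape d
irreducible-shape {zero} [] irr = [] , [] , refl
irreducible-shape {suc m} d irr with sortingPerm (key (lookup d))
... | σ , sorted with toStaircase _ (irreducible-smallSteps (lookup d) irr σ sorted)
... | S₁ , S₂ , e = S₁ , S₂ , trans (cong toList (trans (lamS-staircase S₁ S₂) e))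
  (trans (toList-tabulate (lookup d ∘ (σ ⟨$⟩ʳ_))) (sym (shape-values d σ (λ lt → key-reflects (lookup d) (sorted lt)))))

-- The dominance order and a numerical weight for it.

⊴-refl : ∀ {μ} → μ ⊴ μ
⊴-refl = refl , λ j → ℕₚ.≤-refl

⊴-trans : ∀ {μ ν κ} → μ ⊴ ν → ν ⊴ κ → μ ⊴ κ
⊴-trans (a , b) (c , d) = trans a c , λ j → ℕₚ.≤-trans (b j) (d j)

-- Lists differing by trailing zeros dominate each other, hence the hypothesis on lengths. Shapes
-- all have length n.
⊴-antisym : ∀ {μ ν} → length μ ≡ length ν → μ ⊴ ν → ν ⊴ μ → μ ≡ ν
⊴-antisym l (_ , b) (_ , d) = takeSum-injective _ _ l λ j _ → ℕₚ.≤-antisym (b j) (d j)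

⊴-◁-trans : ∀ {μ ν κ} → length μ ≡ length ν → μ ⊴ ν → ν ◁ κ → μ ◁ κ
⊴-◁-trans l μν (νκ , ν≢κ) = ⊴-trans μν νκ , λ { refl → ν≢κ (⊴-antisym (sym l) νκ μν) }

⊴-stable : ∀ μ ν → ¬ ¬ (μ ⊴ ν) → μ ⊴ ν
⊴-stable μ ν h = decidable-stable (_ ℕₚ.≟ _) (λ n → h (n ∘ proj₁)) ,
                 λ j → decidable-stable (_ ≤? _) (λ n → h (λ x → n (proj₂ x j)))

◁-stable : ∀ μ ν → ¬ ¬ (μ ◁ ν) → μ ◁ ν
◁-stable μ ν h = ⊴-stable μ ν (λ n → h (n ∘ proj₁)) , λ e → h (λ x → proj₂ x e)

shape-length : ∀ {n} (m : Monomial n) → length (shape m) ≡ n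
shape-length m = trans (Permₚ.↭-length (sortDesc-↭ (toList m))) (Vecₚ.length-toList m)

-- The sum of the prefix sums is strictly monotone for dominance on lists of length n, which turns
-- induction along dominance into induction on numbers.
weight : ℕ → List ℕ → ℕ
weight n μ = sumF {suc n} (λ j → takeSum (toℕ j) μ)

sumF-mono-≤ : ∀ {n} (f g : Fin n → ℕ) → (∀ i → f i ≤ g i) → sumF f ≤ sumF g
sumF-mono-≤ {zero} f g h = z≤n
sumF-mono-≤ {suc n} f g h = ℕₚ.+-mono-≤ (h zero) (sumF-mono-≤ (f ∘ suc) (g ∘ suc) (h ∘ suc))

sumF-tight : ∀ {n} (f g : Fin n → ℕ) → (∀ i → f i ≤ g i) → sumF g ≤ sumF f → ∀ i → f i ≡ g i
sumF-tight f g h le zero = ℕₚ.≤-antisym (h zero) (ℕₚ.+-cancelʳ-≤ (sumF (f ∘ suc)) _ _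
  (ℕₚ.≤-trans (ℕₚ.+-monoʳ-≤ (g zero) (sumF-mono-≤ (f ∘ suc) (g ∘ suc) (h ∘ suc))) le))
sumF-tight f g h le (suc i) = sumF-tight (f ∘ suc) (g ∘ suc) (h ∘ suc)
  (ℕₚ.+-cancelˡ-≤ (g zero) _ _ (ℕₚ.≤-trans le (ℕₚ.+-monoˡ-≤ _ (h zero)))) i

weight-mono : ∀ n {μ ν} → μ ⊴ ν → weight n μ ≤ weight n ν
weight-mono n (_ , b) = sumF-mono-≤ {suc n} _ _ (λ i → b (toℕ i))

weight-strict : ∀ n {μ ν} → length μ ≡ n → length ν ≡ n → μ ◁ ν → weight n μ < weight n ν
weight-strict n {μ} {ν} refl l ((_ , b) , ne) = ℕₚ.≰⇒> λ le → ne (takeSum-injective μ ν (sym l) λ j j≤ →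
  subst (λ j → takeSum j μ ≡ takeSum j ν) (Finₚ.toℕ-fromℕ< (s≤s j≤))
    (sumF-tight _ _ (λ i → b (toℕ i)) le (fromℕ< (s≤s j≤))))

takeSum-≤-sum : ∀ j xs → takeSum j xs ≤ sumℕ xs
takeSum-≤-sum zero xs = z≤n
takeSum-≤-sum (suc j) [] = z≤n
takeSum-≤-sum (suc j) (x ∷ xs) = ℕₚ.+-monoʳ-≤ x (takeSum-≤-sum j xs)

sumF-bound : ∀ {n} (f : Fin n → ℕ) B → (∀ i → f i ≤ B) → sumF f ≤ n * B
sumF-bound {zero} f B h = z≤n
sumF-bound {suc n} f B h = ℕₚ.+-mono-≤ (h zero) (sumF-bound (f ∘ suc) B (h ∘ suc))

-- Allows induction from the dominant shapes downward, on the distance to this bound.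
weight-bound : ∀ n μ → weight n μ ≤ suc n * sumℕ μ
weight-bound n μ = sumF-bound {suc n} _ _ (λ i → takeSum-≤-sum (toℕ i) μ)

-- Normal forms modulo the ideal

∑-nonneg : {A : Set} (F : A → ℚ) (xs : List A) → (∀ x → 0ℚ ℚ.≤ F x) → 0ℚ ℚ.≤ ∑ xs F
∑-nonneg F [] h = ℚₚ.≤-refl
∑-nonneg F (x ∷ xs) h = ℚₚ.+-mono-≤ (h x) (∑-nonneg F xs h)

∑-positive : {A : Set} (F : A → ℚ) {xs : List A} {x : A} → (∀ x → 0ℚ ℚ.≤ F x) → x ∈ xs → F x ≡ 1ℚ → 0ℚ ℚ.< ∑ xs F
∑-positive F {_ ∷ xs} h (here refl) e =
  ℚₚ.+-mono-<-≤ {0ℚ} {_} {0ℚ} (subst (0ℚ ℚ.<_) (sym e) (ℚₚ.positive⁻¹ 1ℚ)) (∑-nonneg F xs h)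
∑-positive F {y ∷ _} h (there x∈) e = ℚₚ.+-mono-≤-< {0ℚ} {_} {0ℚ} (h y) (∑-positive F h x∈ e)

inverseOf : ∀ {x} → 0ℚ ℚ.< x → ∃ λ y → y ℚ.* x ≡ 1ℚ
inverseOf {x} lt = (ℚ.1/ x) {{ℚ.>-nonZero lt}} , ℚₚ.*-inverseˡ x {{ℚ.>-nonZero lt}}

≡-neg⇒≡0 : ∀ x → ℚ.- x ≡ x → x ≡ 0ℚ
≡-neg⇒≡0 x e = trans (solve 1 (λ x → x := con ½ :* (x :+ x)) refl x)
  (trans (cong (λ y → ½ ℚ.* (y ℚ.+ x)) (sym e)) (trans (cong (½ ℚ.*_) (ℚₚ.+-inverseˡ x)) (ℚₚ.*-zeroʳ ½)))
  where open +-*-Solver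

negPow-0 : ∀ s → negPow s 0ℚ ≡ 0ℚ
negPow-0 zero = refl
negPow-0 (suc s) = cong ℚ.-_ (negPow-0 s)

even-or-odd : ∀ s → 2 * ⌊ s /2⌋ ≡ s ⊎ (∀ x → negPow s x ≡ ℚ.- x)
even-or-odd zero = inj₁ refl
even-or-odd (suc zero) = inj₂ λ x → refl
even-or-odd (suc (suc s)) with even-or-odd s
... | inj₁ e = inj₁ (trans (ℕₚ.*-suc 2 ⌊ s /2⌋) (cong (2 +_) e))
... | inj₂ e = inj₂ λ x → trans (neg-involutive _) (e x)

sumF-single : ∀ {n} (f : Fin n → ℕ) i → sumF (λ j → if does (j Finₚ.≟ i) then f j else 0) ≡ f i
sumF-single {suc n} f zero = trans (cong (f zero +_) (sumF-0 {n})) (ℕₚ.+-identityʳ _)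
sumF-single {suc n} f (suc i) = sumF-single (f ∘ suc) i

lookup-ext : ∀ {A : Set} {n} {u v : Vec A n} → (∀ i → lookup u i ≡ lookup v i) → u ≡ v
lookup-ext {u = u} {v} h = trans (sym (tabulate∘lookup u)) (trans (tabulate-cong h) (tabulate∘lookup v))

module _ {n : ℕ} where

  open Decomposition

  ∑-cong-All : ∀ {A : Set} {F F′ : A → ℚ} {xs : List A} → All (λ x → F x ≡ F′ x) xs → ∑ xs F ≡ ∑ xs F′
  ∑-cong-All [] = refl
  ∑-cong-All (e ∷ es) = cong₂ ℚ._+_ e (∑-cong-All es)

  ext-cong-span : ∀ {Q : Monomial n → Set} {φ χ : Monomial n → Poly n} {p} → InSpan Q p →
                  (∀ e → Q e → φ e ≋ χ e) → ext φ p ≋ ext χ p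
  ext-cong-span {Q} {φ} {χ} {p} s h = ≋-trans (≋-sym (ext-cong (clean p))) (≋-trans
    (by λ ψ → trans (pair-ext ψ φ q) (trans (∑-cong-All (All.map (λ {t} o → cong (proj₁ t ℚ.*_) (at (h _ (occurs⇒ s _ o)) ψ))
      (Allₚ.all-filter (occurs? p ∘ proj₂) p))) (sym (pair-ext ψ χ q)))) (ext-cong (clean p)))
    where q = restrict (occurs? p) p

  zero-isSubspace : IsSubspace {n} (_≋ [])
  zero-isSubspace = ker-isSubspace id-linear

  infixl 6 _⊞_
  _⊞_ : Monomial n → Monomial n → Monomial n
  _⊞_ = Vec.zipWith _+_

  double : Monomial n → Monomial n
  double = Vec.map (2 *_)

  lookup-double : ∀ c i → lookup (double c) i ≡ 2 * lookup c i
  lookup-double c i = lookup-map i (2 *_) c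

  lookup-⊞double : ∀ b c i → lookup (b ⊞ double c) i ≡ lookup b i + 2 * lookup c i
  lookup-⊞double b c i = trans (lookup-zipWith _+_ i b (double c)) (cong (lookup b i +_) (lookup-double c i))

  actE-double : ∀ σ c → actE σ (double c) ≡ double (actE σ c)
  actE-double σ c = lookup-ext λ i → trans (lookup∘tabulate _ i) (trans (lookup-double c _)
    (sym (trans (lookup-double (actE σ c) i) (cong (2 *_) (lookup∘tabulate _ i)))))

  negPow-double : ∀ σ c x → negPow (signExp σ (double c)) x ≡ x
  negPow-double (π , ε) c x = trans (cong (λ s → negPow s x) (trans (sumF-cong λ i →
      trans (cong (λ e → if ε i then e else 0) (trans (lookup-double c i) (cong (lookup c i +_) (ℕₚ.+-identityʳ _))))
        (if-+ (ε i) (lookup c i)))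
      (sumF-+ (λ i → if ε i then lookup c i else 0) (λ i → if ε i then lookup c i else 0))))
    (negPow-even (sumF (λ i → if ε i then lookup c i else 0)) x)
    where
    if-+ : ∀ b e → (if b then e + e else 0) ≡ (if b then e else 0) + (if b then e else 0)
    if-+ true  e = refl
    if-+ false e = refl

  -- The sum runs over the group rather than the orbit, so an exponent is counted with the order of
  -- its stabilizer. On doubled exponents all signs are trivial and no cancellation occurs.
  orbitSum : Monomial n → Poly n
  orbitSum e = sumP (map (λ g → act g (mono e)) G)

  pair-act-mono : ∀ ψ (g : SignedPerm n) (e : Monomial n) → pair ψ (act g (mono e)) ≡ negPow (signExp g e) (ψ (actE g e))
  pair-act-mono ψ g e = trans (pair-act ψ g (mono e)) (pair-mono (λ e → negPow (signExp g e) (ψ (actE g e))) e)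

  pair-orbitSum-double : ∀ ψ c → pair ψ (orbitSum (double c)) ≡ ∑ G (λ g → ψ (actE g (double c)))
  pair-orbitSum-double ψ c = trans (pair-sumP ψ (λ g → act g (mono (double c))) G)
    (∑-cong (G {n}) λ g → trans (pair-act-mono ψ g (double c)) (negPow-double g c (ψ (actE g (double c)))))

  actE-≐ : ∀ {σ τ : SignedPerm n} → σ ≐ τ → ∀ e → actE σ e ≡ actE τ e
  actE-≐ h e = tabulate-cong (λ j → cong (lookup e) (ˡ-eq h j))

  orbitSum-invariant : ∀ e σ → act σ (orbitSum e) ≋ orbitSum e
  orbitSum-invariant e σ = by λ ψ → trans (at (L-sumP (act-linear σ) (λ g → act g (mono e)) G) ψ)
    (trans (pair-sumP ψ (λ g → act σ (act g (mono e))) G)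
    (trans (∑-cong G λ g → sym (at (act-⊛ σ g (mono e)) ψ))
    (trans (∑-G-⊛ˡ {F = λ g → pair ψ (act g (mono e))} (λ h → at (act-≐ h (mono e)) ψ) σ)
      (sym (pair-sumP ψ (λ g → act g (mono e)) G)))))

  orbitSum-permute : ∀ τ c → orbitSum (double (actE τ c)) ≋ orbitSum (double c)
  orbitSum-permute τ c = by λ ψ → trans (pair-orbitSum-double ψ (actE τ c))
    (trans (∑-cong G λ g → cong ψ (trans (cong (actE g) (sym (actE-double τ c))) (sym (actE-⊛ g τ (double c)))))
    (trans (∑-G-⊛ʳ {F = λ g → ψ (actE g (double c))} (λ h → cong ψ (actE-≐ h (double c))) τ)
      (sym (pair-orbitSum-double ψ c))))

  double-nonzero : ∀ {c} → ¬ c ≡ zeroMono → ∀ g → ¬ actE g (double c) ≡ zeroMono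
  double-nonzero {c} ne g e = ne (lookup-ext λ i → trans (ℕₚ.m*n≡0⇒m≡0 _ 2 (begin
    lookup c i * 2                                ≡⟨ ℕₚ.*-comm (lookup c i) 2 ⟩
    2 * lookup c i                                ≡⟨ sym (lookup-double c i) ⟩
    lookup (double c) i                           ≡⟨ cong (lookup (double c)) (sym (FP.inverseˡ (proj₁ g))) ⟩
    lookup (double c) (proj₁ g ⟨$⟩ˡ (proj₁ g ⟨$⟩ʳ i)) ≡⟨ sym (lookup∘tabulate _ (proj₁ g ⟨$⟩ʳ i)) ⟩
    lookup (actE g (double c)) (proj₁ g ⟨$⟩ʳ i)   ≡⟨ cong (λ v → lookup v (proj₁ g ⟨$⟩ʳ i)) e ⟩
    lookup zeroMono (proj₁ g ⟨$⟩ʳ i)              ≡⟨ lookup-replicate (proj₁ g ⟨$⟩ʳ i) 0 ⟩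
    0                                             ∎)) (sym (lookup-replicate i 0)))
    where open ≡-Reasoning

  orbitSum-generator : ∀ {c} → ¬ c ≡ zeroMono → Generator (orbitSum (double c))
  orbitSum-generator {c} ne = (λ σ → ≋⇒≈ {p = act σ (orbitSum (double c))} (orbitSum-invariant (double c) σ)) ,
    trans (coeff-pair (orbitSum (double c)) zeroMono) (trans (pair-orbitSum-double (δ zeroMono) c)
      (∑-zero _ (All.tabulate {xs = G {n}} λ {g} _ → δ-≢ zeroMono _ (double-nonzero ne g))))

  -- Pairing with the delta function at the zero exponent is evaluation at the origin, hence
  -- multiplicative: a product has no constant term as soon as one factor has none.
  generator-* : ∀ p {g} → (∀ σ → act σ p ≋ p) → Generator g → Generator (p *P g)
  generator-* p {g} inv (sym-g , const-g) =
    (λ σ → ≋⇒≈ {p = act σ (p *P g)} (≋-trans (act-* σ p g) (≋-trans (L-cong (*ˡ-linear (act σ g)) (inv σ))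
      (L-cong (*ʳ-linear p) (≈⇒≋ (act σ g) g (sym-g σ)))))) ,
    trans (coeff-pair (p *P g) zeroMono) (trans (pair-* (δ zeroMono) p g) (trans (pair-cong inner p) (pair-0fun p)))
    where
    ⊞-zero : ∀ e f → e ⊞ f ≡ zeroMono → e ≡ zeroMono × f ≡ zeroMono
    ⊞-zero e f h = lookup-ext (λ i → trans (ℕₚ.m+n≡0⇒m≡0 _ (z i)) (sym (lookup-replicate i 0))) ,
                   lookup-ext (λ i → trans (ℕₚ.m+n≡0⇒n≡0 (lookup e i) (z i)) (sym (lookup-replicate i 0)))
      where
      z : ∀ i → lookup e i + lookup f i ≡ 0
      z i = trans (sym (lookup-zipWith _+_ i e f)) (trans (cong (λ v → lookup v i) h) (lookup-replicate i 0))
    δ-yes : ∀ {e} → e ≡ zeroMono → δ zeroMono e ≡ 1ℚ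
    δ-yes {e} refl = δ-refl e
    zero-⊞ : zeroMono ⊞ zeroMono ≡ zeroMono
    zero-⊞ = lookup-ext λ i → trans (lookup-zipWith _+_ i zeroMono zeroMono)
      (trans (cong₂ _+_ (lookup-replicate i 0) (lookup-replicate i 0)) (sym (lookup-replicate i 0)))
    factor : ∀ e f → δ zeroMono (e ⊞ f) ≡ δ zeroMono e ℚ.* δ zeroMono f
    factor e f = go (≡-dec ℕ._≟_ e zeroMono) (≡-dec ℕ._≟_ f zeroMono)
      where
      go : Dec (e ≡ zeroMono) → Dec (f ≡ zeroMono) → δ zeroMono (e ⊞ f) ≡ δ zeroMono e ℚ.* δ zeroMono f
      go (yes p) (yes q) = trans (δ-yes (trans (cong₂ _⊞_ p q) zero-⊞)) (sym (cong₂ ℚ._*_ (δ-yes p) (δ-yes q)))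
      go (no ne) _ = trans (δ-≢ zeroMono (e ⊞ f) (ne ∘ proj₁ ∘ ⊞-zero e f))
        (sym (trans (cong (ℚ._* δ zeroMono f) (δ-≢ zeroMono e ne)) (ℚₚ.*-zeroˡ (δ zeroMono f))))
      go (yes _) (no ne) = trans (δ-≢ zeroMono (e ⊞ f) (ne ∘ proj₂ ∘ ⊞-zero e f))
        (sym (trans (cong (δ zeroMono e ℚ.*_) (δ-≢ zeroMono f ne)) (ℚₚ.*-zeroʳ (δ zeroMono e))))
    inner : ∀ e → pair (λ f → δ zeroMono (e ⊞ f)) g ≡ 0ℚ
    inner e = trans (pair-cong (factor e) g) (trans (pair-*fun (δ zeroMono e) (δ zeroMono) g)
      (trans (cong (δ zeroMono e ℚ.*_) (trans (sym (coeff-pair g zeroMono)) const-g)) (ℚₚ.*-zeroʳ (δ zeroMono e))))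

  decomp : (m : Monomial n) → Decomposition (lookup m)
  decomp m = decompose (suc (sumF (lookup m))) (lookup m) ℕₚ.≤-refl

  opaque
    baseOf restOf : Monomial n → Monomial n
    baseOf m = tabulate (base (decomp m))
    restOf m = tabulate (rest (decomp m))

    baseOf-irreducible : ∀ m → Irreducible (lookup (baseOf m))
    baseOf-irreducible m = subst-irreducible (λ i → sym (lookup∘tabulate (base (decomp m)) i)) (irreducible (decomp m))
      where
      subst-irreducible : ∀ {f g : Fin n → ℕ} → (∀ i → f i ≡ g i) → Irreducible f → Irreducible g
      subst-irreducible {f} {g} e irr i (2≤ , gap) = irr i (subst (2 ≤_) (sym (e i)) 2≤ ,
        λ k lt → subst₂ (λ x y → x + 2 * n < y) (sym (key-cong k)) (sym (key-cong i)) (gap k (subst₂ _<_ (key-cong k) (key-cong i) lt)))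
        where
        key-cong : ∀ k → key f k ≡ key g k
        key-cong k = cong (λ x → Fin.toℕ (Fin.opposite k) + x * n) (e k)

    split-baseOf : ∀ m → Split (lookup m) (lookup (baseOf m)) (lookup (restOf m))
    split-baseOf m = split λ i → trans (parts (sum-eq (decomp m)) i)
      (sym (cong₂ (λ x y → x + 2 * y) (lookup∘tabulate (base (decomp m)) i) (lookup∘tabulate (rest (decomp m)) i)))

    restOf-compat : ∀ m → Compat (key (lookup (baseOf m))) (lookup (restOf m))
    restOf-compat m i j lt = subst₂ _≤_ (sym (lookup∘tabulate (rest (decomp m)) i)) (sym (lookup∘tabulate (rest (decomp m)) j))
      (compat (decomp m) i j (subst₂ _<_ (key-cong i) (key-cong j) lt))
      where
      key-cong : ∀ k → key (lookup (baseOf m)) k ≡ key (base (decomp m)) k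
      key-cong k = cong (λ x → Fin.toℕ (Fin.opposite k) + x * n) (lookup∘tabulate (base (decomp m)) k)

  decompositionOf : ∀ m → Decomposition (lookup m)
  decompositionOf m = record { base = lookup (baseOf m) ; rest = lookup (restOf m) ; sum-eq = split-baseOf m
                             ; irreducible = baseOf-irreducible m ; compat = restOf-compat m }

  base-rest-unique : ∀ {m b c} → Irreducible (lookup b) → Compat (key (lookup b)) (lookup c) →
                     Split (lookup m) (lookup b) (lookup c) → baseOf m ≡ b × restOf m ≡ c
  base-rest-unique {m} irr h e with decomposition-unique (decompositionOf m)
    (record { sum-eq = e ; irreducible = irr ; compat = h })
  ... | p , q = lookup-ext p , lookup-ext q

  base-of-rest-zero : ∀ m → restOf m ≡ zeroMono → baseOf m ≡ m
  base-of-rest-zero m z = lookup-ext λ i → sym (trans (parts (split-baseOf m) i)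
    (trans (cong (λ v → lookup (baseOf m) i + 2 * lookup v i) z) (trans (cong (λ x → lookup (baseOf m) i + 2 * x) (lookup-replicate i 0)) (ℕₚ.+-identityʳ _))))

  energyOf : Monomial n → ℕ
  energyOf m = energy (lookup m)

  opaque
    -- The E m form a basis of the polynomial ring with leading terms m; those with restOf m ≠ 0 span the ideal.
    E : Monomial n → Poly n
    E m = mono (baseOf m) *P orbitSum (double (restOf m))

    E-def : ∀ m → E m ≡ mono (baseOf m) *P orbitSum (double (restOf m))
    E-def m = refl

  pair-mono-orbit : ∀ ψ b c → pair ψ (mono b *P orbitSum (double c)) ≡ ∑ G (λ g → ψ (b ⊞ actE g (double c)))
  pair-mono-orbit ψ b c = trans (pair-* ψ (mono b) (orbitSum (double c))) (trans (pair-mono (λ e → pair (λ f → ψ (e ⊞ f)) (orbitSum (double c))) b) (pair-orbitSum-double (λ f → ψ (b ⊞ f)) c))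

  pair-E : ∀ ψ m → pair ψ (E m) ≡ ∑ G (λ g → ψ (baseOf m ⊞ actE g (double (restOf m))))
  pair-E ψ m = trans (cong (pair ψ) (E-def m)) (pair-mono-orbit ψ (baseOf m) (restOf m))

  ⊞-baseOf : ∀ m → baseOf m ⊞ double (restOf m) ≡ m
  ⊞-baseOf m = lookup-ext λ i → trans (lookup-⊞double (baseOf m) (restOf m) i) (sym (parts (split-baseOf m) i))

  -- Every group element contributes 0 or 1 to this coefficient, and the identity contributes 1. It
  -- need not equal 1, so `scaleE` normalizes it.
  leading-positive : ∀ m → 0ℚ ℚ.< coeff (E m) m
  leading-positive m with G-complete ι
  ... | τ , τ∈ , τ≐ι = subst (0ℚ ℚ.<_) (sym (trans (coeff-pair (E m) m) (pair-E (δ m) m)))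
    (∑-positive _ (λ g → δ-nonneg (baseOf m ⊞ actE g (double (restOf m)))) τ∈ (trans (cong (λ e → δ m (baseOf m ⊞ e)) fixed) (trans (cong (δ m) (⊞-baseOf m)) (δ-refl m))))
    where
    δ-nonneg : ∀ e → 0ℚ ℚ.≤ δ m e
    δ-nonneg e with ≡-dec ℕ._≟_ e m
    ... | yes _ = ℚₚ.nonNegative⁻¹ 1ℚ
    ... | no _ = ℚₚ.≤-refl
    fixed : actE τ (double (restOf m)) ≡ double (restOf m)
    fixed = lookup-ext λ i → trans (lookup∘tabulate _ i) (cong (lookup (double (restOf m))) (trans (ˡ-eq τ≐ι i) (ι-ˡ i)))
      where
      opaque
        unfolding ι
        ι-ˡ : ∀ i → proj₁ (ι {n}) ⟨$⟩ˡ i ≡ i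
        ι-ˡ i = refl

  scaleE : Monomial n → ℚ
  scaleE m = proj₁ (inverseOf (leading-positive m))

  scaleE-coeff : ∀ m → scaleE m ℚ.* coeff (E m) m ≡ 1ℚ
  scaleE-coeff m = proj₂ (inverseOf (leading-positive m))

  Below : Monomial n → Monomial n → Set
  Below m m′ = (m′ ≡ m ⊎ energyOf m′ < energyOf m) × shape m′ ⊴ shape m

  E-below : ∀ m → InSpan (Below m) (E m)
  E-below m = resp S (by λ ψ → trans (pair-sumP ψ (λ g → mono (term g)) G)
      (trans (∑-cong G λ g → pair-mono ψ (term g)) (sym (pair-E ψ m))))
    (sumP-closed S {F = λ g → mono (term g)} G λ g → InSpan-mono (below g))
    where
    term : SignedPerm n → Monomial n
    term g = baseOf m ⊞ actE g (double (restOf m))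
    S : IsSubspace (InSpan (Below m))
    S = InSpan-isSubspace λ m′ h → decidable-stable (≡-dec ℕ._≟_ m′ m ⊎-dec (energyOf m′ ℕ.<? energyOf m)) (λ ne → h (ne ∘ proj₁)) ,
          ⊴-stable _ _ (λ ne → h (ne ∘ proj₂))
    below : ∀ g → Below m (term g)
    below g = Sum.map₁ lookup-ext (energy-decreases (split-baseOf m) term-split (restOf-compat m) perm) ,
              dominance m (term g) (split-baseOf m) term-split (restOf-compat m) perm
      where
      c′ : Fin n → ℕ
      c′ i = lookup (restOf m) (proj₁ g ⟨$⟩ˡ i)
      term-split : Split (lookup (term g)) (lookup (baseOf m)) c′
      term-split = split λ i → trans (lookup-zipWith _+_ i (baseOf m) (actE g (double (restOf m))))
        (cong (lookup (baseOf m) i +_) (trans (lookup∘tabulate _ i) (lookup-double (restOf m) _)))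
      perm : values c′ ↭ values (lookup (restOf m))
      perm = values-permute (FP.flip (proj₁ g)) (lookup (restOf m))

  opaque
    lower : Monomial n → Poly n
    lower m = -P restrict (≢? m) (scaleE m ·P E m)

    mono-lower : ∀ m → mono m ≋ ((scaleE m ·P E m) +P lower m)
    mono-lower m = by λ ψ → trans (pair-mono ψ m) (sym (trans (pair-sub ψ q (restrict (≢? m) q))
      (trans (cong (ℚ._- pair ψ (restrict (≢? m) q)) (pair-split ψ m q))
      (trans (solve 2 (λ a b → (a :+ b) :- b := a) refl (coeff q m ℚ.* ψ m) (pair ψ (restrict (≢? m) q)))
      (trans (cong (ℚ._* ψ m) (trans (coeff-· (scaleE m) (E m) m) (scaleE-coeff m))) (ℚₚ.*-identityˡ (ψ m)))))))
      where
      open +-*-Solver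
      q : Poly n
      q = scaleE m ·P E m

    lower-span : ∀ m → InSpan (λ m′ → energyOf m′ < energyOf m × shape m′ ⊴ shape m) (lower m)
    lower-span m = scale-closed S (ℚ.- 1ℚ) (InSpan-weaken
        (λ { e (ne , inj₁ eq , _) → ⊥-elim (ne eq) ; e (ne , inj₂ lt , le) → lt , le })
        (InSpan-restrict (≢? m) (scale-closed S′ (scaleE m) (E-below m))))
      where
      S : IsSubspace (InSpan (λ m′ → energyOf m′ < energyOf m × shape m′ ⊴ shape m))
      S = InSpan-isSubspace λ m′ h → decidable-stable (energyOf m′ ℕ.<? energyOf m) (λ ne → h (ne ∘ proj₁)) ,
          ⊴-stable _ _ (λ ne → h (ne ∘ proj₂))
      S′ : IsSubspace (InSpan (Below m))
      S′ = InSpan-isSubspace λ m′ h → decidable-stable (≡-dec ℕ._≟_ m′ m ⊎-dec (energyOf m′ ℕ.<? energyOf m)) (λ ne → h (ne ∘ proj₁)) ,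
          ⊴-stable _ _ (λ ne → h (ne ∘ proj₂))

  monomial-induction : (P : Monomial n → Set) →
    (∀ m → (∀ m′ → energyOf m′ < energyOf m × shape m′ ⊴ shape m → P m′) → P m) → ∀ m → P m
  monomial-induction P step m = <-rec (λ k → ∀ m → energyOf m ≡ k → P m)
    (λ { k ih m refl → step m λ m′ lt → ih (proj₁ lt) m′ refl }) _ m refl

  -- The fuel stands for recursion on the energy, which decreases along `lower`. The empty result at
  -- fuel zero is never met when the fuel exceeds the energy. A zero rest means that m is itself a
  -- descent monomial.
  normalForm : ℕ → Monomial n → Poly n
  normalForm zero m = []
  normalForm (suc k) m with ≡-dec ℕ._≟_ (restOf m) zeroMono
  ... | yes _ = mono m
  ... | no _ = ext (normalForm k) (lower m)

  normalForm-fuel : ∀ k k′ m → energyOf m < k → energyOf m < k′ → normalForm k m ≋ normalForm k′ m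
  normalForm-fuel (suc k) (suc k′) m (s≤s l) (s≤s l′) with ≡-dec ℕ._≟_ (restOf m) zeroMono
  ... | yes _ = ≋-refl
  ... | no _ = ext-cong-span (lower-span m) λ m′ lt →
    normalForm-fuel k k′ m′ (ℕₚ.<-≤-trans (proj₁ lt) l) (ℕₚ.<-≤-trans (proj₁ lt) l′)

  opaque
    N : Poly n → Poly n
    N = ext (λ m → normalForm (suc (energyOf m)) m)

    N-linear : IsLinear N
    N-linear = ext-linear _

    N-mono : ∀ m → N (mono m) ≋ normalForm (suc (energyOf m)) m
    N-mono m = by λ ψ → trans (pair-ext ψ (λ m → normalForm (suc (energyOf m)) m) (mono m)) (pair-mono (λ m → pair ψ (normalForm (suc (energyOf m)) m)) m)

    N-mono-irreducible : ∀ m → restOf m ≡ zeroMono → N (mono m) ≋ mono m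
    N-mono-irreducible m z = ≋-trans (N-mono m) go
      where
      go : normalForm (suc (energyOf m)) m ≋ mono m
      go with ≡-dec ℕ._≟_ (restOf m) zeroMono
      ... | yes _ = ≋-refl
      ... | no ne = ⊥-elim (ne z)

    N-mono-reducible : ∀ m → ¬ restOf m ≡ zeroMono → N (mono m) ≋ N (lower m)
    N-mono-reducible m ne = ≋-trans (N-mono m) go
      where
      go : normalForm (suc (energyOf m)) m ≋ N (lower m)
      go with ≡-dec ℕ._≟_ (restOf m) zeroMono
      ... | yes z = ⊥-elim (ne z)
      ... | no _ = ext-cong-span (lower-span m) λ m′ lt →
        normalForm-fuel _ _ m′ (proj₁ lt) ℕₚ.≤-refl

  Standard : Monomial n → Monomial n → Set
  Standard m d = Irreducible (lookup d) × shape d ⊴ shape m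

  Standard-isSubspace : ∀ m → IsSubspace (InSpan (Standard m))
  Standard-isSubspace m = InSpan-isSubspace λ d h → (λ i r → h (λ x → proj₁ x i r)) , ⊴-stable _ _ (λ ne → h (ne ∘ proj₂))

  N-standard : ∀ m → InSpan (Standard m) (N (mono m))
  N-standard = monomial-induction _ λ m ih → step m ih (≡-dec ℕ._≟_ (restOf m) zeroMono)
    where
    step : ∀ m → (∀ m′ → energyOf m′ < energyOf m × shape m′ ⊴ shape m → InSpan (Standard m′) (N (mono m′))) →
           Dec (restOf m ≡ zeroMono) → InSpan (Standard m) (N (mono m))
    step m ih (yes z) = resp (Standard-isSubspace m) (≋-sym (N-mono-irreducible m z))
      (InSpan-mono (subst (Irreducible ∘ lookup) (base-of-rest-zero m z) (baseOf-irreducible m) , ⊴-refl))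
    step m ih (no ne) = resp (Standard-isSubspace m) (≋-sym (N-mono-reducible m ne))
      (L-closed N-linear (Standard-isSubspace m) (lower-span m) λ m′ lt →
        InSpan-weaken (λ d st → proj₁ st , ⊴-trans (proj₂ st) (proj₂ lt)) (ih m′ lt))

  scaleE-Ideal : ∀ m → ¬ restOf m ≡ zeroMono → Ideal (scaleE m ·P E m)
  scaleE-Ideal m ne = scale-closed Ideal-isSubspace (scaleE m)
    (subst Ideal (sym (E-def m)) (Ideal-generator (mono (baseOf m)) (orbitSum-generator ne)))

  remainder-linear : IsLinear (λ p → p -P N p)
  remainder-linear = +-linear id-linear (scale-linear (ℚ.- 1ℚ) N-linear)

  sub-self : ∀ (p : Poly n) → (p -P p) ≋ []
  sub-self p = by λ ψ → trans (pair-sub ψ p p) (ℚₚ.+-inverseʳ (pair ψ p))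

  sub-assoc : ∀ (p q r : Poly n) → ((p +P q) -P r) ≋ (p +P (q -P r))
  sub-assoc p q r = by λ ψ → trans (pair-sub ψ (p +P q) r) (trans (cong (ℚ._- pair ψ r) (pair-++ ψ p q))
    (trans (ℚₚ.+-assoc (pair ψ p) (pair ψ q) _) (sym (trans (pair-++ ψ p (q -P r)) (cong (pair ψ p ℚ.+_) (pair-sub ψ q r))))))

  -- Each reduction step changes the polynomial by a multiple of some `E m` with nonzero rest, which
  -- has a generator as a factor.
  N-remainder : ∀ p → Ideal (p -P N p)
  N-remainder p = L-closed remainder-linear {Q = λ _ → ⊤} {p = p} Ideal-isSubspace (span λ _ _ → tt) λ e _ → go e
    where
    go : ∀ m → Ideal (mono m -P N (mono m))
    go = monomial-induction _ λ m ih → step m ih (≡-dec ℕ._≟_ (restOf m) zeroMono)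
      where
      step : ∀ m → (∀ m′ → energyOf m′ < energyOf m × shape m′ ⊴ shape m → Ideal (mono m′ -P N (mono m′))) →
             Dec (restOf m ≡ zeroMono) → Ideal (mono m -P N (mono m))
      step m ih (yes z) = resp Ideal-isSubspace (≋-sym (≋-trans (sub-cong {p = mono m} ≋-refl (N-mono-irreducible m z)) (sub-self (mono m))))
        (zero-closed Ideal-isSubspace)
      step m ih (no ne) = resp Ideal-isSubspace
        (≋-sym (≋-trans (sub-cong (mono-lower m) (N-mono-reducible m ne)) (sub-assoc (scaleE m ·P E m) (lower m) (N (lower m)))))
        (add-closed Ideal-isSubspace (scaleE-Ideal m ne) (L-closed remainder-linear Ideal-isSubspace (lower-span m) ih))

-- The normal form vanishes on the ideal.

halve : ∀ {n} → Monomial n → Monomial n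
halve = Vec.map ⌊_/2⌋

module _ {n : ℕ} where

  -- Reduction replaces `mono m` by `lower m` under N, while by linearity the two values differ by
  -- `scaleE m` times N of `E m`. The scalar is invertible.
  E-kill : ∀ (m : Monomial n) → ¬ restOf m ≡ zeroMono → N (E m) ≋ []
  E-kill m ne = by λ ψ → cancel (pair ψ (N (E m))) (+-cancelʳ (pair ψ (N (lower m))) (begin
      scaleE m ℚ.* pair ψ (N (E m)) ℚ.+ pair ψ (N (lower m))   ≡⟨ cong (ℚ._+ pair ψ (N (lower m))) (sym (pair-· ψ (scaleE m) (N (E m)))) ⟩
      pair ψ (scaleE m ·P N (E m)) ℚ.+ pair ψ (N (lower m))    ≡⟨ sym (pair-++ ψ (scaleE m ·P N (E m)) (N (lower m))) ⟩
      pair ψ ((scaleE m ·P N (E m)) +P N (lower m))            ≡⟨ at expand ψ ⟩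
      pair ψ (N (lower m))                                     ≡⟨ sym (ℚₚ.+-identityˡ (pair ψ (N (lower m)))) ⟩
      0ℚ ℚ.+ pair ψ (N (lower m))                              ∎))
    where
    open +-*-Solver
    open ≡-Reasoning
    +-cancelʳ : ∀ {a b} c → a ℚ.+ c ≡ b ℚ.+ c → a ≡ b
    +-cancelʳ {a} {b} c e = trans (solve 2 (λ a c → a := (a :+ c) :- c) refl a c)
      (trans (cong (ℚ._- c) e) (solve 2 (λ b c → (b :+ c) :- c := b) refl b c))
    cancel : ∀ x → scaleE m ℚ.* x ≡ 0ℚ → x ≡ 0ℚ
    cancel x e = begin
      x                                       ≡⟨ sym (ℚₚ.*-identityˡ x) ⟩
      1ℚ ℚ.* x                                ≡⟨ cong (ℚ._* x) (sym (scaleE-coeff m)) ⟩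
      (scaleE m ℚ.* coeff (E m) m) ℚ.* x      ≡⟨ solve 3 (λ a b c → (a :* b) :* c := b :* (a :* c)) refl (scaleE m) (coeff (E m) m) x ⟩
      coeff (E m) m ℚ.* (scaleE m ℚ.* x)      ≡⟨ cong (coeff (E m) m ℚ.*_) e ⟩
      coeff (E m) m ℚ.* 0ℚ                    ≡⟨ ℚₚ.*-zeroʳ (coeff (E m) m) ⟩
      0ℚ                                      ∎
    expand : ((scaleE m ·P N (E m)) +P N (lower m)) ≋ N (lower m)
    expand = ≋-trans (++-cong (≋-sym (L-· N-linear (scaleE m) (E m))) ≋-refl)
      (≋-trans (≋-sym (L-+ N-linear (scaleE m ·P E m) (lower m)))
      (≋-trans (≋-sym (L-cong N-linear (mono-lower m))) (N-mono-reducible m ne)))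

  -- b * orbitSum (2c) is an E m, once c is rearranged to be compatible with b.
  base-orbit-kill : ∀ (b c : Monomial n) → Irreducible (lookup b) → ¬ c ≡ zeroMono →
                    N (mono b *P orbitSum (double c)) ≋ []
  base-orbit-kill b c irr ne with compatible-rearrangement (key (lookup b)) (lookup c)
  ... | π , h = ≋-trans (L-cong N-linear (L-cong (*ʳ-linear (mono b)) (≋-sym (orbitSum-permute τ c))))
    (subst (λ p → N p ≋ []) (trans (E-def m) (cong₂ (λ b c → mono b *P orbitSum (double c)) (proj₁ unique) (proj₂ unique)))
      (E-kill m λ z → ne (restore (trans (sym (proj₂ unique)) z))))
    where
    τ : SignedPerm n
    τ = π , λ _ → false
    m : Monomial n
    m = b ⊞ double (actE τ c)
    unique : baseOf m ≡ b × restOf m ≡ actE τ c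
    unique = base-rest-unique irr
      (λ i j lt → subst₂ _≤_ (sym (lookup∘tabulate _ i)) (sym (lookup∘tabulate _ j)) (h i j lt))
      (split (lookup-⊞double b (actE τ c)))
    restore : actE τ c ≡ zeroMono → c ≡ zeroMono
    restore z = lookup-ext λ i → trans (cong (lookup c) (sym (FP.inverseˡ π)))
      (trans (sym (lookup∘tabulate _ (π ⟨$⟩ʳ i))) (trans (cong (λ v → lookup v (π ⟨$⟩ʳ i)) z)
        (trans (lookup-replicate (π ⟨$⟩ʳ i) 0) (sym (lookup-replicate i 0)))))

  EvenNonzero : Monomial n → Set
  EvenNonzero e = double (halve e) ≡ e × ¬ e ≡ zeroMono

  signFlip : Fin n → SignedPerm n
  signFlip i = FP.id , λ j → does (j Finₚ.≟ i)

  coeff-signFlip : ∀ i g e → coeff (act (signFlip i) g) e ≡ negPow (lookup e i) (coeff g e)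
  coeff-signFlip i g e = trans (coeff-pair (act (signFlip i) g) e) (trans (pair-act (δ e) (signFlip i) g)
    (trans (pair-cong pointwise g) (trans (pair-negPow (lookup e i) (δ e) g) (cong (negPow (lookup e i)) (sym (coeff-pair g e))))))
    where
    pointwise : ∀ x → negPow (signExp (signFlip i) x) (δ e (actE (signFlip i) x)) ≡ negPow (lookup e i) (δ e x)
    pointwise x = trans (cong₂ (λ s y → negPow s (δ e y)) (sumF-single (lookup x) i) (tabulate∘lookup x)) (go (≡-dec ℕ._≟_ x e))
      where
      go : Dec (x ≡ e) → negPow (lookup x i) (δ e x) ≡ negPow (lookup e i) (δ e x)
      go (yes refl) = refl
      go (no ne) = trans (cong (negPow (lookup x i)) (δ-≢ e x ne)) (trans (negPow-0 (lookup x i))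
        (sym (trans (cong (negPow (lookup e i)) (δ-≢ e x ne)) (negPow-0 (lookup e i)))))

  -- Changing the sign of a single variable negates the coefficient of any monomial in which that
  -- variable has odd exponent. By invariance this coefficient equals its own negative.
  generator-evenNonzero : ∀ {g : Poly n} → Generator g → InSpan EvenNonzero g
  generator-evenNonzero {g} (sym-g , const-g) = span λ e o →
    decidable-stable (≡-dec ℕ._≟_ (double (halve e)) e) (λ odd → o (vanish e (Finₚ.¬∀⟶∃¬ n _ (λ i → 2 * ⌊ lookup e i /2⌋ ℕ.≟ lookup e i)
      λ all → odd (lookup-ext λ i → trans (lookup-double (halve e) i) (trans (cong (2 *_) (lookup-map i ⌊_/2⌋ e)) (all i)))))) ,
    λ { refl → o const-g }
    where
    vanish : ∀ e → ∃ (λ i → ¬ 2 * ⌊ lookup e i /2⌋ ≡ lookup e i) → coeff g e ≡ 0ℚ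
    vanish e (i , odd) with even-or-odd (lookup e i)
    ... | inj₁ even = ⊥-elim (odd even)
    ... | inj₂ flips = ≡-neg⇒≡0 (coeff g e) (trans (sym (flips (coeff g e)))
      (trans (sym (coeff-signFlip i g e)) (sym-g (signFlip i) e)))

  order : ℚ
  order = ∑ (G {n}) (λ _ → 1ℚ)

  order-positive : 0ℚ ℚ.< order
  order-positive with G-complete (ι {n})
  ... | τ , τ∈ , _ = ∑-positive (λ _ → 1ℚ) (λ _ → ℚₚ.nonNegative⁻¹ 1ℚ) τ∈ refl

  1/order : ℚ
  1/order = proj₁ (inverseOf order-positive)

  ∑-constant : ∀ c → ∑ (G {n}) (λ _ → c) ≡ order ℚ.* c
  ∑-constant c = trans (∑-cong (G {n}) (λ _ → sym (ℚₚ.*-identityʳ c))) (trans (∑-* c (λ _ → 1ℚ) (G {n})) (ℚₚ.*-comm c order))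

  average-constant : ∀ c → 1/order ℚ.* ∑ (G {n}) (λ _ → c) ≡ c
  average-constant c = trans (cong (1/order ℚ.*_) (∑-constant c)) (trans (sym (ℚₚ.*-assoc 1/order order c))
    (trans (cong (ℚ._* c) (proj₂ (inverseOf order-positive))) (ℚₚ.*-identityˡ c)))

  average : Poly n → Poly n
  average p = 1/order ·P sumP (map (λ g → act g p) G)

  average-linear : IsLinear average
  average-linear = scale-linear 1/order (sumP-linear G act-linear)

  average-invariant : ∀ {p} → (∀ σ → act σ p ≋ p) → average p ≋ p
  average-invariant {p} inv = by λ ψ → trans (pair-· ψ 1/order (sumP (map (λ g → act g p) G)))
    (trans (cong (1/order ℚ.*_) (trans (pair-sumP ψ (λ g → act g p) G) (∑-cong G λ g → at (inv g) ψ))) (average-constant (pair ψ p)))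

  -- Being invariant, g equals its average. Averaging turns each monomial of g into a multiple of
  -- the orbit sum of a nonzero doubled exponent, a case already settled.
  base-generator-kill : ∀ (b : Monomial n) → Irreducible (lookup b) → ∀ {g} → Generator g → N (mono b *P g) ≋ []
  base-generator-kill b irr {g} gen = ≋-trans (L-cong M-linear (≋-sym (average-invariant λ σ → ≈⇒≋ (act σ g) g (proj₁ gen σ))))
    (L-closed (∘-linear M-linear average-linear) zero-isSubspace (generator-evenNonzero gen) orbit)
    where
    M-linear : IsLinear (λ p → N (mono b *P p))
    M-linear = ∘-linear N-linear (*ʳ-linear (mono b))
    orbit : ∀ e → EvenNonzero e → N (mono b *P average (mono e)) ≋ []
    orbit e (even , ne) = ≋-trans (L-· M-linear 1/order (orbitSum e)) (scale-closed zero-isSubspace 1/order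
      (subst (λ e → N (mono b *P orbitSum e) ≋ []) even (base-orbit-kill b (halve e) irr λ z → ne (begin
        e                  ≡⟨ sym even ⟩
        double (halve e)   ≡⟨ cong double z ⟩
        double zeroMono    ≡⟨ lookup-ext (λ i → trans (lookup-double zeroMono i) (trans (cong (2 *_) (lookup-replicate i 0)) (sym (lookup-replicate i 0)))) ⟩
        zeroMono           ∎))))
      where open ≡-Reasoning

  -- Induction on the energy, writing `mono m` as a multiple of `E m` plus `lower m`. In `E m` times
  -- g the orbit sum is moved over to g, where it yields another generator, so only an irreducible
  -- monomial remains in front.
  generator-kill : ∀ e {g : Poly n} → Generator g → N (mono e *P g) ≋ []
  generator-kill = monomial-induction _ λ m ih {g} gen →
    ≋-trans (L-cong (M-linear g) (mono-lower m)) (≋-trans (L-+ (M-linear g) (scaleE m ·P E m) (lower m))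
      (++-cong {q′ = []} (≋-trans (L-· (M-linear g) (scaleE m) (E m)) (scale-closed zero-isSubspace (scaleE m) (E-case m gen)))
        (L-closed (M-linear g) zero-isSubspace (lower-span m) λ m′ lt → ih m′ lt gen)))
    where
    M-linear : ∀ g → IsLinear (λ p → N (p *P g))
    M-linear g = ∘-linear N-linear (*ˡ-linear g)
    E-case : ∀ m {g} → Generator g → N (E m *P g) ≋ []
    E-case m {g} gen = subst (λ p → N (p *P g) ≋ []) (sym (E-def m))
      (≋-trans (L-cong N-linear (*-assoc (mono (baseOf m)) (orbitSum (double (restOf m))) g))
        (base-generator-kill (baseOf m) (baseOf-irreducible m)
          (generator-* (orbitSum (double (restOf m))) (orbitSum-invariant (double (restOf m))) gen)))

  N-kills-Ideal : ∀ {p : Poly n} → Ideal p → N p ≋ []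
  N-kills-Ideal = Ideal-rec (ker-isSubspace N-linear) λ p {g} gen →
    L-closed (∘-linear N-linear (*ˡ-linear g)) {Q = λ _ → ⊤} {p = p} zero-isSubspace (span λ _ _ → tt) λ e _ → generator-kill e gen

-- The isomorphism

isPartition? : ∀ xs → Dec (IsPartition xs)
isPartition? [] = yes tt
isPartition? (a ∷ []) = yes tt
isPartition? (a ∷ b ∷ xs) = (b ℕ.≤? a) ×-dec isPartition? (b ∷ xs)

valid? : ∀ n k S₁ S₂ → Dec (Valid n k S₁ S₂)
valid? n k S₁ S₂ = isPartition? (toList (lamS n S₁ S₂)) ×-dec (2 * sumElems S₁ + ∣ S₂ ∣ ℕ.≟ k)

descending⇒IsPartition : ∀ xs → Descending xs → IsPartition xs
descending⇒IsPartition [] _ = tt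
descending⇒IsPartition (a ∷ []) _ = tt
descending⇒IsPartition (a ∷ b ∷ xs) ((b≤a ∷ _) ∷ d) = b≤a , descending⇒IsPartition (b ∷ xs) d

module _ {n : ℕ} where

  recover : ∀ {C : Poly n → Set} → IsSubspace C → ∀ {p q} → C (p -P q) → C q → C p
  recover S {p} {q} c d = resp S (by λ ψ → trans (pair-++ ψ (p -P q) q) (trans (cong (ℚ._+ pair ψ q) (pair-sub ψ p q))
    (solve 2 (λ a b → (a :- b) :+ b := a) refl (pair ψ p) (pair ψ q)))) (add-closed S c d)
    where open +-*-Solver

  sub-[] : ∀ {p q : Poly n} → q ≋ [] → (p -P q) ≋ p
  sub-[] {p} {q} e = by λ ψ → trans (pair-sub ψ p q) (trans (cong (λ x → pair ψ p ℚ.- x) (at e ψ)) (ℚₚ.+-identityʳ (pair ψ p)))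

  sub≋[]⇒≋ : ∀ {p q : Poly n} → (p -P q) ≋ [] → p ≋ q
  sub≋[]⇒≋ {p} {q} e = by λ ψ → p-q≡0⇒p≡q _ _ (trans (sym (pair-sub ψ p q)) (at e ψ))

  ≋⇒sub≋[] : ∀ {p q : Poly n} → p ≋ q → (p -P q) ≋ []
  ≋⇒sub≋[] {p} {q} e = ≋-trans (sub-cong e (≋-refl {p = q})) (sub-self q)

  InSpan-empty : ∀ {Q : Monomial n → Set} {p} → InSpan Q p → (∀ m → Occurs m p → Q m → ⊥) → p ≋ []
  InSpan-empty {p = p} s h = ≈⇒≋ p [] λ m → decidable-stable (coeff p m ℚₚ.≟ 0ℚ) λ o → h m o (occurs⇒ s m o)

  InSpan-complement : ∀ {Q P : Monomial n → Set} (P? : Decidable P) {p} → InSpan Q p →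
                      InSpan (λ m → ¬ P m × Q m) (p -P restrict P? p)
  InSpan-complement P? {p} s = span λ m o → decidable-stable (¬? (P? m)) (λ ¬¬p → o (kept m (decidable-stable (P? m) ¬¬p))) ,
    occurs⇒ s m λ z → o (trans (expand m) (cong₂ ℚ._-_ z (restricted m z)))
    where
    expand : ∀ m → coeff (p -P restrict P? p) m ≡ coeff p m ℚ.- coeff (restrict P? p) m
    expand m = trans (coeff-pair (p -P restrict P? p) m) (trans (pair-sub (δ m) p (restrict P? p))
      (sym (cong₂ ℚ._-_ (coeff-pair p m) (coeff-pair (restrict P? p) m))))
    kept : ∀ m → _ → coeff (p -P restrict P? p) m ≡ 0ℚ
    kept m pm = trans (expand m) (trans (cong (λ x → coeff p m ℚ.- x) (coeff-restrict-yes P? pm p)) (ℚₚ.+-inverseʳ (coeff p m)))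
    restricted : ∀ m → coeff p m ≡ 0ℚ → coeff (restrict P? p) m ≡ 0ℚ
    restricted m z with P? m
    ... | yes pm = trans (coeff-restrict-yes P? pm p) z
    ... | no ¬pm = coeff-restrict-no P? ¬pm p

  act-span : ∀ {Q : Monomial n → Set} → IsSubspace (InSpan Q) → (∀ σ e → Q e → Q (actE σ e)) →
             ∀ σ {p} → InSpan Q p → InSpan Q (act σ p)
  act-span S inv σ s = L-closed (act-linear σ) S s λ e q →
    resp S (by λ ψ → trans (pair-· ψ (negPow (signExp σ e) 1ℚ) (mono (actE σ e)))
      (trans (cong (negPow (signExp σ e) 1ℚ ℚ.*_) (pair-mono ψ (actE σ e))) (trans (sym (negPow-scale (signExp σ e) (ψ (actE σ e)))) (sym (pair-act-mono ψ σ e)))))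
      (scale-closed S (negPow (signExp σ e) 1ℚ) (InSpan-mono (inv σ e q)))

  module _ (lam : Vec ℕ n) where

    Dom SDom : Poly n → Set
    Dom  = InSpan (λ m → shape m ⊴ toList lam)
    SDom = InSpan (λ m → shape m ◁ toList lam)

    Dom-isSubspace : IsSubspace Dom
    Dom-isSubspace = InSpan-isSubspace (λ m → ⊴-stable (shape m) (toList lam))

    SDom-isSubspace : IsSubspace SDom
    SDom-isSubspace = InSpan-isSubspace (λ m → ◁-stable (shape m) (toList lam))

    ModSDom-isSubspace : IsSubspace (Mod SDom)
    ModSDom-isSubspace = Mod-isSubspace SDom-isSubspace

    ModDom-isSubspace : IsSubspace (Mod Dom)
    ModDom-isSubspace = Mod-isSubspace Dom-isSubspace

    act-ModDom : ∀ σ {p} → Mod Dom p → Mod Dom (act σ p)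
    act-ModDom σ = Mod-rec (preimage-isSubspace (act-linear σ) ModDom-isSubspace)
      (λ i → Mod-ideal Dom-isSubspace (Ideal-act σ i))
      (λ s → Mod-rest (act-span Dom-isSubspace (λ τ e → subst (_⊴ toList lam) (sym (shape-act τ e))) σ s))

    act-ModSDom : ∀ σ {p} → Mod SDom p → Mod SDom (act σ p)
    act-ModSDom σ = Mod-rec (preimage-isSubspace (act-linear σ) ModSDom-isSubspace)
      (λ i → Mod-ideal SDom-isSubspace (Ideal-act σ i))
      (λ s → Mod-rest (act-span SDom-isSubspace (λ τ e → subst (_◁ toList lam) (sym (shape-act τ e))) σ s))

    hasShape? : Decidable (λ (m : Monomial n) → shape m ≡ toList lam)
    hasShape? m = ≡-decList ℕ._≟_ (shape m) (toList lam)

    N-Dom : ∀ {p} → Dom p → Dom (N p)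
    N-Dom s = L-closed N-linear Dom-isSubspace s λ e le → InSpan-weaken (λ d st → ⊴-trans (proj₂ st) le) (N-standard e)

    N-SDom : ∀ {p} → SDom p → SDom (N p)
    N-SDom s = L-closed N-linear SDom-isSubspace s λ e lt → InSpan-weaken
      (λ d st → ⊴-◁-trans (trans (shape-length d) (sym (shape-length e))) (proj₂ st) lt) (N-standard e)

    -- For p dominated by lam modulo the ideal, N p has shapes dominated by lam, and the discarded
    -- terms are strictly below. So the class of p in R^B_lam is kept.
    top : Poly n → Poly n
    top p = restrict hasShape? (N p)

    top-linear : IsLinear top
    top-linear = ∘-linear (restrict-linear hasShape?) N-linear

    top-Ideal : ∀ {p} → Ideal p → top p ≋ []
    top-Ideal i = L-cong (restrict-linear hasShape?) (N-kills-Ideal i)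

    -- N kills the ideal and does not raise shapes, so no term of shape exactly lam can appear.
    top-ModSDom : ∀ {p} → Mod SDom p → top p ≋ []
    top-ModSDom = Mod-rec (ker-isSubspace top-linear) top-Ideal
      (λ s → InSpan-empty (InSpan-restrict hasShape? (N-SDom s)) λ m _ x → proj₂ (proj₂ x) (proj₁ x))

    top-congruent : ∀ {p} → Mod Dom p → Mod SDom (p -P top p)
    top-congruent = Mod-rec (preimage-isSubspace (+-linear id-linear (scale-linear (ℚ.- 1ℚ) top-linear)) ModSDom-isSubspace)
      (λ {p} i → resp ModSDom-isSubspace (≋-sym (sub-[] (top-Ideal i))) (Mod-ideal SDom-isSubspace i))
      (λ {p} s → resp ModSDom-isSubspace (telescope p) (add-closed ModSDom-isSubspace
        (Mod-ideal SDom-isSubspace (N-remainder p))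
        (Mod-rest (InSpan-weaken (λ m x → proj₂ x , proj₁ x) (InSpan-complement hasShape? (N-Dom s))))))
      where
      open +-*-Solver
      telescope : ∀ p → ((p -P N p) +P (N p -P top p)) ≋ (p -P top p)
      telescope p = by λ ψ → trans (pair-++ ψ (p -P N p) (N p -P top p)) (trans (cong₂ ℚ._+_ (pair-sub ψ p (N p)) (pair-sub ψ (N p) (top p)))
        (trans (solve 3 (λ a b c → (a :- b) :+ (b :- c) := a :- c) refl (pair ψ p) (pair ψ (N p)) (pair ψ (top p)))
          (sym (pair-sub ψ p (top p)))))

    conjugate : SignedPerm n → Poly n → Poly n
    conjugate g p = act g (top (act (inv g) p))

    -- Averaging top over the group, as in Maschke's theorem, gives an equivariant section of R^B_lam.
    lift : Poly n → Poly n
    lift p = 1/order {n} ·P sumP (map (λ g → conjugate g p) G)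

    conjugate-linear : ∀ g → IsLinear (conjugate g)
    conjugate-linear g = ∘-linear (act-linear g) (∘-linear top-linear (act-linear (inv g)))

    lift-linear : IsLinear lift
    lift-linear = scale-linear (1/order {n}) (sumP-linear G conjugate-linear)

    pair-lift : ∀ ψ p → pair ψ (lift p) ≡ 1/order {n} ℚ.* ∑ G (λ g → pair ψ (conjugate g p))
    pair-lift ψ p = trans (pair-· ψ (1/order {n}) (sumP (map (λ g → conjugate g p) G)))
      (cong (1/order {n} ℚ.*_) (pair-sumP ψ (λ g → conjugate g p) G))

    lift-ModSDom : ∀ {p} → Mod SDom p → lift p ≋ []
    lift-ModSDom {p} m = scale-closed zero-isSubspace (1/order {n}) (sumP-closed zero-isSubspace G λ g →
      ≋-trans (L-cong (act-linear g) (top-ModSDom (act-ModSDom (inv g) m))) (L-[] (act-linear g)))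

    -- The difference is the mean of the differences p - `conjugate g p`. Each of these lies in the
    -- submodule, which the action preserves.
    lift-congruent : ∀ {p} → Mod Dom p → Mod SDom (p -P lift p)
    lift-congruent {p} m = resp ModSDom-isSubspace (by eq) (scale-closed ModSDom-isSubspace (1/order {n}) (sumP-closed ModSDom-isSubspace G each))
      where
      each : ∀ g → Mod SDom (p -P conjugate g p)
      each g = resp ModSDom-isSubspace
        (≋-trans (L-sub (act-linear g) (act (inv g) p) (top (act (inv g) p)))
          (sub-cong (act-inverse g (inv g) (⊛-inverseʳ g) p) (≋-refl {p = conjugate g p})))
        (act-ModSDom g (top-congruent (act-ModDom (inv g) m)))
      eq : ∀ ψ → pair ψ (1/order {n} ·P sumP (map (λ g → p -P conjugate g p) G)) ≡ pair ψ (p -P lift p)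
      eq ψ = begin
        pair ψ (1/order {n} ·P sumP (map (λ g → p -P conjugate g p) G))
          ≡⟨ trans (pair-· ψ (1/order {n}) (sumP (map (λ g → p -P conjugate g p) G))) (cong (1/order {n} ℚ.*_) (pair-sumP ψ (λ g → p -P conjugate g p) G)) ⟩
        1/order {n} ℚ.* ∑ G (λ g → pair ψ (p -P conjugate g p))
          ≡⟨ cong (1/order {n} ℚ.*_) (trans (∑-cong G (λ g → trans (pair-++ ψ p (-P conjugate g p)) (cong (pair ψ p ℚ.+_) (pair-· ψ (ℚ.- 1ℚ) (conjugate g p)))))
              (trans (∑-+ (λ _ → pair ψ p) (λ g → ℚ.- 1ℚ ℚ.* pair ψ (conjugate g p)) G)
                (cong (∑ (G {n}) (λ _ → pair ψ p) ℚ.+_) (∑-* (ℚ.- 1ℚ) (λ g → pair ψ (conjugate g p)) G)))) ⟩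
        1/order {n} ℚ.* (∑ G (λ _ → pair ψ p) ℚ.+ ℚ.- 1ℚ ℚ.* ∑ G (λ g → pair ψ (conjugate g p)))
          ≡⟨ solve 3 (λ o a b → o :* (a :+ (:- con 1ℚ) :* b) := o :* a :- o :* b) refl (1/order {n}) (∑ G (λ _ → pair ψ p)) (∑ G (λ g → pair ψ (conjugate g p))) ⟩
        1/order {n} ℚ.* ∑ G (λ _ → pair ψ p) ℚ.- 1/order {n} ℚ.* ∑ G (λ g → pair ψ (conjugate g p))
          ≡⟨ cong₂ ℚ._-_ (average-constant {n} (pair ψ p)) (sym (pair-lift ψ p)) ⟩
        pair ψ p ℚ.- pair ψ (lift p)
          ≡⟨ sym (pair-sub ψ p (lift p)) ⟩
        pair ψ (p -P lift p) ∎
        where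
        open ≡-Reasoning
        open +-*-Solver

    -- Reindexing the mean by g ↦ σ g: the inverse of σ g followed by σ cancels to the inverse of g,
    -- and the outer σ factors out.
    lift-equivariant : ∀ σ p → lift (act σ p) ≋ act σ (lift p)
    lift-equivariant σ p = by λ ψ → begin
      pair ψ (lift (act σ p)) ≡⟨ pair-lift ψ (act σ p) ⟩
      1/order {n} ℚ.* ∑ G (λ g → pair ψ (conjugate g (act σ p)))
        ≡⟨ cong (1/order {n} ℚ.*_) (sym (∑-G-⊛ˡ {F = λ g → pair ψ (conjugate g (act σ p))} (λ h → at (conjugate-≐ h (act σ p)) ψ) σ)) ⟩
      1/order {n} ℚ.* ∑ G (λ g → pair ψ (conjugate (σ ⊛ g) (act σ p)))
        ≡⟨ cong (1/order {n} ℚ.*_) (∑-cong G λ g → at (shift g) ψ) ⟩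
      1/order {n} ℚ.* ∑ G (λ g → pair ψ (act σ (conjugate g p)))
        ≡⟨ cong (1/order {n} ℚ.*_) (sym (pair-sumP ψ (λ g → act σ (conjugate g p)) G)) ⟩
      1/order {n} ℚ.* pair ψ (sumP (map (λ g → act σ (conjugate g p)) G))
        ≡⟨ cong (1/order {n} ℚ.*_) (sym (at (L-sumP (act-linear σ) (λ g → conjugate g p) G) ψ)) ⟩
      1/order {n} ℚ.* pair ψ (act σ (sumP (map (λ g → conjugate g p) G)))
        ≡⟨ sym (pair-· ψ (1/order {n}) (act σ (sumP (map (λ g → conjugate g p) G)))) ⟩
      pair ψ (1/order {n} ·P act σ (sumP (map (λ g → conjugate g p) G)))
        ≡⟨ sym (at (L-· (act-linear σ) (1/order {n}) (sumP (map (λ g → conjugate g p) G))) ψ) ⟩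
      pair ψ (act σ (lift p)) ∎
      where
      open ≡-Reasoning
      conjugate-≐ : ∀ {g h} → g ≐ h → ∀ p → conjugate g p ≋ conjugate h p
      conjugate-≐ {g} {h} e p = ≋-trans (act-≐ e _) (L-cong (act-linear h) (L-cong top-linear (act-≐ (inv-cong e) p)))
      inv-⊛ : ∀ σ g → (inv (σ ⊛ g) ⊛ σ) ≐ inv g
      inv-⊛ σ g = ≐-trans (≐-sym (⊛-cancelʳ (inv (σ ⊛ g) ⊛ σ) g (inv g) (⊛-inverseʳ g)))
        (≐-trans (⊛-cong (≐-trans (⊛-assoc (inv (σ ⊛ g)) σ g) (⊛-inverseˡ (σ ⊛ g))) ≐-refl) (⊛-identityˡ (inv g)))
      shift : ∀ g → conjugate (σ ⊛ g) (act σ p) ≋ act σ (conjugate g p)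
      shift g = ≋-trans (act-⊛ σ g (top (act (inv (σ ⊛ g)) (act σ p)))) (L-cong (act-linear σ) (L-cong (act-linear g) (L-cong top-linear
        (≋-trans (≋-sym (act-⊛ (inv (σ ⊛ g)) σ p)) (act-≐ (inv-⊛ σ g) p)))))

    lift-shape : ∀ p → InSpan (λ m → shape m ≡ toList lam) (lift p)
    lift-shape p = scale-closed S (1/order {n}) (sumP-closed S G λ g →
      act-span S (λ σ e q → trans (shape-act σ e) q) g
        (InSpan-weaken (λ m x → proj₁ x) (InSpan-restrict {Q = λ _ → ⊤} hasShape? {p = N (act (inv g) p)} (span λ _ _ → tt))))
      where
      S : IsSubspace (InSpan (λ m → shape m ≡ toList lam))
      S = InSpan-isSubspace (λ m → decidable-stable (hasShape? m))

    lift-Dom : ∀ p → Dom (lift p)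
    lift-Dom p = InSpan-weaken (λ m e → subst (shape m ⊴_) e ⊴-refl) (lift-shape p)

    -- The diagonal entry of the triangular system: modulo strictly lower shapes p agrees with its
    -- lift, and the lift agrees with its top part.
    lift-reflects : ∀ {p} → Mod Dom p → top (lift p) ≋ [] → Mod SDom p
    lift-reflects {p} m z = recover ModSDom-isSubspace (lift-congruent m)
      (resp ModSDom-isSubspace (sub-[] z) (top-congruent (Mod-rest (lift-Dom p))))

-- The sum of the splittings and its bijectivity.

module _ {n : ℕ} {C D : Poly n → Set} where

  toMod : (∀ {p} → C p → D p) → ∀ {p} → InIdealPlus C p → Mod D p
  toMod h {p} (a , b , (gs , e) , c , eq) = ideal gs (≈⇒≋ a (idealSum gs) e) ⊹ h c by ≈⇒≋ p (a +P b) eq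

  fromMod : (∀ {p} → D p → C p) → ∀ {p} → Mod D p → InIdealPlus C p
  fromMod h {p} (_⊹_by_ {a} {b} (ideal gs e) d eq) = a , b , (gs , ≋⇒≈ {p = a} e) , h d , ≋⇒≈ {p = p} eq

toIdeal : ∀ {n} {p : Poly n} → InIdeal p → Ideal p
toIdeal {p = p} (gs , e) = ideal gs (≈⇒≋ p (idealSum gs) e)

fromIdeal : ∀ {n} {p : Poly n} → Ideal p → InIdeal p
fromIdeal {p = p} (ideal gs e) = gs , ≋⇒≈ {p = p} e

≋⇒InIdeal : ∀ {n} {p q : Poly n} → p ≋ q → InIdeal (p -P q)
≋⇒InIdeal e = fromIdeal (resp Ideal-isSubspace (≋-sym (≋⇒sub≋[] e)) (zero-closed Ideal-isSubspace))

module _ (n k : ℕ) where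

  Family : Set
  Family = Subset (n ∸ 1) → Subset n → Poly n

  lamOf : Subset (n ∸ 1) × Subset n → Vec ℕ n
  lamOf (S₁ , S₂) = lamS n S₁ S₂

  indices : List (Subset (n ∸ 1) × Subset n)
  indices = cartesianProduct (allVec bools (n ∸ 1)) (allVec bools n)

  indices-unique : Unique indices
  indices-unique = Uniqueₚ.cartesianProduct⁺ (allVec-unique bools-unique (n ∸ 1)) (allVec-unique bools-unique n)

  ∈-indices : ∀ S → S ∈ indices
  ∈-indices (S₁ , S₂) = ∈-cartesianProduct⁺ (∈-allVec ∈-bools S₁) (∈-allVec ∈-bools S₂)

  -- The direct sum leaves the components at invalid indices unconstrained, so they must contribute
  -- nothing.
  summand : Subset (n ∸ 1) × Subset n → Poly n → Poly n
  summand (S₁ , S₂) p with valid? n k S₁ S₂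
  ... | yes _ = lift (lamS n S₁ S₂) p
  ... | no _ = []

  summand-valid : ∀ {S₁ S₂} → Valid n k S₁ S₂ → ∀ p → summand (S₁ , S₂) p ≡ lift (lamS n S₁ S₂) p
  summand-valid {S₁} {S₂} v p with valid? n k S₁ S₂
  ... | yes _ = refl
  ... | no nv = ⊥-elim (nv v)

  summand-elim : (P : (Poly n → Poly n) → Set) → ∀ S₁ S₂ → (Valid n k S₁ S₂ → P (lift (lamS n S₁ S₂))) →
                 P (λ _ → []) → P (summand (S₁ , S₂))
  summand-elim P S₁ S₂ h z with valid? n k S₁ S₂
  ... | yes v = h v
  ... | no _ = z

  []-linear : IsLinear {n} (λ _ → [])
  []-linear = via-pair {L = λ _ → []} (λ _ _ → 0ℚ) (λ ψ p → sym (pair-0fun p))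

  summand-linear : ∀ S → IsLinear (summand S)
  summand-linear (S₁ , S₂) = summand-elim IsLinear S₁ S₂ (λ _ → lift-linear (lamS n S₁ S₂)) []-linear

  assemble : Family → Poly n
  assemble F = sumP (map (λ S → summand S (F (proj₁ S) (proj₂ S))) indices)

  assemble-+ : ∀ F F′ → assemble (λ S₁ S₂ → F S₁ S₂ +P F′ S₁ S₂) ≋ (assemble F +P assemble F′)
  assemble-+ F F′ = by λ ψ → trans (pair-sumP ψ (λ S → summand S (F (proj₁ S) (proj₂ S) +P F′ (proj₁ S) (proj₂ S))) indices)
    (trans (∑-cong indices λ S → trans (at (L-+ (summand-linear S) (F (proj₁ S) (proj₂ S)) (F′ (proj₁ S) (proj₂ S))) ψ)
        (pair-++ ψ (summand S (F (proj₁ S) (proj₂ S))) (summand S (F′ (proj₁ S) (proj₂ S)))))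
    (trans (∑-+ (λ S → pair ψ (summand S (F (proj₁ S) (proj₂ S)))) (λ S → pair ψ (summand S (F′ (proj₁ S) (proj₂ S)))) indices)
      (sym (trans (pair-++ ψ (assemble F) (assemble F′)) (cong₂ ℚ._+_
        (pair-sumP ψ (λ S → summand S (F (proj₁ S) (proj₂ S))) indices) (pair-sumP ψ (λ S → summand S (F′ (proj₁ S) (proj₂ S))) indices))))))

  assemble-· : ∀ c F → assemble (λ S₁ S₂ → c ·P F S₁ S₂) ≋ (c ·P assemble F)
  assemble-· c F = ≋-trans (sumP-cong indices λ S → L-· (summand-linear S) c (F (proj₁ S) (proj₂ S)))
    (≋-sym (L-sumP (scale-linear c id-linear) (λ S → summand S (F (proj₁ S) (proj₂ S))) indices))

  assemble-act : ∀ σ F → assemble (λ S₁ S₂ → act σ (F S₁ S₂)) ≋ act σ (assemble F)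
  assemble-act σ F = ≋-trans (sumP-cong indices λ S → summand-elim (λ L → L (act σ (F (proj₁ S) (proj₂ S))) ≋ act σ (L (F (proj₁ S) (proj₂ S))))
      (proj₁ S) (proj₂ S) (λ _ → lift-equivariant (lamOf S) σ (F (proj₁ S) (proj₂ S))) ≋-refl)
    (≋-sym (L-sumP (act-linear σ) (λ S → summand S (F (proj₁ S) (proj₂ S))) indices))

  assemble-sub : ∀ F F′ → assemble (λ S₁ S₂ → F S₁ S₂ -P F′ S₁ S₂) ≋ (assemble F -P assemble F′)
  assemble-sub F F′ = ≋-trans (assemble-+ F (λ S₁ S₂ → -P F′ S₁ S₂)) (++-cong {p = assemble F} ≋-refl (assemble-· (ℚ.- 1ℚ) F′))

  assemble-zero : assemble (λ _ _ → []) ≋ []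
  assemble-zero = sumP-closed zero-isSubspace indices λ S → L-[] (summand-linear S)

  Elem : Family → Set
  Elem F = ∀ S₁ S₂ → Valid n k S₁ S₂ → Mod (Dom (lamS n S₁ S₂)) (F S₁ S₂)

  Null : Family → Set
  Null F = ∀ S₁ S₂ → Valid n k S₁ S₂ → Mod (SDom (lamS n S₁ S₂)) (F S₁ S₂)

  ofDegree : Monomial n → Set
  ofDegree m = sumℕ (toList m) ≡ k

  ofDegree-isSubspace : IsSubspace (InSpan ofDegree)
  ofDegree-isSubspace = InSpan-isSubspace λ m → decidable-stable (sumℕ (toList m) ℕ.≟ k)

  degree-shape : ∀ (m : Monomial n) → sumℕ (shape m) ≡ sumℕ (toList m)
  degree-shape m = sum-↭ (sortDesc-↭ (toList m))

  valid-sum : ∀ {S₁ S₂} → Valid n k S₁ S₂ → sumℕ (toList (lamS n S₁ S₂)) ≡ k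
  valid-sum {S₁} {S₂} (_ , e) = trans (lamS-sum n S₁ S₂) e

  assemble-degree : ∀ F → InSpan ofDegree (assemble F)
  assemble-degree F = sumP-closed ofDegree-isSubspace indices λ S →
    summand-elim (λ L → InSpan ofDegree (L (F (proj₁ S) (proj₂ S)))) (proj₁ S) (proj₂ S)
      (λ v → InSpan-weaken (λ m e → trans (sym (degree-shape m)) (trans (cong sumℕ e) (valid-sum v))) (lift-shape (lamOf S) (F (proj₁ S) (proj₂ S))))
      (zero-closed ofDegree-isSubspace)

  assemble-null : ∀ F → Null F → assemble F ≋ []
  assemble-null F h = sumP-closed zero-isSubspace indices λ S →
    summand-elim (λ L → L (F (proj₁ S) (proj₂ S)) ≋ []) (proj₁ S) (proj₂ S) (λ v → lift-ModSDom (lamOf S) (h _ _ v)) ≋-refl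

  length-lam : ∀ (v : Vec ℕ n) → length (toList v) ≡ n
  length-lam = length-toList

  -- Induction from the dominant shapes downward. Applying `top` at lam to the whole sum gives zero
  -- because the sum lies in the ideal. Only the summand at lam can survive, and `lift-reflects`
  -- then makes its component null.
  null-of-assemble : ∀ F → Elem F → Ideal (assemble F) → Null F
  null-of-assemble F elem i S₁ S₂ v = go _ S₁ S₂ v ℕₚ.≤-refl
    where
    bound : ℕ
    bound = suc n * k
    depth : Subset (n ∸ 1) → Subset n → ℕ
    depth S₁ S₂ = bound ∸ weight n (toList (lamS n S₁ S₂))
    go : ∀ r S₁ S₂ → Valid n k S₁ S₂ → depth S₁ S₂ < r → Mod (SDom (lamS n S₁ S₂)) (F S₁ S₂)
    go (suc r) S₁ S₂ v (s≤s le) = lift-reflects lam (elem S₁ S₂ v) (by λ ψ → begin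
      pair ψ (top lam (lift lam (F S₁ S₂)))                ≡⟨ cong (λ p → pair ψ (top lam p)) (sym (summand-valid v (F S₁ S₂))) ⟩
      pair ψ (top lam (component (S₁ , S₂)))               ≡⟨ sym (∑-single (λ S → pair ψ (top lam (component S))) indices-unique (∈-indices (S₁ , S₂)) (λ U ne → at (others U ne) ψ)) ⟩
      ∑ indices (λ S → pair ψ (top lam (component S)))     ≡⟨ sym (pair-sumP ψ (λ S → top lam (component S)) indices) ⟩
      pair ψ (sumP (map (λ S → top lam (component S)) indices)) ≡⟨ sym (at (L-sumP (top-linear lam) component indices) ψ) ⟩
      pair ψ (top lam (assemble F))                        ≡⟨ at (top-Ideal lam i) ψ ⟩
      pair ψ []                                            ∎)
      where
      open ≡-Reasoning
      lam : Vec ℕ n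
      lam = lamS n S₁ S₂
      component : Subset (n ∸ 1) × Subset n → Poly n
      component S = summand S (F (proj₁ S) (proj₂ S))
      others : ∀ U → ¬ U ≡ (S₁ , S₂) → top lam (component U) ≋ []
      others (U₁ , U₂) ne = summand-elim (λ L → top lam (L (F U₁ U₂)) ≋ []) U₁ U₂ valid-case (L-[] (top-linear lam))
        where
        mu : Vec ℕ n
        mu = lamS n U₁ U₂
        valid-case : Valid n k U₁ U₂ → top lam (lift mu (F U₁ U₂)) ≋ []
        valid-case u = InSpan-empty (InSpan-restrict (hasShape? lam) (N-Dom mu (lift-Dom mu (F U₁ U₂))))
          -- A surviving monomial would have shape lam and be dominated by mu, so mu lies strictly
          -- above lam. The component at mu is then null by induction and its lift is zero. Arguing
          -- from a monomial avoids deciding dominance.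
          λ m o (m-lam , m-mu) → o (coeff-≋ (≋-trans (L-cong (top-linear lam) (lift-ModSDom mu (go r U₁ U₂ u (deeper (above {m} m-lam m-mu))))) (L-[] (top-linear lam))) m)
          where
          above : ∀ {m : Monomial n} → shape m ≡ toList lam → shape m ⊴ toList mu → toList lam ◁ toList mu
          above e le = subst (_⊴ toList mu) e le , λ q → ne (cong₂ _,_ (sym (proj₁ (lamS-injective n S₁ U₁ S₂ U₂ q))) (sym (proj₂ (lamS-injective n S₁ U₁ S₂ U₂ q))))
          deeper : toList lam ◁ toList mu → depth U₁ U₂ < r
          deeper lt = ℕₚ.<-≤-trans (ℕₚ.∸-monoʳ-< (weight-strict n (length-lam lam) (length-lam mu) lt)
            (ℕₚ.≤-trans (weight-bound n (toList mu)) (ℕₚ.≤-reflexive (cong (suc n *_) (valid-sum u))))) le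

  -- The image modulo the ideal. It is a subspace, so surjectivity can be tested on monomials.
  Reached : Poly n → Set
  Reached y = ∃ λ F → Elem F × Ideal (assemble F -P y)

  Reached-isSubspace : IsSubspace Reached
  Reached-isSubspace = record
    { zero-closed = (λ _ _ → []) , (λ S₁ S₂ _ → zero-closed (ModDom-isSubspace (lamS n S₁ S₂))) ,
        resp Ideal-isSubspace (≋-sym (≋-trans (sub-[] ≋-refl) assemble-zero)) (zero-closed Ideal-isSubspace)
    ; add-closed = λ { {p} {q} (F , e , i) (F′ , e′ , i′) → (λ S₁ S₂ → F S₁ S₂ +P F′ S₁ S₂) ,
        (λ S₁ S₂ v → add-closed (ModDom-isSubspace (lamS n S₁ S₂)) (e S₁ S₂ v) (e′ S₁ S₂ v)) ,
        resp Ideal-isSubspace (≋-trans (exchange (assemble F) p (assemble F′) q) (sub-cong (≋-sym (assemble-+ F F′)) (≋-refl {p = p +P q})))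
          (add-closed Ideal-isSubspace i i′) }
    ; scale-closed = λ { c {p} (F , e , i) → (λ S₁ S₂ → c ·P F S₁ S₂) ,
        (λ S₁ S₂ v → scale-closed (ModDom-isSubspace (lamS n S₁ S₂)) c (e S₁ S₂ v)) ,
        resp Ideal-isSubspace (≋-trans (L-sub (scale-linear c id-linear) (assemble F) p) (sub-cong (≋-sym (assemble-· c F)) (≋-refl {p = c ·P p})))
          (scale-closed Ideal-isSubspace c i) }
    ; resp = λ { eq (F , e , i) → F , e , resp Ideal-isSubspace (sub-cong {p = assemble F} ≋-refl eq) i } }
    where
    exchange : ∀ (a b c d : Poly n) → ((a -P b) +P (c -P d)) ≋ ((a +P c) -P (b +P d))
    exchange a b c d = by λ ψ → trans (pair-++ ψ (a -P b) (c -P d)) (trans (cong₂ ℚ._+_ (pair-sub ψ a b) (pair-sub ψ c d))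
      (trans (solve 4 (λ a b c d → (a :- b) :+ (c :- d) := (a :+ c) :- (b :+ d)) refl (pair ψ a) (pair ψ b) (pair ψ c) (pair ψ d))
        (sym (trans (pair-sub ψ (a +P c) (b +P d)) (cong₂ ℚ._-_ (pair-++ ψ a c) (pair-++ ψ b d))))))
      where open +-*-Solver

  Reached-Ideal : ∀ {p} → Ideal p → Reached p
  Reached-Ideal {p} i = (λ _ _ → []) , (λ S₁ S₂ _ → zero-closed (ModDom-isSubspace (lamS n S₁ S₂))) ,
    sub-closed Ideal-isSubspace (resp Ideal-isSubspace (≋-sym assemble-zero) (zero-closed Ideal-isSubspace)) i

  -- Witnessed by the family that is p at one index and zero elsewhere.
  Reached-lift : ∀ {S₁ S₂ p} → Valid n k S₁ S₂ → Mod (Dom (lamS n S₁ S₂)) p → Reached (lift (lamS n S₁ S₂) p)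
  Reached-lift {S₁} {S₂} {p} v m = F , elem ,
    resp Ideal-isSubspace (≋-sym (≋⇒sub≋[] total)) (zero-closed Ideal-isSubspace)
    where
    isIndex? : ∀ U → Dec (U ≡ (S₁ , S₂))
    isIndex? U = Productₚ.≡-dec (≡-dec Boolₚ._≟_) (≡-dec Boolₚ._≟_) U (S₁ , S₂)
    F : Family
    F U₁ U₂ with isIndex? (U₁ , U₂)
    ... | yes _ = p
    ... | no _ = []
    F-off : ∀ U₁ U₂ → ¬ (U₁ , U₂) ≡ (S₁ , S₂) → F U₁ U₂ ≡ []
    F-off U₁ U₂ ne with isIndex? (U₁ , U₂)
    ... | yes e = ⊥-elim (ne e)
    ... | no _ = refl
    F-on : F S₁ S₂ ≡ p
    F-on with isIndex? (S₁ , S₂)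
    ... | yes _ = refl
    ... | no ne = ⊥-elim (ne refl)
    elem : Elem F
    elem U₁ U₂ u with isIndex? (U₁ , U₂)
    ... | yes refl = m
    ... | no _ = zero-closed (ModDom-isSubspace (lamS n U₁ U₂))
    total : assemble F ≋ lift (lamS n S₁ S₂) p
    total = by λ ψ → trans (pair-sumP ψ (λ S → summand S (F (proj₁ S) (proj₂ S))) indices)
      (trans (∑-single (λ S → pair ψ (summand S (F (proj₁ S) (proj₂ S)))) indices-unique (∈-indices (S₁ , S₂))
          λ { (U₁ , U₂) ne → trans (cong (λ q → pair ψ (summand (U₁ , U₂) q)) (F-off U₁ U₂ ne)) (at (L-[] (summand-linear (U₁ , U₂))) ψ) })
        (cong (pair ψ) (trans (summand-valid v (F S₁ S₂)) (cong (lift (lamS n S₁ S₂)) F-on))))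

  -- Modulo the ideal, a monomial is a combination of descent monomials d with shapes dominated by
  -- its own. The shape of d is a valid lam, and `mono d` differs from its lift by strictly lower
  -- shapes modulo the ideal. Those have smaller weight and are reached by induction.
  Reached-monomial : ∀ r e → ofDegree e → weight n (shape e) < r → Reached (mono e)
  Reached-monomial (suc r) e deg (s≤s le) = recover Reached-isSubspace {mono e} {N (mono e)} (Reached-Ideal (N-remainder (mono e)))
    (span-closed Reached-isSubspace (N-standard e) standard)
    where
    standard : ∀ d → Standard e d → Reached (mono d)
    standard d (irr , d⊴e) with irreducible-shape d irr
    ... | S₁ , S₂ , eq = recover Reached-isSubspace {mono d} {lift lam (mono d)} (Mod-rec Reached-isSubspace Reached-Ideal rest (lift-congruent lam inDom))
                           (Reached-lift {S₁} {S₂} v inDom)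
      where
      lam : Vec ℕ n
      lam = lamS n S₁ S₂
      v : Valid n k S₁ S₂
      v = subst IsPartition (sym eq) (descending⇒IsPartition _ (sortDesc-descending (toList d))) ,
          trans (sym (lamS-sum n S₁ S₂)) (trans (cong sumℕ eq) (trans (proj₁ d⊴e) (trans (degree-shape e) deg)))
      inDom : Mod (Dom lam) (mono d)
      inDom = Mod-rest (InSpan-mono (subst (shape d ⊴_) (sym eq) ⊴-refl))
      rest : ∀ {p} → SDom lam p → Reached p
      rest s = span-closed Reached-isSubspace s λ b b◁ → Reached-monomial r b
        (trans (sym (degree-shape b)) (trans (proj₁ (proj₁ b◁)) (valid-sum v)))
        (ℕₚ.<-≤-trans (weight-strict n (shape-length b) (length-lam lam) b◁)
          (ℕₚ.≤-trans (ℕₚ.≤-reflexive (cong (weight n) eq)) (ℕₚ.≤-trans (weight-mono n d⊴e) le)))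

  assemble-surjective : ∀ y → Homogeneous k y → Reached y
  assemble-surjective y h = span-closed {Q = ofDegree} {p = y} Reached-isSubspace (span h) λ e deg → Reached-monomial _ e deg ℕₚ.≤-refl

theorem5p8 : (n k : ℕ) → k ≤ n * n → DirectSum n k ≅Rep RBdeg n k
theorem5p8 n k _ = record
  { f = assemble n k
  ; f-elem = λ F _ → occurs⇒ (assemble-degree n k F)
  ; f-cong = λ F F′ _ _ e → ≋⇒InIdeal (sub≋[]⇒≋ {p = assemble n k F} {assemble n k F′} (≋-trans (≋-sym (assemble-sub n k F F′))
      (assemble-null n k (λ S₁ S₂ → F S₁ S₂ -P F′ S₁ S₂) λ S₁ S₂ v → toMod span {F S₁ S₂ -P F′ S₁ S₂} (e S₁ S₂ v))))
  ; f-add = λ F F′ _ _ → ≋⇒InIdeal (assemble-+ n k F F′)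
  ; f-scale = λ c F _ → ≋⇒InIdeal (assemble-· n k c F)
  ; f-equiv = λ σ F _ → ≋⇒InIdeal (assemble-act n k σ F)
  ; f-inj = λ F F′ x y e S₁ S₂ v → fromMod occurs⇒ (null-of-assemble n k (λ S₁ S₂ → F S₁ S₂ -P F′ S₁ S₂)
      (λ S₁ S₂ v → sub-closed (ModDom-isSubspace (lamS n S₁ S₂)) (toMod span {F S₁ S₂} (x S₁ S₂ v)) (toMod span {F′ S₁ S₂} (y S₁ S₂ v)))
      (resp Ideal-isSubspace (≋-sym (assemble-sub n k F F′)) (toIdeal {p = assemble n k F -P assemble n k F′} e)) S₁ S₂ v)
  ; f-surj = λ y h → let (F , elem , i) = assemble-surjective n k y h in
      F , (λ S₁ S₂ v → fromMod occurs⇒ (elem S₁ S₂ v)) , fromIdeal i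
  }
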